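{- Let $H$ be either a spider, or a double broom with parameters $t$, $s_1$, $s_2$ satisfying $s_1<s_2$. Then for all sufficiently large $n$, \[ f(n,H)={\rm ex}(n,H). \]
   Context: For a graph $H$ and a red-blue coloring $c$ of the edges of the complete graph $K_n$, an edge of $K_n$ is called NIM-$H$ if it is not contained in any monochromatic copy of $H$. $E(c,H)$ is the set of NIM-$H$ edges under $c$, and $f(n,H)=\max\{|E(c,H)| : c \text{ a 2-edge-coloring of } K_n\}$. ${\rm ex}(n,H)$ denotes the Turán number of $H$, i.e. the maximum number of edges of an $n$-vertex graph containing no copy of $H$. A spider is a graph consisting of finitely many paths (each of positive length) sharing one common end vertex, all other vertices being distinct. A double broom with parameters $t,s_1,s_2$ is the graph consisting of a path on $t$ vertices together with $s_1$ distinct new leaves attached to one end vertex of the path and $s_2$ distinct new leaves attached to the other end vertex. -}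

module Defs where

open import Data.Nat using (ℕ; zero; suc; _+_; _≤_; _≡ᵇ_)
open import Data.Bool using (Bool; true; false; _∧_; _∨_)
open import Data.Fin using (Fin; toℕ; _<_)
open import Data.List using (List; []; _∷_; _++_; length; map)
open import Data.Nat.ListAction using (sum)
open import Data.List.Relation.Unary.Unique.Propositional using (Unique)
open import Data.List.Membership.Propositional using (_∈_)
open import Data.Product using (Σ; ∃; _×_; _,_)
open import Relation.Binary.PropositionalEquality using (_≡_)
open import Relation.Nullary using (¬_)
open import Function.Definitions using (Injective)

record Graph (k : ℕ) : Set where
  field
    adj : Fin k → Fin k → Bool

open Graph public

record IsSimple {k : ℕ} (G : Graph k) : Set where
  field
    symm    : ∀ u v → adj G u v ≡ adj G v u
    loopless : ∀ u → adj G u u ≡ false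

_==ₑ_ : ℕ × ℕ → ℕ × ℕ → Bool
(a , b) ==ₑ (c , d) = (a ≡ᵇ c) ∧ (b ≡ᵇ d)

memₑ : ℕ × ℕ → List (ℕ × ℕ) → Bool
memₑ e []       = false
memₑ e (x ∷ xs) = (e ==ₑ x) ∨ memₑ e xs

fromEdges : (k : ℕ) → List (ℕ × ℕ) → Graph k
fromEdges k es = record
  { adj = λ u v → memₑ (toℕ u , toℕ v) es ∨ memₑ (toℕ v , toℕ u) es }

-- Spiders.  A spider with legs of lengths suc l₁, …, suc lᵣ (r ≥ 1,
-- every leg of positive length).  Vertex 0 is the common end vertex
-- (the centre); the legs occupy consecutive blocks of labels.

chain : ℕ → ℕ → List (ℕ × ℕ)
chain s zero    = []
chain s (suc l) = (s , suc s) ∷ chain (suc s) l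

spiderEdges : ℕ → List ℕ → List (ℕ × ℕ)
spiderEdges o []       = []
spiderEdges o (l ∷ ls) =
  ((0 , suc o) ∷ chain (suc o) l) ++ spiderEdges (o + suc l) ls

spiderSize : List ℕ → ℕ
spiderSize ls = suc (sum (map suc ls))

spider : (l : ℕ) (ls : List ℕ) → Graph (spiderSize (l ∷ ls))
spider l ls = fromEdges (spiderSize (l ∷ ls)) (spiderEdges 0 (l ∷ ls))

-- Double brooms.  Path on t vertices 0,…,t-1 (t ≥ 1); s₁ leaves
-- t,…,t+s₁-1 attached to vertex 0; s₂ leaves t+s₁,…,t+s₁+s₂-1 attached
-- to vertex t-1.

leaves : ℕ → ℕ → ℕ → List (ℕ × ℕ)
leaves c start zero    = []
leaves c start (suc s) = (c , start) ∷ leaves c (suc start) s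

-- t = suc t'
doubleBroomEdges : ℕ → ℕ → ℕ → List (ℕ × ℕ)
doubleBroomEdges t' s₁ s₂ =
  chain 0 t' ++ leaves 0 (suc t') s₁ ++ leaves t' (suc t' + s₁) s₂

doubleBroom : (t' s₁ s₂ : ℕ) → Graph (suc t' + s₁ + s₂)
doubleBroom t' s₁ s₂ = fromEdges (suc t' + s₁ + s₂) (doubleBroomEdges t' s₁ s₂)

IsCopy : {k n : ℕ} → Graph k → Graph n → (Fin k → Fin n) → Set
IsCopy H G φ = Injective _≡_ _≡_ φ × (∀ a b → adj H a b ≡ true → adj G (φ a) (φ b) ≡ true)

Contains : {k n : ℕ} → Graph n → Graph k → Set
Contains G H = Σ _ λ φ → IsCopy H G φ

EdgeInCopy : {k n : ℕ} → Graph k → (Fin k → Fin n) → Fin n → Fin n → Set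
EdgeInCopy H φ u v = Σ _ λ a → Σ _ λ b → adj H a b ≡ true × φ a ≡ u × φ b ≡ v

-- Red/blue colourings of K_n: a symmetric Boolean function on pairs
-- (values on the diagonal are irrelevant).

record Coloring (n : ℕ) : Set where
  field
    col  : Fin n → Fin n → Bool
    csym : ∀ u v → col u v ≡ col v u

open Coloring public

IsMonoCopy : {k n : ℕ} → Graph k → Coloring n → Bool → (Fin k → Fin n) → Set
IsMonoCopy H c b φ =
  Injective _≡_ _≡_ φ × (∀ a a' → adj H a a' ≡ true → col c (φ a) (φ a') ≡ b)

NIM : {k n : ℕ} → Graph k → Coloring n → Fin n → Fin n → Set
NIM H c u v =
  ¬ (Σ Bool λ b → Σ _ λ φ → IsMonoCopy H c b φ × EdgeInCopy H φ u v)

-- Number of unordered pairs {u,v} (u ≠ v) satisfying a (symmetric)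
-- predicate P: enumerated as pairs (u , v) with u < v.

HasCard : {n : ℕ} → (Fin n → Fin n → Set) → ℕ → Set
HasCard {n} P m = Σ (List (Fin n × Fin n)) λ L →
    Unique L
  × length L ≡ m
  × (∀ u v → (u , v) ∈ L → (u < v) × P u v)
  × (∀ u v → u < v → P u v → (u , v) ∈ L)

IsMax : (ℕ → Set) → ℕ → Set
IsMax S m = S m × (∀ k → S k → k ≤ m)

IsF : {k : ℕ} → ℕ → Graph k → ℕ → Set
IsF n H = IsMax (λ m → Σ (Coloring n) λ c → HasCard (NIM H c) m)

IsEx : {k : ℕ} → ℕ → Graph k → ℕ → Set
IsEx n H = IsMax (λ m → Σ (Graph n) λ G →
  IsSimple G × ¬ Contains G H × HasCard (λ u v → adj G u v ≡ true) m)

EventuallyFeqEx : {k : ℕ} → Graph k → Set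
EventuallyFeqEx H = Σ ℕ λ N → ∀ n → N ≤ n → Σ ℕ λ m → IsF n H m × IsEx n H m

{-# OPTIONS --safe #-}
module Submission where

-- The NIM-graph of a colouring whose colour classes are the edges of an extremal graph and its complement shows f ≥ ex.
-- For the converse, Ramsey's theorem gives a large monochromatic clique Q, blue say. If u has many blue neighbours in Q,
-- then every blue edge at u is the pendant edge of a blue copy of H; so both ends of a blue NIM-edge are red to almost all of Q.
--
-- Spiders: the NIM-graph is H-free. In a copy of the spider made of NIM-edges, insert vertices of Q between the ends of the
-- blue edges and truncate the legs; this yields a red copy. To keep a red NIM-edge in it, keep the first red edge e of a leg
-- in its place, replace every second vertex before e by a vertex of Q and, if need be, the centre by a vertex of Q.
--
-- Double brooms (with s₁ ≥ 1; otherwise they are spiders): if the NIM-graph contains H, some vertex s has a blue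
-- NIM-neighbour s′ and a red NIM-neighbour. Then s and s′ are red to all but a bounded number of vertices, and only boundedly
-- many vertices have NIM-degree below (|H| − 2) / 2, since replacing them by cliques on |H| − 1 vertices would beat ex.
-- As s₁ < s₂, the other vertices have NIM-degree at least s₁ + ⌈t / 2⌉, which is just enough to build a red double broom
-- from s, s′, two NIM-paths and common neighbours of their ends.

open import Defs
open import Data.Nat using (ℕ; zero; suc; _+_; _*_; _∸_; _^_; _≤_; _<_; z≤n; s≤s; ⌈_/2⌉; ⌊_/2⌋)
open import Data.Nat.Properties hiding (_≟_)
open import Data.Bool using (Bool; true; false; not; _∧_; _∨_; T) renaming (_≟_ to _≟B_)
open import Data.Bool.Properties using (∨-comm)
open import Data.Fin as F using (Fin; toℕ; fromℕ<)
import Data.Fin.Properties as FP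
open import Data.List using (List; []; _∷_; [_]; _++_; length; map; concat; concatMap; filter; take; drop; reverse; allFin; replicate; cartesianProduct)
import Data.List.Properties as LP
open import Data.List.Relation.Unary.All as All using (All; []; _∷_)
import Data.List.Relation.Unary.All.Properties as AllP
open import Data.List.Relation.Unary.Any using (Any; here; there)
open import Data.List.Relation.Unary.AllPairs using ([]; _∷_)
open import Data.List.Relation.Unary.Unique.Propositional using (Unique)
import Data.List.Relation.Unary.Unique.Propositional.Properties as UP
open import Data.List.Membership.Propositional using (_∈_; _∉_; find; lose)
open import Data.List.Membership.Propositional.Properties
open import Data.List.Relation.Binary.Permutation.Propositional using (_↭_; ↭-sym; ↭-trans; ↭-refl; prep; ↭⇒↭ₛ)
import Data.List.Relation.Binary.Permutation.Propositional.Properties as PermP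
import Data.List.Relation.Binary.Permutation.Setoid.Properties as PermS
open import Data.Vec using (Vec; []; _∷_; lookup; tabulate)
import Data.Vec.Properties as VecP
open import Data.Nat.ListAction using (sum)
open import Data.Product using (Σ; ∃; _×_; _,_; proj₁; proj₂) renaming (swap to ×-swap)
open import Data.Sum using (_⊎_; inj₁; inj₂; [_,_]′)
open import Data.Empty using (⊥; ⊥-elim)
open import Data.Unit using (tt)
open import Function using (_∘_; id)
open import Relation.Binary using (tri<; tri≈; tri>)
open import Relation.Binary.PropositionalEquality hiding ([_]; J)
open import Relation.Nullary using (¬_; Dec; yes; no; contradiction; does)
open import Relation.Nullary.Decidable using (¬?; _×-dec_; _⊎-dec_; _→-dec_; map′; dec-true)

-- The obstacle for double brooms is the path towards `s`: the NIM-graph need not contain long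
-- paths. The way out is a trade-off. Let κ = ⌈t/2⌉, where `t` counts the edges of the path. Suppose
-- that NIM-paths on J vertices are plentiful but those on J + 1 vertices are not. Then the
-- NIM-neighbours of the head of a shorter path lie on that path or in a bounded set, and the
-- pigeonhole principle gives many paths whose heads share κ - J neighbours, the hubs. Two such
-- paths joined through `s′` have 2J + 1 vertices, each hub with a new head adds two, and one last
-- hub brings the total to 2κ ≥ t.
--
-- The bound s₁ < s₂ enters through the degrees: a vertex that is not worth replacing has NIM-degree
-- at least (t + s₁ + s₂ - 1) / 2, and this is at least s₁ + t / 2.
--
-- The Turán number and the NIM-edges are found by exhaustive search, so that no excluded middle is
-- assumed. The upper bounds are refutations, which allows the supply of paths to be asserted up to
-- double negation only.

-- Lists without repetition

unique-⊆⇒length≤ : {A : Set} {xs ys : List A} → Unique xs → (∀ {x} → x ∈ xs → x ∈ ys) → length xs ≤ length ys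
unique-⊆⇒length≤ {xs = []} _ _ = z≤n
unique-⊆⇒length≤ {A} {x ∷ xs} (px ∷ u) sub with ∈-∃++ (sub (here refl))
... | as , bs , refl = begin
    suc (length xs)            ≤⟨ s≤s (unique-⊆⇒length≤ u sub′) ⟩
    suc (length (as ++ bs))    ≡⟨ cong suc (LP.length-++ as) ⟩
    suc (length as + length bs) ≡⟨ +-suc (length as) (length bs) ⟨
    length as + suc (length bs) ≡⟨ LP.length-++ as ⟨
    length (as ++ x ∷ bs)      ∎
  where
  open ≤-Reasoning
  sub′ : ∀ {y} → y ∈ xs → y ∈ as ++ bs
  sub′ y∈ with ∈-++⁻ as (sub (there y∈))
  ... | inj₁ i = ∈-++⁺ˡ i
  ... | inj₂ (here refl) = contradiction refl (All.lookup px y∈)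
  ... | inj₂ (there i) = ∈-++⁺ʳ as i

unique-++ˡ : {A : Set} (xs : List A) {ys : List A} → Unique (xs ++ ys) → Unique xs
unique-++ˡ [] _ = []
unique-++ˡ (x ∷ xs) (p ∷ u) = AllP.++⁻ˡ xs p ∷ unique-++ˡ xs u

unique-++ʳ : {A : Set} (xs : List A) {ys : List A} → Unique (xs ++ ys) → Unique ys
unique-++ʳ [] u = u
unique-++ʳ (x ∷ xs) (_ ∷ u) = unique-++ʳ xs u

unique-++-disjoint : {A : Set} (xs : List A) {ys : List A} → Unique (xs ++ ys) → ∀ {x} → x ∈ xs → x ∉ ys
unique-++-disjoint (x ∷ xs) (p ∷ u) (here refl) y = All.lookup p (∈-++⁺ʳ xs y) refl
unique-++-disjoint (x ∷ xs) (p ∷ u) (there i) y = unique-++-disjoint xs u i y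

unique-++ : {A : Set} {xs ys : List A} → Unique xs → Unique ys → (∀ {x} → x ∈ xs → x ∉ ys) → Unique (xs ++ ys)
unique-++ u v d = UP.++⁺ u v (λ (i , j) → d i j)

unique-∷ : {A : Set} {x : A} {xs : List A} → x ∉ xs → Unique xs → Unique (x ∷ xs)
unique-∷ x∉ u = All.tabulate (λ { i refl → x∉ i }) ∷ u

∈-take : {A : Set} (m : ℕ) {xs : List A} {x : A} → x ∈ take m xs → x ∈ xs
∈-take (suc m) {y ∷ ys} (here p) = here p
∈-take (suc m) {y ∷ ys} (there p) = there (∈-take m p)

length-take≤ : {A : Set} (m : ℕ) {xs : List A} → m ≤ length xs → length (take m xs) ≡ m
length-take≤ m {xs} p = trans (LP.length-take m xs) (m≤n⇒m⊓n≡m p)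

nonempty-lookup : {A : Set} {m : ℕ} (xs : List A) → suc m ≤ length xs → ∃ λ x → x ∈ xs
nonempty-lookup (x ∷ xs) _ = x , here refl

-- The form in which most exceptions are counted: they only have to be listed, and the list may
-- contain repetitions and foreign elements.
length-filter-cover : {A : Set} {P : A → Set} (P? : ∀ x → Dec (P x)) {xs bad : List A} → Unique xs →
  (∀ {x} → x ∈ xs → P x ⊎ x ∈ bad) → length xs ≤ length (filter P? xs) + length bad
length-filter-cover P? {xs} {bad} u cov =
  subst (length xs ≤_) (LP.length-++ (filter P? xs)) (unique-⊆⇒length≤ u sub)
  where
  sub : ∀ {x} → x ∈ xs → x ∈ filter P? xs ++ bad
  sub i with cov i
  ... | inj₁ p = ∈-++⁺ˡ (∈-filter⁺ P? i p)
  ... | inj₂ b = ∈-++⁺ʳ (filter P? xs) b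

length-concatMap≤ : {A B : Set} (f : A → List B) (m : ℕ) (xs : List A) →
  (∀ {x} → x ∈ xs → length (f x) ≤ m) → length (concatMap f xs) ≤ length xs * m
length-concatMap≤ f m [] _ = z≤n
length-concatMap≤ f m (x ∷ xs) h =
  subst (_≤ m + length xs * m) (sym (LP.length-++ (f x)))
    (+-mono-≤ (h (here refl)) (length-concatMap≤ f m xs (h ∘ there)))

-- d is the value past the end of the list
nth : {A : Set} → A → List A → ℕ → A
nth d [] _ = d
nth d (x ∷ xs) zero = x
nth d (x ∷ xs) (suc i) = nth d xs i

nth-∈ : {A : Set} (d : A) (xs : List A) {i : ℕ} → i < length xs → nth d xs i ∈ xs
nth-∈ d (x ∷ xs) {zero} _ = here refl
nth-∈ d (x ∷ xs) {suc i} (s≤s p) = there (nth-∈ d xs p)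

nth-injective : {A : Set} (d : A) {xs : List A} → Unique xs → ∀ {i j} → i < length xs → j < length xs →
  nth d xs i ≡ nth d xs j → i ≡ j
nth-injective d {x ∷ xs} u {zero} {zero} _ _ _ = refl
nth-injective d {x ∷ xs} (p ∷ u) {zero} {suc j} _ (s≤s q) e = contradiction e (All.lookup p (nth-∈ d xs q))
nth-injective d {x ∷ xs} (p ∷ u) {suc i} {zero} (s≤s q) _ e = contradiction (sym e) (All.lookup p (nth-∈ d xs q))
nth-injective d {x ∷ xs} (p ∷ u) {suc i} {suc j} (s≤s q) (s≤s r) e = cong suc (nth-injective d u q r e)

nth-++ʳ : {A : Set} (d : A) (xs ys : List A) (i : ℕ) → nth d (xs ++ ys) (length xs + i) ≡ nth d ys i
nth-++ʳ d [] ys i = refl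
nth-++ʳ d (x ∷ xs) ys i = nth-++ʳ d xs ys i

nth-++ˡ : {A : Set} (d : A) (xs ys : List A) {i : ℕ} → i < length xs → nth d (xs ++ ys) i ≡ nth d xs i
nth-++ˡ d (x ∷ xs) ys {zero} _ = refl
nth-++ˡ d (x ∷ xs) ys {suc i} (s≤s p) = nth-++ˡ d xs ys p

double-cancel-≤ : ∀ {a b} → a + a ≤ b + b → a ≤ b
double-cancel-≤ h = ≮⇒≥ λ lt → <⇒≱ (+-mono-< lt lt) h

bool-cases : (x b : Bool) → x ≡ b ⊎ x ≡ not b
bool-cases false false = inj₁ refl
bool-cases false true = inj₂ refl
bool-cases true false = inj₂ refl
bool-cases true true = inj₁ refl

not-≢ : (b : Bool) → not b ≢ b
not-≢ false ()
not-≢ true ()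

-- Exhaustive search over finite types

Searchable : Set → Set₁
Searchable A = (P : A → Set) → (∀ a → Dec (P a)) → Dec (Σ A P)

search-Bool : Searchable Bool
search-Bool P P? with P? true | P? false
... | yes p | _ = yes (true , p)
... | no _ | yes q = yes (false , q)
... | no ¬p | no ¬q = no λ { (true , p) → ¬p p ; (false , q) → ¬q q }

search-Fin : (n : ℕ) → Searchable (Fin n)
search-Fin n P P? = FP.any? P?

-- Maps out of a finite set are searched as vectors, because without extensionality a predicate need
-- not agree on pointwise equal functions.
search-Vec : {A : Set} → Searchable A → (k : ℕ) → Searchable (Vec A k)
search-Vec s zero P P? = map′ (λ p → [] , p) (λ { ([] , p) → p }) (P? [])
search-Vec s (suc k) P P? =
  map′ (λ (a , v , p) → (a ∷ v) , p) (λ { ((a ∷ v) , p) → a , v , p })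
    (s _ λ a → search-Vec s k _ λ v → P? (a ∷ v))

bounded-max : (S : ℕ → Set) → (∀ m → Dec (S m)) → (B : ℕ) → (∀ m → S m → m ≤ B) → S 0 → Σ ℕ (IsMax S)
bounded-max S S? zero bd s0 = 0 , s0 , bd
bounded-max S S? (suc B) bd s0 with S? (suc B)
... | yes s = suc B , s , bd
... | no ¬s = bounded-max S S? B (λ m s → ≤-pred (≤∧≢⇒< (bd m s) λ { refl → ¬s s })) s0

-- Graphs given by edge lists

memₑ⁻ : ∀ e es → memₑ e es ≡ true → e ∈ es
memₑ⁻ (a , b) ((c , d) ∷ es) p with (a , b) ==ₑ (c , d) in eq
... | false = there (memₑ⁻ _ es p)
... | true with a Data.Nat.≟ c | b Data.Nat.≟ d
... | yes refl | yes refl = here refl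
... | no a≢c | _ = contradiction (≡ᵇ⇒≡ a c (subst T (sym (∧-trueˡ eq)) tt)) a≢c
  where
  ∧-trueˡ : ∀ {x y} → x ∧ y ≡ true → x ≡ true
  ∧-trueˡ {true} _ = refl
... | yes _ | no b≢d = contradiction (≡ᵇ⇒≡ b d (subst T (sym (∧-trueʳ eq)) tt)) b≢d
  where
  ∧-trueʳ : ∀ {x y} → x ∧ y ≡ true → y ≡ true
  ∧-trueʳ {true} {true} _ = refl

T⇒≡ : ∀ {x} → T x → x ≡ true
T⇒≡ {true} _ = refl

memₑ⁺ : ∀ e es → e ∈ es → memₑ e es ≡ true
memₑ⁺ (a , b) (_ ∷ es) (here refl) rewrite T⇒≡ (≡⇒≡ᵇ a a refl) | T⇒≡ (≡⇒≡ᵇ b b refl) = refl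
memₑ⁺ e (x ∷ es) (there i) with e ==ₑ x
... | true = refl
... | false = memₑ⁺ e es i

∨-true⁻ : ∀ x y → x ∨ y ≡ true → x ≡ true ⊎ y ≡ true
∨-true⁻ true y _ = inj₁ refl
∨-true⁻ false y p = inj₂ p

adj-fromEdges⁻ : ∀ {K} es (a b : Fin K) → adj (fromEdges K es) a b ≡ true →
  (toℕ a , toℕ b) ∈ es ⊎ (toℕ b , toℕ a) ∈ es
adj-fromEdges⁻ es a b p with ∨-true⁻ _ _ p
... | inj₁ q = inj₁ (memₑ⁻ _ es q)
... | inj₂ q = inj₂ (memₑ⁻ _ es q)

adj-fromEdges⁺ : ∀ {K} es (a b : Fin K) → (toℕ a , toℕ b) ∈ es → adj (fromEdges K es) a b ≡ true
adj-fromEdges⁺ es a b i rewrite memₑ⁺ _ es i = refl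

adj-fromEdges-sym : ∀ {K} es (a b : Fin K) → adj (fromEdges K es) a b ≡ adj (fromEdges K es) b a
adj-fromEdges-sym es a b = ∨-comm (memₑ (toℕ a , toℕ b) es) _

Bounded : ℕ → List (ℕ × ℕ) → Set
Bounded K es = ∀ {i j} → (i , j) ∈ es → i < K × j < K

Loopless : List (ℕ × ℕ) → Set
Loopless es = ∀ {i j} → (i , j) ∈ es → i ≢ j

-- An embedding of the graph with vertices 0,…,K−1 and edge list es into a relation,
-- as a labelling of all of ℕ with junk values from K on
Emb : {V : Set} → (V → V → Set) → ℕ → List (ℕ × ℕ) → (ℕ → V) → Set
Emb E K es f = (∀ {i j} → i < K → j < K → f i ≡ f j → i ≡ j) × (∀ {i j} → (i , j) ∈ es → E (f i) (f j))

module _ {n : ℕ} {K : ℕ} {es : List (ℕ × ℕ)} where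

  private H = fromEdges K es

  label-injective : {f : ℕ → Fin n} → (∀ {i j} → i < K → j < K → f i ≡ f j → i ≡ j) →
    ∀ {a b : Fin K} → f (toℕ a) ≡ f (toℕ b) → a ≡ b
  label-injective inj {a} {b} e = FP.toℕ-injective (inj (FP.toℕ<n a) (FP.toℕ<n b) e)

  emb⇒mono : (c : Coloring n) {b : Bool} {f : ℕ → Fin n} →
    Emb (λ x y → col c x y ≡ b) K es f → IsMonoCopy H c b (f ∘ toℕ)
  emb⇒mono c em = label-injective (proj₁ em) , λ a a' p → case′ (adj-fromEdges⁻ es a a' p)
    where
    case′ : ∀ {a a'} → (toℕ a , toℕ a') ∈ es ⊎ (toℕ a' , toℕ a) ∈ es → col c _ _ ≡ _
    case′ (inj₁ i) = proj₂ em i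
    case′ (inj₂ i) = trans (csym c _ _) (proj₂ em i)

  edge-inCopy : (f : ℕ → Fin n) → Bounded K es → ∀ {i j} → (i , j) ∈ es → EdgeInCopy H (f ∘ toℕ) (f i) (f j)
  edge-inCopy f bd i∈ with bd i∈
  ... | i<K , j<K = fromℕ< i<K , fromℕ< j<K ,
    adj-fromEdges⁺ es _ _ (subst₂ (λ x y → (x , y) ∈ es) (sym (FP.toℕ-fromℕ< i<K)) (sym (FP.toℕ-fromℕ< j<K)) i∈) ,
    cong f (FP.toℕ-fromℕ< i<K) , cong f (FP.toℕ-fromℕ< j<K)

  NIM-sym : (c : Coloring n) → ∀ {u v} → NIM H c u v → NIM H c v u
  NIM-sym c nim (b , φ , mono , x , y , p , q , r) =
    nim (b , φ , mono , y , x , trans (adj-fromEdges-sym es y x) p , r , q)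

  emb⇒¬NIM : (c : Coloring n) → Bounded K es → {b : Bool} {f : ℕ → Fin n} →
    Emb (λ x y → col c x y ≡ b) K es f → ∀ {i j} → (i , j) ∈ es → ¬ NIM H c (f i) (f j)
  emb⇒¬NIM c bd {b} {f} em i∈ nim = nim (b , _ , emb⇒mono c em , edge-inCopy f bd i∈)

extend : {A : Set} {K : ℕ} → (Fin (suc K) → A) → ℕ → A
extend {K = K} φ i with i Data.Nat.<? suc K
... | yes p = φ (fromℕ< p)
... | no _ = φ F.zero

extend-toℕ : {A : Set} {K : ℕ} (φ : Fin (suc K) → A) {i : ℕ} (p : i < suc K) → extend φ i ≡ φ (fromℕ< p)
extend-toℕ {K = K} φ {i} p with i Data.Nat.<? suc K
... | yes q = cong φ (FP.fromℕ<-cong i i refl q p)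
... | no ¬q = contradiction p ¬q

copy⇒emb : {n K : ℕ} {es : List (ℕ × ℕ)} → Bounded (suc K) es → {E : Fin n → Fin n → Set} (φ : Fin (suc K) → Fin n) →
  (∀ {a b} → φ a ≡ φ b → a ≡ b) → (∀ a b → adj (fromEdges (suc K) es) a b ≡ true → E (φ a) (φ b)) →
  Emb E (suc K) es (extend φ)
copy⇒emb {K = K} {es} bd {E} φ inj ed = inj′ , ed′
  where
  inj′ : ∀ {i j} → i < suc K → j < suc K → extend φ i ≡ extend φ j → i ≡ j
  inj′ p q e = FP.fromℕ<-injective _ _ p q (inj (trans (sym (extend-toℕ φ p)) (trans e (extend-toℕ φ q))))
  ed′ : ∀ {i j} → (i , j) ∈ es → E (extend φ i) (extend φ j)
  ed′ i∈ with bd i∈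
  ... | p , q = subst₂ E (sym (extend-toℕ φ p)) (sym (extend-toℕ φ q))
    (ed _ _ (adj-fromEdges⁺ es _ _ (subst₂ (λ x y → (x , y) ∈ es) (sym (FP.toℕ-fromℕ< p)) (sym (FP.toℕ-fromℕ< q)) i∈)))

-- Cardinalities of sets of unordered pairs

pairs : (n : ℕ) → List (Fin n × Fin n)
pairs n = filter (λ p → proj₁ p FP.<? proj₂ p) (cartesianProduct (allFin n) (allFin n))

∈-pairs : ∀ {n} {u v : Fin n} → u F.< v → (u , v) ∈ pairs n
∈-pairs u<v = ∈-filter⁺ (λ p → proj₁ p FP.<? proj₂ p) (∈-cartesianProduct⁺ (∈-allFin _) (∈-allFin _)) u<v

hasCard-exists : ∀ {n} {P : Fin n → Fin n → Set} → (∀ u v → Dec (P u v)) → Σ ℕ (HasCard P)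
hasCard-exists {n} {P} P? = _ , filter Q? (pairs n) ,
  UP.filter⁺ Q? (UP.filter⁺ lt? (UP.cartesianProduct⁺ (UP.allFin⁺ n) (UP.allFin⁺ n))) , refl ,
  (λ u v i → proj₂ (∈-filter⁻ lt? {xs = all} (proj₁ (∈-filter⁻ Q? {xs = pairs n} i))) , proj₂ (∈-filter⁻ Q? {xs = pairs n} i)) ,
  λ u v u<v p → ∈-filter⁺ Q? (∈-pairs u<v) p
  where
  Q? = λ (p : Fin n × Fin n) → P? (proj₁ p) (proj₂ p)
  lt? = λ (p : Fin n × Fin n) → proj₁ p FP.<? proj₂ p
  all = cartesianProduct (allFin n) (allFin n)

hasCard-mono : ∀ {n} {P Q : Fin n → Fin n → Set} {k m} → (∀ u v → u F.< v → P u v → Q u v) →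
  HasCard P k → HasCard Q m → k ≤ m
hasCard-mono {P = P} P⊆Q (L , u , refl , s , _) (L' , _ , refl , _ , c) = unique-⊆⇒length≤ u λ {x} i →
  let u<v , p = s (proj₁ x) (proj₂ x) i in c _ _ u<v (P⊆Q _ _ u<v p)

hasCard-resp : ∀ {n} {P Q : Fin n → Fin n → Set} {k} → (∀ u v → u F.< v → P u v → Q u v) →
  (∀ u v → u F.< v → Q u v → P u v) → HasCard P k → HasCard Q k
hasCard-resp to from (L , u , e , s , c) = L , u , e ,
  (λ x y i → proj₁ (s x y i) , to x y (proj₁ (s x y i)) (proj₂ (s x y i))) ,
  λ x y lt q → c x y lt (from x y lt q)

hasCard? : ∀ {n} {P : Fin n → Fin n → Set} → (∀ u v → Dec (P u v)) → ∀ m → Dec (HasCard P m)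
hasCard? P? m with hasCard-exists P?
... | k , h with k Data.Nat.≟ m
... | yes refl = yes h
... | no k≢m = no λ h' → k≢m (≤-antisym (hasCard-mono (λ _ _ _ p → p) h h') (hasCard-mono (λ _ _ _ p → p) h' h))

-- Decidability of copies and existence of the Turán number

injective? : ∀ {k n} (φ : Fin k → Fin n) → Dec (∀ {a b} → φ a ≡ φ b → a ≡ b)
injective? φ = map′ (λ f {a} {b} → f a b) (λ f a b → f)
  (FP.all? λ a → FP.all? λ b → (φ a FP.≟ φ b) →-dec (a FP.≟ b))

contains? : ∀ {k n} (G : Graph n) (H : Graph k) → Dec (Contains G H)
contains? {k} {n} G H = map′ (λ (v , c) → lookup v , c)
  (λ (φ , inj , ed) → tabulate φ ,
    (λ {a} {b} e → inj (trans (sym (VecP.lookup∘tabulate φ a)) (trans e (VecP.lookup∘tabulate φ b)))) ,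
    λ a b p → trans (cong₂ (adj G) (VecP.lookup∘tabulate φ a) (VecP.lookup∘tabulate φ b)) (ed a b p))
  (search-Vec (search-Fin n) k (λ v → IsCopy H G (lookup v)) λ v →
    injective? (lookup v) ×-dec FP.all? λ a → FP.all? λ b → (adj H a b ≟B true) →-dec (adj G _ _ ≟B true))

abstract
  NIM? : ∀ {k n} (H : Graph k) (c : Coloring n) (u v : Fin n) → Dec (NIM H c u v)
  NIM? {k} {n} H c u v = ¬? (map′
      (λ (b , w , m) → b , lookup w , m)
      (λ (b , φ , (inj , ed) , x , y , p , q , r) → let l = VecP.lookup∘tabulate φ in b , tabulate φ ,
        ((λ {a} {b} e → inj (trans (sym (l a)) (trans e (l b)))) ,
         λ a a' h → trans (cong₂ (col c) (l a) (l a')) (ed a a' h)) ,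
        x , y , p , trans (l x) q , trans (l y) r)
    (search-Bool _ λ b → search-Vec (search-Fin n) k _ λ w →
      (injective? (lookup w) ×-dec FP.all? λ a → FP.all? λ a' → (adj H a a' ≟B true) →-dec (col c _ _ ≟B b))
      ×-dec FP.any? λ x → FP.any? λ y → (adj H x y ≟B true) ×-dec ((lookup w x FP.≟ u) ×-dec (lookup w y FP.≟ v))))

fromMatrix : ∀ {n} → Vec (Vec Bool n) n → Graph n
fromMatrix M = record { adj = λ u v → lookup (lookup M u) v }

module _ {k : ℕ} (H : Graph k) (n : ℕ) where

  private
    Q : Graph n → ℕ → Set
    Q G m = IsSimple G × ¬ Contains G H × HasCard (λ u v → adj G u v ≡ true) m

    Q? : ∀ G m → Dec (Q G m)
    Q? G m = map′ (λ (s , l) → record { symm = s ; loopless = l }) (λ s → IsSimple.symm s , IsSimple.loopless s)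
        ((FP.all? λ u → FP.all? λ v → adj G u v ≟B adj G v u) ×-dec (FP.all? λ u → adj G u u ≟B false))
      ×-dec (¬? (contains? G H) ×-dec hasCard? (λ u v → adj G u v ≟B true) m)

    Q-resp : ∀ {G G' m} → (∀ u v → adj G u v ≡ adj G' u v) → Q G m → Q G' m
    Q-resp e (s , f , h) =
      record { symm = λ u v → trans (sym (e u v)) (trans (IsSimple.symm s u v) (e v u))
             ; loopless = λ u → trans (sym (e u u)) (IsSimple.loopless s u) } ,
      (λ (φ , inj , ed) → f (φ , inj , λ a b p → trans (e _ _) (ed a b p))) ,
      hasCard-resp (λ u v _ p → trans (sym (e u v)) p) (λ u v _ p → trans (e u v) p) h

    matrix : Graph n → Vec (Vec Bool n) n
    matrix G = tabulate λ u → tabulate (adj G u)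

    matrix-adj : ∀ G u v → adj G u v ≡ adj (fromMatrix (matrix G)) u v
    matrix-adj G u v = sym (trans (cong (λ r → lookup r v) (VecP.lookup∘tabulate _ u)) (VecP.lookup∘tabulate _ v))

  -- The edge of `H` makes the edgeless graph `H`-free, so 0 is attained; `pairs n` bounds all edge
  -- numbers, and adjacency matrices make the graphs searchable.
  isEx-exists : (∃ λ a → ∃ λ b → adj H a b ≡ true) → Σ ℕ (IsEx n H)
  isEx-exists (a , b , ab) = bounded-max (λ m → Σ (Graph n) λ G → Q G m)
    (λ m → map′ (λ (M , q) → fromMatrix M , q) (λ (G , q) → matrix G , Q-resp {G} (matrix-adj G) q)
      (search-Vec (search-Vec search-Bool n) n _ λ M → Q? (fromMatrix M) m))
    (length (pairs n)) (λ { m (G , _ , _ , L , u , refl , s , _) →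
      unique-⊆⇒length≤ u λ i → ∈-pairs (proj₁ (s _ _ i)) })
    (record { adj = λ _ _ → false } , record { symm = λ _ _ → refl ; loopless = λ _ → refl } ,
     (λ (φ , _ , ed) → contradiction (ed a b ab) λ ()) ,
     [] , [] , refl , (λ _ _ ()) , λ _ _ _ ())

-- The NIM-graph and the reduction to an upper bound

-- The second factor removes the diagonal: for loopless `H` no edge of a copy has equal ends, so
-- `NIM` holds there vacuously.
nimGraph : ∀ {k n} → Graph k → Coloring n → Graph n
nimGraph H c = record { adj = λ u v → does (NIM? H c u v) ∧ not (does (u FP.≟ v)) }

does-true : {A : Set} (d : Dec A) → does d ≡ true → A
does-true (yes a) _ = a

∧-true⁻ : ∀ x {y} → x ∧ y ≡ true → x ≡ true × y ≡ true
∧-true⁻ true {true} _ = refl , refl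

does-¬ : {A : Set} (d : Dec A) → not (does d) ≡ true → ¬ A
does-¬ (no ¬a) _ = ¬a

¬-does : {A : Set} (d : Dec A) → ¬ A → not (does d) ≡ true
¬-does (no _) _ = refl
¬-does (yes a) ¬a = contradiction a ¬a

module _ {n K : ℕ} {es : List (ℕ × ℕ)} (bd : Bounded (suc K) es) {i₀ j₀ : ℕ} (e₀ : (i₀ , j₀) ∈ es) where

  private H = fromEdges (suc K) es

  nimGraph⁻ : (c : Coloring n) {u v : Fin n} → adj (nimGraph H c) u v ≡ true → NIM H c u v × u ≢ v
  nimGraph⁻ c {u} {v} p with ∧-true⁻ (does (NIM? H c u v)) p
  ... | q , r = does-true (NIM? H c u v) q , does-¬ (u FP.≟ v) r

  nimGraph⁺ : (c : Coloring n) {u v : Fin n} → NIM H c u v → u ≢ v → adj (nimGraph H c) u v ≡ true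
  nimGraph⁺ c {u} {v} p q = cong₂ _∧_ (dec-true (NIM? H c u v) p) (¬-does (u FP.≟ v) q)

  nimGraph-simple : (c : Coloring n) → IsSimple (nimGraph H c)
  nimGraph-simple c = record { symm = sy ; loopless = λ u → lp u }
    where
    lp : ∀ u → adj (nimGraph H c) u u ≡ false
    lp u with adj (nimGraph H c) u u in eq
    ... | false = refl
    ... | true = contradiction refl (proj₂ (nimGraph⁻ c eq))
    one : ∀ u v → adj (nimGraph H c) u v ≡ true → adj (nimGraph H c) v u ≡ true
    one u v p with nimGraph⁻ c p
    ... | q , r = nimGraph⁺ c (NIM-sym {es = es} c q) (r ∘ sym)
    sy : ∀ u v → adj (nimGraph H c) u v ≡ adj (nimGraph H c) v u
    sy u v with adj (nimGraph H c) u v in e₁ | adj (nimGraph H c) v u in e₂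
    ... | true | true = refl
    ... | false | false = refl
    ... | true | false = trans (sym (one u v e₁)) e₂
    ... | false | true = trans (sym e₁) (one v u e₂)

  nimGraph-free⇒≤ex : (c : Coloring n) → ¬ Contains (nimGraph H c) H →
    ∀ {m k} → IsEx n H m → HasCard (NIM H c) k → k ≤ m
  nimGraph-free⇒≤ex c free (_ , ub) h = ub _ (nimGraph H c , nimGraph-simple c , free ,
    hasCard-resp (λ u v u<v p → nimGraph⁺ c p (FP.<⇒≢ u<v)) (λ u v _ p → proj₁ (nimGraph⁻ c p)) h)

-- The hypothesis refutes `m < k` instead of asserting `k ≤ m` because, for double brooms, the bound
-- on the number of low-degree vertices starts from that strict inequality.
eventually-feqex : {K : ℕ} {es : List (ℕ × ℕ)} → Bounded (suc K) es → {i₀ j₀ : ℕ} → (i₀ , j₀) ∈ es →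
  (N : ℕ) → (∀ n → N ≤ n → (c : Coloring n) → ∀ {m k} → IsEx n (fromEdges (suc K) es) m →
    HasCard (NIM (fromEdges (suc K) es) c) k → ¬ m < k) → EventuallyFeqEx (fromEdges (suc K) es)
eventually-feqex {K} {es} bd e₀ N upper = N , λ n N≤n → main n N≤n (isEx-exists H n edge)
  where
  H = fromEdges (suc K) es
  edge : ∃ λ a → ∃ λ b → adj H a b ≡ true
  edge with bd e₀
  ... | p , q = fromℕ< p , fromℕ< q ,
    adj-fromEdges⁺ es _ _ (subst₂ (λ x y → (x , y) ∈ es) (sym (FP.toℕ-fromℕ< p)) (sym (FP.toℕ-fromℕ< q)) e₀)
  main : ∀ n → N ≤ n → Σ ℕ (IsEx n H) → Σ ℕ λ m → IsF n H m × IsEx n H m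
  main n N≤n (m , ex@((G , simple , free , card) , _)) =
    m , ((c , subst (HasCard (NIM H c)) (≤-antisym (≮⇒≥ (upper n N≤n c ex (proj₂ h))) m≤k) (proj₂ h)) ,
         λ k (c' , h') → ≮⇒≥ (upper n N≤n c' ex h')) , ex
    where
    c : Coloring n
    c = record { col = adj G ; csym = IsSimple.symm simple }
    h : Σ ℕ (HasCard (NIM H c))
    h = hasCard-exists (NIM? H c)
    m≤k : m ≤ proj₁ h
    m≤k = hasCard-mono nim card (proj₂ h)
      where
      nim : ∀ u v → u F.< v → adj G u v ≡ true → NIM H c u v
      -- A copy in colour `true` is a copy in the extremal graph, and a copy in colour `false`
      -- cannot pass through one of its edges.
      nim u v _ uv (true , φ , mono , _) = free (φ , mono)
      nim u v _ uv (false , φ , (inj , ed) , x , y , xy , refl , refl) =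
        contradiction (trans (sym uv) (ed x y xy)) λ ()

-- Ramsey's theorem for two colours

-- The Erdős-Szekeres recursion, with one more for the vertex whose two neighbourhoods are compared.
ramseyBound : ℕ → ℕ → ℕ
ramseyBound zero b = 0
ramseyBound (suc a) zero = 0
ramseyBound (suc a) (suc b) = suc (ramseyBound a (suc b) + ramseyBound (suc a) b)

MonoClique : ∀ {n} → Coloring n → Bool → List (Fin n) → Set
MonoClique c b Q = Unique Q × (∀ {x y} → x ∈ Q → y ∈ Q → x ≢ y → col c x y ≡ b)

clique-∷ : ∀ {n} (c : Coloring n) {b x Q} → x ∉ Q → (∀ {y} → y ∈ Q → col c x y ≡ b) → MonoClique c b Q →
  MonoClique c b (x ∷ Q)
clique-∷ c {b} {x} {Q} x∉ all (u , cl) = unique-∷ x∉ u , cl′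
  where
  cl′ : ∀ {y z} → y ∈ x ∷ Q → z ∈ x ∷ Q → y ≢ z → col c y z ≡ b
  cl′ (here refl) (here refl) ne = contradiction refl ne
  cl′ (here refl) (there j) _ = all j
  cl′ (there i) (here refl) _ = trans (csym c _ _) (all i)
  cl′ (there i) (there j) ne = cl i j ne

CliqueIn : ∀ {n} → Coloring n → List (Fin n) → Bool → ℕ → Set
CliqueIn c xs b a = ∃ λ Q → length Q ≡ a × MonoClique c b Q × (∀ {x} → x ∈ Q → x ∈ xs)

ramsey-list : ∀ {n} (c : Coloring n) (a b : ℕ) (xs : List (Fin n)) → Unique xs → ramseyBound a b ≤ length xs →
  CliqueIn c xs true a ⊎ CliqueIn c xs false b
ramsey-list c zero b xs u le = inj₁ ([] , refl , ([] , λ ()) , λ ())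
ramsey-list c (suc a) zero xs u le = inj₂ ([] , refl , ([] , λ ()) , λ ())
ramsey-list c (suc a) (suc b) (x ∷ xs) (x∉ ∷ u) (s≤s le) = result
  where
  C? = λ β y → col c x y ≟B β
  N : Bool → List _
  N β = filter (C? β) xs
  extend-clique : ∀ {β m} → CliqueIn c (N β) β m → CliqueIn c (x ∷ xs) β (suc m)
  extend-clique {β} (Q , e , cl , sub) = x ∷ Q , cong suc e ,
    clique-∷ c (λ i → All.lookup x∉ (proj₁ (∈-filter⁻ (C? β) (sub i))) refl)
      (λ i → proj₂ (∈-filter⁻ (C? β) {xs = xs} (sub i))) cl ,
    λ { (here p) → here p ; (there i) → there (proj₁ (∈-filter⁻ (C? β) (sub i))) }
  weaken : ∀ {β γ m} → CliqueIn c (N γ) β m → CliqueIn c (x ∷ xs) β m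
  weaken {γ = γ} (Q , e , cl , sub) = Q , e , cl , λ i → there (proj₁ (∈-filter⁻ (C? γ) (sub i)))
  cover : length xs ≤ length (N true) + length (N false)
  cover = length-filter-cover (C? true) u λ {y} i → case (bool-cases (col c x y) true) i
    where
    case : ∀ {y} → col c x y ≡ true ⊎ col c x y ≡ false → y ∈ xs → col c x y ≡ true ⊎ y ∈ N false
    case (inj₁ p) _ = inj₁ p
    case (inj₂ p) i = inj₂ (∈-filter⁺ (C? false) i p)
  result : CliqueIn c (x ∷ xs) true (suc a) ⊎ CliqueIn c (x ∷ xs) false (suc b)
  result with ≤-<-connex (ramseyBound a (suc b)) (length (N true))
  ... | inj₁ p with ramsey-list c a (suc b) (N true) (UP.filter⁺ (C? true) u) p
  ...   | inj₁ q = inj₁ (extend-clique q)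
  ...   | inj₂ q = inj₂ (weaken q)
  result | inj₂ p with ramsey-list c (suc a) b (N false) (UP.filter⁺ (C? false) u)
           (+-cancelˡ-≤ (ramseyBound a (suc b)) _ _ (≤-trans le (≤-trans cover (+-monoˡ-≤ _ (<⇒≤ p)))))
  ...   | inj₁ q = inj₁ (weaken q)
  ...   | inj₂ q = inj₂ (extend-clique q)

ramsey : ∀ {n} (c : Coloring n) (m : ℕ) → ramseyBound m m ≤ n →
  ∃ λ b → ∃ λ Q → length Q ≡ m × MonoClique c b Q
ramsey {n} c m le with ramsey-list c m m (allFin n) (UP.allFin⁺ n) (subst (ramseyBound m m ≤_) (sym (LP.length-tabulate id)) le)
... | inj₁ (Q , e , cl , _) = true , Q , e , cl
... | inj₂ (Q , e , cl , _) = false , Q , e , cl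

-- Embeddings with a prescribed pendant edge

InjectiveBelow : {V : Set} → ℕ → (ℕ → V) → Set
InjectiveBelow K f = ∀ {i j} → i < K → j < K → f i ≡ f j → i ≡ j

_[_↦_] : {V : Set} → (ℕ → V) → ℕ → V → ℕ → V
(f [ a ↦ w ]) i with i Data.Nat.≟ a
... | yes _ = w
... | no _ = f i

update-≡ : {V : Set} (f : ℕ → V) (a : ℕ) (w : V) → (f [ a ↦ w ]) a ≡ w
update-≡ f a w with a Data.Nat.≟ a
... | yes _ = refl
... | no ne = contradiction refl ne

update-≢ : {V : Set} (f : ℕ → V) (a : ℕ) (w : V) {i : ℕ} → i ≢ a → (f [ a ↦ w ]) i ≡ f i
update-≢ f a w {i} ne with i Data.Nat.≟ a
... | yes e = contradiction e ne
... | no _ = refl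

update-injective : {V : Set} {K : ℕ} (f : ℕ → V) (a : ℕ) (w : V) → InjectiveBelow K f →
  (∀ {i} → i < K → f i ≢ w) → InjectiveBelow K (f [ a ↦ w ])
update-injective f a w inj avoid {i} {j} p q e with i Data.Nat.≟ a | j Data.Nat.≟ a
... | yes refl | yes refl = refl
... | yes _ | no _ = contradiction (sym e) (avoid q)
... | no _ | yes _ = contradiction e (avoid p)
... | no _ | no _ = inj p q e

update-avoids : {V : Set} {K : ℕ} (f : ℕ → V) (a : ℕ) (w x : V) → w ≢ x →
  (∀ {i} → i < K → f i ≢ x) → ∀ {i} → i < K → (f [ a ↦ w ]) i ≢ x
update-avoids f a w x ne avoid {i} p with i Data.Nat.≟ a
... | yes _ = ne
... | no _ = avoid p

PendantAt : List (ℕ × ℕ) → ℕ → ℕ → Set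
PendantAt es a b = ∀ {i j} → (i , j) ∈ es → (i ≡ a → j ≡ b) × (j ≡ a → i ≡ b)

-- Only the edge to `b` constrains the image of the leaf `a`, so `w` has to be related to `u` alone.
-- This is the common core of the clique version and the bipartite version below.
pendant-update : {V : Set} {E : V → V → Set} → (∀ {x y} → E x y → E y x) → {K : ℕ} {es : List (ℕ × ℕ)} →
  Bounded K es → Loopless es → {a b : ℕ} → PendantAt es a b → a ≢ b →
  (g : ℕ → V) → InjectiveBelow K g → (u w : V) → u ≢ w → (∀ {i} → i < K → g i ≢ u) → (∀ {i} → i < K → g i ≢ w) →
  (∀ {i j} → (i , j) ∈ es → i ≢ b → j ≢ b → E (g i) (g j)) →
  (∀ {i j} → (i , j) ∈ es → (i ≡ b → E u (g j)) × (j ≡ b → E u (g i))) →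
  E u w → Emb E K es ((g [ b ↦ u ]) [ a ↦ w ])
pendant-update {E = E} sy bd ll {a} {b} pend a≢b g inj u w u≢w gu gw ee eu uw =
  update-injective _ a w (update-injective g b u inj gu) (update-avoids g b u w u≢w gw) , edge
  where
  edge : ∀ {i j} → (i , j) ∈ _ → E (((g [ b ↦ u ]) [ a ↦ w ]) i) (((g [ b ↦ u ]) [ a ↦ w ]) j)
  edge {i} {j} ij with i Data.Nat.≟ a | j Data.Nat.≟ a
  ... | yes refl | yes refl = contradiction refl (ll ij)
  ... | yes refl | no _ with proj₁ (pend ij) refl
  ...   | refl rewrite update-≡ g b u = sy uw
  edge {i} {j} ij | no _ | yes refl with proj₂ (pend ij) refl
  ...   | refl rewrite update-≡ g b u = uw
  edge {i} {j} ij | no _ | no _ with i Data.Nat.≟ b | j Data.Nat.≟ b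
  ... | yes refl | yes refl = contradiction refl (ll ij)
  ... | yes p | no _ = proj₁ (eu ij) p
  ... | no _ | yes p = sy (proj₂ (eu ij) p)
  ... | no p | no q = ee ij p q

pendant-clique-emb : ∀ {n} (c : Coloring n) {β : Bool} {K : ℕ} {es : List (ℕ × ℕ)} →
  Bounded K es → Loopless es → {a b : ℕ} → PendantAt es a b → a ≢ b →
  {Q : List (Fin n)} → MonoClique c β Q → K ≤ length Q → (u w : Fin n) → u ∉ Q → w ∉ Q → u ≢ w →
  (∀ {q} → q ∈ Q → col c u q ≡ β) → col c u w ≡ β →
  Emb (λ x y → col c x y ≡ β) K es ((nth u Q [ b ↦ u ]) [ a ↦ w ])
pendant-clique-emb c bd ll pend a≢b {Q} (uq , cl) K≤ u w u∉ w∉ u≢w uQ uw =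
  pendant-update (trans (csym c _ _)) bd ll pend a≢b (nth u Q)
    (λ p q → nth-injective u uq (≤-trans p K≤) (≤-trans q K≤)) u w u≢w
    (λ p e → u∉ (subst (_∈ Q) e (mem p))) (λ p e → w∉ (subst (_∈ Q) e (mem p)))
    (λ ij _ _ → cl (mem (proj₁ (bd ij))) (mem (proj₂ (bd ij)))
      λ e → ll ij (nth-injective u uq (≤-trans (proj₁ (bd ij)) K≤) (≤-trans (proj₂ (bd ij)) K≤) e))
    (λ ij → (λ _ → uQ (mem (proj₂ (bd ij)))) , λ _ → uQ (mem (proj₁ (bd ij)))) uw
  where
  mem : ∀ {i} → i < _ → nth u Q i ∈ Q
  mem p = nth-∈ u Q (≤-trans p K≤)

-- The class of `b` under `χ` goes into `S` and the other class into `Q`; then `b` moves to `s`,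
-- which is joined to `Q` just as the vertices of `S` are. This serves vertices that are red to most
-- of a blue clique.
pendant-bipartite-emb : ∀ {n} (c : Coloring n) {β : Bool} {K : ℕ} {es : List (ℕ × ℕ)} →
  Bounded K es → Loopless es → {a b : ℕ} → PendantAt es a b → a ≢ b →
  (χ : ℕ → Bool) → (∀ {i j} → (i , j) ∈ es → χ i ≢ χ j) →
  {S Q : List (Fin n)} → Unique S → Unique Q → K ≤ length S → K ≤ length Q → (∀ {x} → x ∈ S → x ∉ Q) →
  (s z : Fin n) → s ≢ z → s ∉ S → s ∉ Q → z ∉ S → z ∉ Q →
  (∀ {x q} → x ∈ S → q ∈ Q → col c x q ≡ β) → (∀ {q} → q ∈ Q → col c s q ≡ β) → col c s z ≡ β →
  ∃ λ f → Emb (λ x y → col c x y ≡ β) K es f × f a ≡ z × f b ≡ s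
pendant-bipartite-emb {n} c {β} {K} {es} bd ll {a} {b} pend a≢b χ χ≢ {S} {Q} uS uQ K≤S K≤Q dis s z s≢z s∉S s∉Q z∉S z∉Q SQ sQ sz =
  _ , pendant-update (trans (csym c _ _)) bd ll pend a≢b g g-inj s z s≢z (avoid s∉S s∉Q) (avoid z∉S z∉Q)
    (λ ij _ _ → g-edge ij) (λ ij → (λ { refl → sg (λ e → χ≢ ij (sym e)) (proj₂ (bd ij)) }) ,
                                  λ { refl → sg (χ≢ ij) (proj₁ (bd ij)) }) sz ,
  update-≡ _ a z , trans (update-≢ _ a z (a≢b ∘ sym)) (update-≡ g b s)
  where
  side : Bool → List (Fin n)
  side true = S
  side false = Q
  same : ℕ → Bool
  same i = does (χ i ≟B χ b)
  g : ℕ → Fin n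
  -- Both lists are indexed by the label itself: this wastes places but makes `g` injective on each
  -- side at once.
  g i = nth s (side (same i)) i
  side-unique : ∀ x → Unique (side x)
  side-unique true = uS
  side-unique false = uQ
  side-length : ∀ x → K ≤ length (side x)
  side-length true = K≤S
  side-length false = K≤Q
  mem : ∀ {i} → i < K → g i ∈ side (same i)
  mem {i} p = nth-∈ s (side (same i)) (≤-trans p (side-length (same i)))
  clash : ∀ {x y v} → v ∈ side x → v ∈ side y → x ≡ y
  clash {true} {true} _ _ = refl
  clash {false} {false} _ _ = refl
  clash {true} {false} p q = contradiction q (dis p)
  clash {false} {true} p q = contradiction p (dis q)
  g-inj : InjectiveBelow K g
  g-inj {i} {j} p q e with clash {same i} {same j} (mem p) (subst (_∈ side (same j)) (sym e) (mem q))
  ... | eq = nth-injective s (side-unique (same j)) (≤-trans p (side-length (same j))) (≤-trans q (side-length (same j)))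
               (trans (cong (λ x → nth s (side x) i) (sym eq)) e)
  avoid : ∀ {v} → v ∉ S → v ∉ Q → ∀ {i} → i < K → g i ≢ v
  avoid v∉S v∉Q {i} p refl with same i | mem p
  ... | true | m = v∉S m
  ... | false | m = v∉Q m
  other : ∀ {i} → χ i ≢ χ b → same i ≡ false
  other {i} ne with χ i ≟B χ b
  ... | yes e = contradiction e ne
  ... | no _ = refl
  sg : ∀ {i} → χ i ≢ χ b → i < K → col c s (g i) ≡ β
  sg {i} ne p = sQ (subst (λ x → g i ∈ side x) (other ne) (mem p))
  third : ∀ {x y z : Bool} → x ≢ y → y ≢ z → x ≡ z
  third {false} {false} p q = contradiction refl p
  third {true} {true} p q = contradiction refl p
  third {x} {true} {true} p q = contradiction refl q
  third {x} {false} {false} p q = contradiction refl q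
  third {false} {true} {false} p q = refl
  third {true} {false} {true} p q = refl
  g-edge : ∀ {i j} → (i , j) ∈ es → col c (g i) (g j) ≡ β
  g-edge {i} {j} ij = by (χ i ≟B χ b)
    where
    p = proj₁ (bd ij)
    q = proj₂ (bd ij)
    inS : ∀ {k} → χ k ≡ χ b → k < K → g k ∈ S
    inS {k} e k< = subst (λ x → g k ∈ side x) (dec-true (χ k ≟B χ b) e) (mem k<)
    inQ : ∀ {k} → χ k ≢ χ b → k < K → g k ∈ Q
    inQ {k} ne k< = subst (λ x → g k ∈ side x) (other ne) (mem k<)
    by : Dec (χ i ≡ χ b) → col c (g i) (g j) ≡ β
    by (yes e) = SQ (inS e p) (inQ (λ e' → χ≢ ij (trans e (sym e'))) q)
    by (no ne) = trans (csym c _ _) (SQ (inS (third (χ≢ ij ∘ sym) ne) q) (inQ ne p))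

-- Spiders as lists of legs

lnk : {V : Set} → V → List V → List (V × V)
lnk x [] = []
lnk x (y ∷ ys) = (x , y) ∷ lnk y ys

Walk : {V : Set} → (V → V → Set) → V → List V → Set
Walk E x ys = ∀ {u v} → (u , v) ∈ lnk x ys → E u v

walk-∷ : {V : Set} {E : V → V → Set} {x y : V} {ys : List V} → E x y → Walk E y ys → Walk E x (y ∷ ys)
walk-∷ e w (here refl) = e
walk-∷ e w (there i) = w i

spiderLinks : {V : Set} → V → List (List V) → List (V × V)
spiderLinks x = concatMap (lnk x)

IsSpider : {V : Set} → (V → V → Set) → List ℕ → V → List (List V) → Set
IsSpider E lens x legs = map length legs ≡ lens × Unique (x ∷ concat legs) × All (Walk E x) legs

∈-DecFin : ∀ {n} (x : Fin n) (xs : List (Fin n)) → Dec (x ∈ xs)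
∈-DecFin = λ x xs → DM._∈?_ x xs
  where import Data.List.Membership.DecPropositional FP._≟_ as DM

_∖_ : ∀ {n} → List (Fin n) → List (Fin n) → List (Fin n)
xs ∖ F = filter (λ x → ¬? (∈-DecFin x F)) xs

∈-∖⁻ : ∀ {n} {x : Fin n} {xs F} → x ∈ xs ∖ F → x ∈ xs × x ∉ F
∈-∖⁻ {F = F} = ∈-filter⁻ (λ x → ¬? (∈-DecFin x F))

∖-unique : ∀ {n} {xs : List (Fin n)} F → Unique xs → Unique (xs ∖ F)
∖-unique F = UP.filter⁺ (λ x → ¬? (∈-DecFin x F))

length-∖ : ∀ {n} {xs : List (Fin n)} F → Unique xs → length xs ≤ length (xs ∖ F) + length F
length-∖ F u = length-filter-cover (λ x → ¬? (∈-DecFin x F)) u λ {x} _ → [ inj₂ , inj₁ ]′ (em (∈-DecFin x F))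
  where
  em : {A : Set} → Dec A → A ⊎ ¬ A
  em (yes a) = inj₁ a
  em (no a) = inj₂ a

fresh : ∀ {n} {xs : List (Fin n)} (F : List (Fin n)) → Unique xs → length F < length xs → ∃ λ x → x ∈ xs × x ∉ F
fresh {xs = xs} F u lt with nonempty-lookup {m = 0} (xs ∖ F) (+-cancelʳ-≤ (length F) 1 _ (≤-trans lt (length-∖ F u)))
... | x , i = x , ∈-∖⁻ i

-- Rerouting through a pool Q all of whose edges to S have colour r.

module Reroute {n : ℕ} (Red : Fin n → Fin n → Set) (red-sym : ∀ {x y} → Red x y → Red y x)
  (N : Fin n → Fin n → Set) (Blue : Fin n → Fin n → Set) (S : Fin n → Set)
  (Q : List (Fin n)) (Q-unique : Unique Q) (SQ : ∀ {s q} → S s → q ∈ Q → Red s q) where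

  private V = Fin n

  -- A step inside `S` can be replaced by a red path of length two through any pool vertex, so its
  -- own colour is not recorded.
  Step : V → V → Set
  Step u v = Red u v ⊎ (S u × S v)

  -- F lists the pool vertices that are already in use.
  record Rerouted (x : V) (leg F : List V) (m : ℕ) : Set where
    constructor rerouted
    field
      ys : List V
      len : length ys ≡ m
      walk : Walk Red x ys
      uniq : Unique ys
      from : ∀ {y} → y ∈ ys → y ∈ leg ⊎ (y ∈ Q × y ∉ F)

  open Rerouted

  weaken-leg : ∀ {leg leg' F y} → (∀ {z} → z ∈ leg → z ∈ leg') → y ∈ leg ⊎ (y ∈ Q × y ∉ F) → y ∈ leg' ⊎ (y ∈ Q × y ∉ F)
  weaken-leg f (inj₁ i) = inj₁ (f i)
  weaken-leg f (inj₂ p) = inj₂ p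

  weaken-F : ∀ {leg F F' y} → (∀ {z} → z ∈ F → z ∈ F') → y ∈ leg ⊎ (y ∈ Q × y ∉ F') → y ∈ leg ⊎ (y ∈ Q × y ∉ F)
  weaken-F f (inj₁ i) = inj₁ i
  weaken-F f (inj₂ (i , ni)) = inj₂ (i , ni ∘ f)

  Fits : List V → ℕ → Set
  Fits F m = length F + m ≤ length Q

  fits-drop : ∀ {F m k} → k ≤ m → Fits F m → Fits F k
  fits-drop {F} le = ≤-trans (+-monoʳ-≤ (length F) le)

  fits-∷ : ∀ {F m q} → Fits F (suc m) → Fits (q ∷ F) m
  fits-∷ {F} {m} = subst (_≤ length Q) (+-suc (length F) m)

  pick : ∀ F {m} → Fits F (suc m) → ∃ λ q → q ∈ Q × q ∉ F
  pick F {m} ft = fresh F Q-unique (≤-trans (≤-trans (s≤s (m≤m+n (length F) m)) (≤-reflexive (sym (+-suc (length F) m)))) ft)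

  keep : ∀ {x v vs F m} → v ∉ vs → v ∉ Q → Red x v → Rerouted v vs F m → Rerouted x (v ∷ vs) F (suc m)
  keep {v = v} v∉ v∉Q xv (rerouted ys l w u f) = rerouted (v ∷ ys) (cong suc l) (walk-∷ xv w)
    (unique-∷ (λ i → [ v∉ , v∉Q ∘ proj₁ ]′ (f i)) u) λ { (here refl) → inj₁ (here refl) ; (there i) → weaken-leg there (f i) }

  insert : ∀ {x leg F m q} → q ∈ Q → q ∉ F → q ∉ leg → Red x q → Rerouted q leg (q ∷ F) m → Rerouted x leg F (suc m)
  insert {q = q} q∈ q∉F q∉leg xq (rerouted ys l w u f) = rerouted (q ∷ ys) (cong suc l) (walk-∷ xq w)
    (unique-∷ (λ i → [ q∉leg , (λ p → proj₂ p (here refl)) ]′ (f i)) u)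
    λ { (here refl) → inj₂ (q∈ , q∉F) ; (there i) → weaken-F there (f i) }

  -- A pool vertex is inserted into each step that is only known to lie inside `S`, and the result
  -- is cut off after `m` vertices. Insertions lengthen the walk, so `vs` is not exhausted before
  -- the cut.
  redden : ∀ x vs → (∀ {v} → v ∈ vs → v ∉ Q) → Unique vs → Walk Step x vs → ∀ F m → m ≤ length vs → Fits F m → Rerouted x vs F m
  redden x vs dQ u w F zero le ft = rerouted [] refl (λ ()) [] λ ()
  redden x (v ∷ vs) dQ (p ∷ u) w F (suc m) (s≤s le) ft with w (here refl)
  ... | inj₁ xv = keep (λ i → All.lookup p i refl) (dQ (here refl)) xv
          (redden v vs (dQ ∘ there) u (w ∘ there) F m le (fits-drop {F} (n≤1+n m) ft))
  ... | inj₂ (sx , sv) with pick F ft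
  -- With one place left, the leg ends in the inserted pool vertex.
  redden x (v ∷ vs) dQ (p ∷ u) w F (suc zero) (s≤s le) ft | inj₂ (sx , sv) | q , q∈ , q∉F =
    insert q∈ q∉F (λ i → dQ i q∈) (SQ sx q∈) (rerouted [] refl (λ ()) [] λ ())
  redden x (v ∷ vs) dQ (p ∷ u) w F (suc (suc m)) (s≤s le) ft | inj₂ (sx , sv) | q , q∈ , q∉F =
    insert q∈ q∉F (λ i → dQ i q∈) (SQ sx q∈)
      (keep (λ i → All.lookup p i refl) (dQ (here refl)) (red-sym (SQ sv q∈))
        (redden v vs (dQ ∘ there) u (w ∘ there) (q ∷ F) m (<⇒≤ le)
          (fits-drop {q ∷ F} (n≤1+n m) (fits-∷ {F} {q = q} ft))))

  -- The leg starts with p steps inside S, followed by the red N-step e; the index is the parity of p (true = even).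
  data FirstRed : Bool → V → List V → V × V → Set where
    stop : ∀ {x y rest} → Red x y → N x y → FirstRed true x (y ∷ rest) (x , y)
    step-odd : ∀ {x y rest e} → S x → S y → FirstRed true y rest e → FirstRed false x (y ∷ rest) e
    step-even : ∀ {x y rest e} → S x → S y → FirstRed false y rest e → FirstRed true x (y ∷ rest) e

  Task : V → List V → Set
  Task x leg = ∀ F → Fits F (length leg) → Rerouted x leg F (length leg)

  TaskWith : V × V → V → List V → Set
  TaskWith e x leg = ∀ F → Fits F (length leg) → Σ (Rerouted x leg F (length leg)) λ r → e ∈ lnk x (ys r)

  -- The red edge e keeps its position; before it, every second vertex (counted backwards from e) is replaced by a pool vertex.
  alternate : ∀ {x leg e} → (∀ {v} → v ∈ leg → v ∉ Q) → Unique leg → Walk Step x leg → FirstRed true x leg e → TaskWith e x leg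
  alternate {x} {y ∷ rest} dQ (p ∷ u) w (stop xy _) F ft =
    keep (λ i → All.lookup p i refl) (dQ (here refl)) xy
      (redden y rest (dQ ∘ there) u (w ∘ there) F (length rest) ≤-refl (fits-drop {F} (n≤1+n _) ft)) , here refl
  alternate {x} {y ∷ z ∷ rest} dQ (_ ∷ (pz ∷ u)) w (step-even sx _ (step-odd _ sz fr)) F ft with pick F ft
  ... | q , q∈ , q∉F with alternate (dQ ∘ there ∘ there) u (w ∘ there ∘ there) fr (q ∷ F)
                            (fits-drop {q ∷ F} (n≤1+n _) (fits-∷ {F} {q = q} ft))
  ...   | r , e∈ = reroot (insert q∈ q∉F (λ i → dQ (there i) q∈) (SQ sx q∈)
                     (keep (λ i → All.lookup pz i refl) (dQ (there (here refl))) (red-sym (SQ sz q∈)) r)) , there (there e∈)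
    where
    reroot : ∀ {m} → Rerouted x (z ∷ rest) F m → Rerouted x (y ∷ z ∷ rest) F m
    reroot (rerouted ys l w u f) = rerouted ys l w u (λ i → weaken-leg there (f i))

  record Assembled (x : V) (legs : List (List V)) (F : List V) : Set where
    constructor assembled
    field
      legs′ : List (List V)
      lens : map length legs′ ≡ map length legs
      walks : All (Walk Red x) legs′
      uniqs : Unique (concat legs′)
      froms : ∀ {y} → y ∈ concat legs′ → y ∈ concat legs ⊎ (y ∈ Q × y ∉ F)

  open Assembled

  Disjoint-legs : List (List V) → Set
  Disjoint-legs legs = Unique (concat legs) × (∀ {v} → v ∈ concat legs → v ∉ Q)

  total : List (List V) → ℕ
  total legs = length (concat legs)

  -- The pool vertices used by one leg join `F` for the following legs, which keeps the new legs
  -- disjoint.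
  cons : ∀ {x leg legs F} → Disjoint-legs (leg ∷ legs) → (r : Rerouted x leg F (length leg)) →
    Assembled x legs (ys r ++ F) → Assembled x (leg ∷ legs) F
  cons {leg = leg} {F = F} (u , dQ) r a = assembled (ys r ∷ legs′ a) (cong₂ _∷_ (len r) (lens a)) (walk r ∷ walks a)
    (unique-++ (uniq r) (uniqs a) dis) fr
    where
    dis : ∀ {y} → y ∈ ys r → y ∉ concat (legs′ a)
    dis i j with froms a j
    ... | inj₂ (_ , ni) = ni (∈-++⁺ˡ i)
    ... | inj₁ k with from r i
    ...   | inj₁ l = unique-++-disjoint leg u l k
    ...   | inj₂ (y∈Q , _) = dQ (∈-++⁺ʳ leg k) y∈Q
    fr : ∀ {y} → y ∈ ys r ++ concat (legs′ a) → _
    fr i with ∈-++⁻ (ys r) i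
    ... | inj₁ j = weaken-leg ∈-++⁺ˡ (from r j)
    ... | inj₂ j = weaken-leg (∈-++⁺ʳ leg) (weaken-F (∈-++⁺ʳ (ys r)) (froms a j))

  fits-head : ∀ leg {legs F} → Fits F (total (leg ∷ legs)) → Fits F (length leg)
  fits-head leg {legs} {F} = fits-drop {F} (subst (length leg ≤_) (sym (LP.length-++ leg)) (m≤m+n _ _))

  fits-tail : ∀ leg {legs F ys} → length ys ≡ length leg → Fits F (total (leg ∷ legs)) → Fits (ys ++ F) (total legs)
  fits-tail leg {legs} {F} {ys} e = subst (_≤ length Q) (begin
    length F + total (leg ∷ legs) ≡⟨ cong (length F +_) (LP.length-++ leg) ⟩
    length F + (length leg + total legs) ≡⟨ +-assoc (length F) _ _ ⟨
    length F + length leg + total legs ≡⟨ cong (_+ total legs) (trans (+-comm (length F) _) (cong (_+ length F) (sym e))) ⟩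
    length ys + length F + total legs ≡⟨ cong (_+ total legs) (LP.length-++ ys) ⟨
    length (ys ++ F) + total legs ∎)
    where open ≡-Reasoning

  split-legs : ∀ leg {legs} → Disjoint-legs (leg ∷ legs) → Disjoint-legs legs
  split-legs leg (u , dQ) = unique-++ʳ leg u , λ i → dQ (∈-++⁺ʳ leg i)

  assemble : ∀ {x legs} → Disjoint-legs legs → All (Task x) legs → ∀ F → Fits F (total legs) → Assembled x legs F
  assemble d [] F ft = assembled [] refl [] [] λ ()
  assemble {legs = leg ∷ legs} d (t ∷ ts) F ft = cons {legs = legs} d r
      (assemble (split-legs leg {legs} d) ts (ys r ++ F) (fits-tail leg {legs} {F} {ys r} (len r) ft))
    where r = t F (fits-head leg {legs} {F} ft)

  assembleWith : ∀ {x legs e} → Disjoint-legs legs → All (Task x) legs → Any (TaskWith e x) legs → ∀ F → Fits F (total legs) →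
    Σ (Assembled x legs F) λ a → e ∈ spiderLinks x (legs′ a)
  assembleWith {legs = leg ∷ legs} d (_ ∷ ts) (here t) F ft with t F (fits-head leg {legs} {F} ft)
  ... | r , e∈ = cons {legs = legs} d r (assemble (split-legs leg {legs} d) ts (ys r ++ F) (fits-tail leg {legs} {F} {ys r} (len r) ft)) , ∈-++⁺ˡ e∈
  assembleWith {x} {legs = leg ∷ legs} d (t ∷ ts) (there a) F ft
    with assembleWith (split-legs leg {legs} d) ts a (ys (t F (fits-head leg {legs} {F} ft)) ++ F)
           (fits-tail leg {legs} {F} {ys (t F (fits-head leg {legs} {F} ft))} (len (t F (fits-head leg {legs} {F} ft))) ft)
  ... | as , e∈ = cons {legs = legs} d (t F (fits-head leg {legs} {F} ft)) as , ∈-++⁺ʳ (lnk x (ys (t F (fits-head leg {legs} {F} ft)))) e∈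

  RedOrBlue : V → V → Set
  RedOrBlue u v = N u v × (Red u v ⊎ (Blue u v × S u × S v))

  toStep : ∀ {u v} → RedOrBlue u v → Step u v
  toStep (_ , inj₁ r) = inj₁ r
  toStep (_ , inj₂ (_ , s)) = inj₂ s

  -- Phrased so that the empty leg satisfies it; such a leg occurs when a double broom on a
  -- one-vertex path is read as a spider.
  FirstIn-S : List V → Set
  FirstIn-S leg = ∀ {y rest} → leg ≡ y ∷ rest → S y

  HasFirstRed : Bool → V → List V → Set
  HasFirstRed p x leg = Σ (V × V) λ e → N (proj₁ e) (proj₂ e) × FirstRed p x leg e

  -- If the number of steps before the first red one is even, alternating backwards from that edge
  -- leaves the centre in place. If it is odd, the centre itself has to become a pool vertex, which
  -- this leg permits because it starts in `S`.
  classify : ∀ x leg → Walk RedOrBlue x leg →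
    HasFirstRed true x leg ⊎ ((FirstIn-S leg × HasFirstRed false x leg) ⊎ (FirstIn-S leg × Walk Blue x leg))
  classify x [] w = inj₂ (inj₂ ((λ ()) , λ ()))
  classify x (y ∷ leg) w with w (here refl)
  ... | nxy , inj₁ r = inj₁ (_ , nxy , stop r nxy)
  ... | nxy , inj₂ (bl , sx , sy) with classify y leg (w ∘ there)
  ...   | inj₁ (e , ne , fr) = inj₂ (inj₁ ((λ { refl → sy }) , e , ne , step-odd sx sy fr))
  ...   | inj₂ (inj₁ (_ , e , ne , fr)) = inj₁ (e , ne , step-even sx sy fr)
  ...   | inj₂ (inj₂ (_ , wb)) = inj₂ (inj₂ ((λ { refl → sy }) , walk-∷ {E = Blue} bl wb))

  -- One even leg suffices to keep the centre. Only when there is none is it known that all legs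
  -- start in `S`, and this is what moving the centre into the pool requires.
  scan : {A B C : List V → Set} → ∀ {legs} → All (λ l → A l ⊎ (B l ⊎ C l)) legs →
    Any A legs ⊎ ((All (λ l → B l ⊎ C l) legs × Any B legs) ⊎ All C legs)
  scan [] = inj₂ (inj₂ [])
  scan (inj₁ a ∷ ps) = inj₁ (here a)
  scan (inj₂ p ∷ ps) with scan ps
  ... | inj₁ a = inj₁ (there a)
  ... | inj₂ (inj₁ (al , an)) = inj₂ (inj₁ (p ∷ al , there an))
  scan (inj₂ (inj₁ b) ∷ ps) | inj₂ (inj₂ cs) = inj₂ (inj₁ (inj₁ b ∷ All.map inj₂ cs , here b))
  scan (inj₂ (inj₂ c) ∷ ps) | inj₂ (inj₂ cs) = inj₂ (inj₂ (c ∷ cs))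

  leg-unique : {legs : List (List V)} {leg : List V} → leg ∈ legs → Unique (concat legs) → Unique leg
  leg-unique {l ∷ legs} (here refl) u = unique-++ˡ l u
  leg-unique {l ∷ legs} (there i) u = leg-unique i (unique-++ʳ l u)

  recentre : ∀ {q₀ x leg} → q₀ ∈ Q → Walk Step x leg → FirstIn-S leg → Walk Step q₀ leg
  recentre {leg = []} q∈ w s = λ ()
  recentre {leg = y ∷ rest} q∈ w s = walk-∷ {E = Step} (inj₁ (red-sym (SQ (s refl) q∈))) (w ∘ there)

  odd-alternate : ∀ {x leg e q₀} → q₀ ∈ Q → (∀ {v} → v ∈ leg → v ∉ Q) → Unique leg → Walk Step x leg → FirstRed false x leg e →
    TaskWith e q₀ leg
  odd-alternate q₀∈ dQ (py ∷ u) w (step-odd _ sy fr) F ft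
    with alternate (dQ ∘ there) u (w ∘ there) fr F (fits-drop {F} (n≤1+n _) ft)
  ... | r , e∈ = keep (λ i → All.lookup py i refl) (dQ (here refl)) (red-sym (SQ sy q₀∈)) r , there e∈

  Outcome : List ℕ → Set
  Outcome lens = ∃ λ x → ∃ λ legs → IsSpider Red lens x legs × ∃ λ u → ∃ λ v → (u , v) ∈ spiderLinks x legs × N u v

  module _ {x : V} {legs : List (List V)} (x∉Q : x ∉ Q) (x∉ : x ∉ concat legs) (u : Unique (concat legs))
    (dQ : ∀ {v} → v ∈ concat legs → v ∉ Q) (ws : All (Walk RedOrBlue x) legs) (big : suc (total legs) ≤ length Q) where

    private
      leg∉Q : ∀ {leg v} → leg ∈ legs → v ∈ leg → v ∉ Q
      leg∉Q leg∈ i = dQ (∈-concat⁺′ i leg∈)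

      leg-walk : ∀ {leg} → leg ∈ legs → Walk Step x leg
      leg-walk leg∈ i = toStep (All.lookup ws leg∈ i)

      outcome : ∀ {x' u₀ v₀} F → (x' ∈ Q × x' ∈ F) ⊎ (x' ∉ Q × x' ∉ concat legs) → N u₀ v₀ →
        (Σ (Assembled x' legs F) λ a → (u₀ , v₀) ∈ spiderLinks x' (legs′ a)) → Outcome (map length legs)
      outcome {x'} F x'-new ne (as , e∈) = x' , legs′ as , (lens as , unique-∷ (λ i → new x'-new (froms as i)) (uniqs as) , walks as) ,
        _ , _ , e∈ , ne
        where
        new : (x' ∈ Q × x' ∈ F) ⊎ (x' ∉ Q × x' ∉ concat legs) → x' ∈ concat legs ⊎ (x' ∈ Q × x' ∉ F) → ⊥
        new (inj₁ (q , _)) (inj₁ j) = dQ j q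
        new (inj₁ (_ , f)) (inj₂ (_ , nf)) = nf f
        new (inj₂ (_ , nl)) (inj₁ j) = nl j
        new (inj₂ (nq , _)) (inj₂ (q , _)) = nq q

    reroute : Outcome (map length legs) ⊎ All (Walk Blue x) legs
    reroute with scan (All.map (λ {l} → classify x l) ws)
    ... | inj₂ (inj₂ blue) = inj₂ (All.map proj₂ blue)
    ... | inj₁ a with find a
    ...   | leg , leg∈ , e , ne , fr = inj₁ (outcome [] (inj₂ (x∉Q , x∉)) ne (assembleWith (u , dQ) tasks
            (lose leg∈ (alternate (leg∉Q leg∈) (leg-unique leg∈ u) (leg-walk leg∈) fr)) [] (<⇒≤ big)))
      where
      tasks : All (Task x) legs
      tasks = All.tabulate λ {l} l∈ F → redden x l (leg∉Q l∈) (leg-unique l∈ u) (leg-walk l∈) F (length l) ≤-refl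
    -- The one spare vertex granted by `big` becomes the new centre and is declared used before any
    -- leg is rerouted.
    reroute | inj₂ (inj₁ (al , an)) with find an | pick [] {total legs} big
    ...   | leg , leg∈ , _ , e , ne , fr | q₀ , q₀∈ , _ = inj₁ (outcome [ q₀ ] (inj₁ (q₀∈ , here refl)) ne (assembleWith (u , dQ) tasks
            (lose leg∈ (odd-alternate q₀∈ (leg∉Q leg∈) (leg-unique leg∈ u) (leg-walk leg∈) fr)) [ q₀ ] big))
      where
      tasks : All (Task q₀) legs
      tasks = All.tabulate λ {l} l∈ F → redden q₀ l (leg∉Q l∈) (leg-unique l∈ u)
        (recentre q₀∈ (leg-walk l∈) ([ proj₁ , proj₁ ]′ (All.lookup al l∈))) F (length l) ≤-refl

-- Spiders do not occur in the NIM-graph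

length-concat : {A : Set} (xss : List (List A)) → length (concat xss) ≡ sum (map length xss)
length-concat [] = refl
length-concat (xs ∷ xss) = trans (LP.length-++ xs) (cong (length xs +_) (length-concat xss))

lnk-∈ : {V : Set} {x u v : V} {ys : List V} → (u , v) ∈ lnk x ys → u ∈ x ∷ ys × v ∈ ys
lnk-∈ {ys = y ∷ ys} (here refl) = here refl , here refl
lnk-∈ {ys = y ∷ ys} (there i) with lnk-∈ i
... | a , b = there a , there b

lnk-≢ : {V : Set} {x u v : V} {ys : List V} → Unique (x ∷ ys) → (u , v) ∈ lnk x ys → u ≢ v
lnk-≢ {ys = y ∷ ys} (p ∷ _) (here refl) = All.lookup p (here refl)
lnk-≢ {ys = y ∷ ys} (_ ∷ u) (there i) = lnk-≢ u i

-- K vertices remain after deleting the K vertices of the spider and up to K blue neighbours of each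
-- of them.
poolSize : ℕ → ℕ
poolSize K = K + K * K + K

-- Stated for an abstract relation `N` and leg lengths that may be zero, so that it covers both
-- spiders and double brooms with s₁ = 0. The facts about the actual graph enter through the two
-- hypotheses that monochromatic copies and pendant edges are not in `N`.
nim-spider-free : ∀ {n} (c : Coloring n) (N : Fin n → Fin n → Set) → (∀ {u v} → N u v → N v u) → (lens : List ℕ) →
  (∀ β x legs → IsSpider (λ u v → col c u v ≡ β) lens x legs → ∀ {u v} → (u , v) ∈ spiderLinks x legs → ¬ N u v) →
  (∀ {β Q u w} → MonoClique c β Q → suc (sum lens) ≤ length Q → u ∉ Q → w ∉ Q → u ≢ w →
    (∀ {q} → q ∈ Q → col c u q ≡ β) → col c u w ≡ β → ¬ N u w) →
  ramseyBound (poolSize (suc (sum lens))) (poolSize (suc (sum lens))) ≤ n →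
  ∀ x legs → IsSpider N lens x legs → ∀ {u v} → (u , v) ∈ spiderLinks x legs → ⊥
nim-spider-free {n} c N N-sym lens nonN pend big x legs (refl , uniq@(px ∷ u) , walks) link∈
  with ramsey c (poolSize (suc (sum lens))) big
... | b , Q , Q-len , uQ , Q-col with R.reroute x∉Q′ x∉ u (λ i → Q′-avoids (there i)) ws large
  where
  K = suc (sum lens)
  r = not b
  Z = x ∷ concat legs
  QZ = Q ∖ Z
  blue? : ∀ z q → Dec (col c z q ≡ b)
  blue? z q = col c z q ≟B b
  A : Fin n → List (Fin n)
  A z = filter (blue? z) QZ
  Z-len : length Z ≡ K
  Z-len = cong suc (length-concat legs)
  good? : ∀ q → Dec (All (λ z → length (A z) < K → col c z q ≡ r) Z)
  good? q = All.all? (λ z → (length (A z) Data.Nat.<? K) →-dec (col c z q ≟B r)) Z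
  Q′ = filter good? QZ
  -- A vertex with at least `K` blue neighbours imposes no condition on the pool; by `S-end` it is
  -- never an end of a blue NIM-edge of the spider.
  badOf : Fin n → List (Fin n)
  badOf z with length (A z) Data.Nat.<? K
  ... | yes _ = A z
  ... | no _ = []
  badOf-len : ∀ {z} → length (badOf z) ≤ K
  badOf-len {z} with length (A z) Data.Nat.<? K
  ... | yes p = <⇒≤ p
  ... | no _ = z≤n
  badOf-∈ : ∀ {z q} → length (A z) < K → q ∈ A z → q ∈ badOf z
  badOf-∈ {z} p i with length (A z) Data.Nat.<? K
  ... | yes _ = i
  ... | no np = contradiction p np
  cover : ∀ {q} → q ∈ QZ → All (λ z → length (A z) < K → col c z q ≡ r) Z ⊎ q ∈ concatMap badOf Z
  cover {q} q∈ with good? q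
  ... | yes g = inj₁ g
  ... | no ng with find (AllP.¬All⇒Any¬ (λ z → (length (A z) Data.Nat.<? K) →-dec (col c z q ≟B r)) Z ng)
  ...   | z , z∈ , nz with length (A z) Data.Nat.<? K
  ...     | no np = contradiction (λ p → contradiction p np) nz
  ...     | yes p with bool-cases (col c z q) b
  ...       | inj₂ e = contradiction (λ _ → e) nz
  ...       | inj₁ e = inj₂ (∈-concat⁺′ (badOf-∈ p (∈-filter⁺ (blue? z) q∈ e)) (∈-map⁺ badOf z∈))
  uQZ : Unique QZ
  uQZ = ∖-unique Z uQ
  uQ′ : Unique Q′
  uQ′ = UP.filter⁺ good? uQZ
  Q′-len : K ≤ length Q′
  Q′-len = +-cancelʳ-≤ (K * K + K) K (length Q′) (begin
      K + (K * K + K) ≡⟨ +-assoc K (K * K) K ⟨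
      poolSize K ≡⟨ Q-len ⟨
      length Q ≤⟨ length-∖ Z uQ ⟩
      length QZ + length Z ≤⟨ +-mono-≤ (length-filter-cover good? uQZ cover) (≤-reflexive Z-len) ⟩
      length Q′ + length (concatMap badOf Z) + K ≤⟨ +-monoˡ-≤ K (+-monoʳ-≤ (length Q′) bad-len) ⟩
      length Q′ + K * K + K ≡⟨ +-assoc (length Q′) _ _ ⟩
      length Q′ + (K * K + K) ∎)
    where
    open ≤-Reasoning
    bad-len : length (concatMap badOf Z) ≤ K * K
    bad-len = subst (λ l → length (concatMap badOf Z) ≤ l * K) Z-len (length-concatMap≤ badOf K Z λ {z} _ → badOf-len {z})
  S : Fin n → Set
  S z = z ∈ Z × length (A z) < K
  Q′-avoids : ∀ {z} → z ∈ Z → z ∉ Q′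
  Q′-avoids z∈ q∈ = proj₂ (∈-∖⁻ {xs = Q} {F = Z} (proj₁ (∈-filter⁻ good? {xs = QZ} q∈))) z∈
  module R = Reroute (λ u v → col c u v ≡ r) (trans (csym c _ _)) N (λ u v → col c u v ≡ b) S Q′ uQ′
    (λ (s∈ , lt) q∈ → All.lookup (proj₂ (∈-filter⁻ good? {xs = QZ} q∈)) s∈ lt)
  S-end : ∀ {u v} → u ∈ Z → v ∈ Z → u ≢ v → N u v → col c u v ≡ b → S u
  S-end {u} {v} u∈ v∈ u≢v nuv e with ≤-<-connex K (length (A u))
  ... | inj₂ lt = u∈ , lt
  ... | inj₁ le = contradiction nuv (pend (UP.filter⁺ (blue? u) uQZ , λ i j → Q-col (inQ i) (inQ j)) le
          (avoid u∈) (avoid v∈) u≢v (λ i → proj₂ (∈-filter⁻ (blue? u) {xs = QZ} i)) e)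
    where
    inQ : ∀ {q} → q ∈ A u → q ∈ Q
    inQ i = proj₁ (∈-∖⁻ {xs = Q} {F = Z} (proj₁ (∈-filter⁻ (blue? u) {xs = QZ} i)))
    avoid : ∀ {z} → z ∈ Z → z ∉ A u
    avoid z∈ i = proj₂ (∈-∖⁻ {xs = Q} {F = Z} (proj₁ (∈-filter⁻ (blue? u) {xs = QZ} i))) z∈
  ws : All (Walk R.RedOrBlue x) legs
  ws = All.tabulate λ {leg} leg∈ i → step leg∈ i (All.lookup walks leg∈ i)
    where
    step : ∀ {leg u v} → leg ∈ legs → (u , v) ∈ lnk x leg → N u v → R.RedOrBlue u v
    step {leg} {u} {v} leg∈ i nuv = nuv , colour (bool-cases (col c u v) b)
      where
      sub : ∀ {y} → y ∈ x ∷ leg → y ∈ Z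
      sub (here p) = here p
      sub (there j) = there (∈-concat⁺′ j leg∈)
      u≢v : u ≢ v
      u≢v = lnk-≢ (unique-∷ (λ j → All.lookup px (∈-concat⁺′ j leg∈) refl) (R.leg-unique leg∈ (unique-++ʳ [ x ] uniq))) i
      colour : col c u v ≡ b ⊎ col c u v ≡ r → _
      colour (inj₂ e) = inj₁ e
      colour (inj₁ e) = inj₂ (e , S-end (sub (proj₁ (lnk-∈ i))) (sub (there (proj₂ (lnk-∈ i)))) u≢v nuv e ,
        S-end (sub (there (proj₂ (lnk-∈ i)))) (sub (proj₁ (lnk-∈ i))) (u≢v ∘ sym) (N-sym nuv) (trans (csym c _ _) e))
  x∉Q′ : x ∉ Q′
  x∉Q′ = Q′-avoids (here refl)
  x∉ : x ∉ concat legs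
  x∉ i = All.lookup px i refl
  large : suc (length (concat legs)) ≤ length Q′
  large = subst (_≤ length Q′) (sym Z-len) Q′-len
... | inj₁ (x' , legs' , sp , u' , v' , i , ne) = nonN (not b) x' legs' sp i ne
-- If no leg has a red edge, the spider is itself a monochromatic copy made of NIM-edges.
... | inj₂ blue = nonN b x legs (refl , uniq , blue) link∈ (member link∈)
  where
  member : ∀ {e} → e ∈ spiderLinks x legs → N (proj₁ e) (proj₂ e)
  member i with find (∈-concatMap⁻ (lnk x) {xs = legs} i)
  ... | leg , leg∈ , j = All.lookup walks leg∈ j

-- Labelled copies versus lists

onEdge : {V : Set} → (ℕ → V) → ℕ × ℕ → V × V
onEdge f (i , j) = f i , f j

seg : {V : Set} → (ℕ → V) → ℕ → ℕ → List V
seg f a zero = []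
seg f a (suc m) = f a ∷ seg f (suc a) m

length-seg : {V : Set} (f : ℕ → V) (a m : ℕ) → length (seg f a m) ≡ m
length-seg f a zero = refl
length-seg f a (suc m) = cong suc (length-seg f (suc a) m)

seg-++ : {V : Set} (f : ℕ → V) (a m k : ℕ) → seg f a (m + k) ≡ seg f a m ++ seg f (a + m) k
seg-++ f a zero k = cong (λ x → seg f x k) (sym (+-identityʳ a))
seg-++ f a (suc m) k = cong (f a ∷_) (trans (seg-++ f (suc a) m k) (cong (λ x → seg f (suc a) m ++ seg f x k) (sym (+-suc a m))))

∈-seg⁻ : {V : Set} (f : ℕ → V) (a m : ℕ) {v : V} → v ∈ seg f a m → ∃ λ i → a ≤ i × i < a + m × v ≡ f i
∈-seg⁻ f a (suc m) (here refl) = a , ≤-refl , subst (a <_) (sym (+-suc a m)) (s≤s (m≤m+n a m)) , refl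
∈-seg⁻ f a (suc m) (there i) with ∈-seg⁻ f (suc a) m i
... | k , p , q , e = k , <⇒≤ p , subst (k <_) (sym (+-suc a m)) q , e

seg-unique : {V : Set} {K : ℕ} {f : ℕ → V} → InjectiveBelow K f → ∀ a m → a + m ≤ K → Unique (seg f a m)
seg-unique inj a zero le = []
seg-unique {K = K} {f} inj a (suc m) le = unique-∷ new (seg-unique inj (suc a) m le′)
  where
  le′ : suc a + m ≤ K
  le′ = subst (_≤ K) (+-suc a m) le
  new : f a ∉ seg f (suc a) m
  new i with ∈-seg⁻ f (suc a) m i
  ... | k , p , q , e = <-irrefl (inj (≤-trans (s≤s (m≤m+n a m)) le′) (≤-trans q le′) e) p

seg-nth : {V : Set} (d : V) (pre ys post : List V) → seg (nth d (pre ++ ys ++ post)) (length pre) (length ys) ≡ ys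
seg-nth d pre [] post = refl
seg-nth d pre (y ∷ ys) post = cong₂ _∷_
  (trans (cong (nth d (pre ++ y ∷ ys ++ post)) (sym (+-identityʳ (length pre)))) (nth-++ʳ d pre (y ∷ ys ++ post) 0))
  (trans (cong₂ (λ xs m → seg (nth d xs) m (length ys)) (sym (LP.++-assoc pre [ y ] (ys ++ post)))
                (trans (+-comm 1 (length pre)) (sym (LP.length-++ pre))))
         (seg-nth d (pre ++ [ y ]) ys post))

lnk-seg : {V : Set} (f : ℕ → V) (s l : ℕ) → lnk (f s) (seg f (suc s) l) ≡ map (onEdge f) (chain s l)
lnk-seg f s zero = refl
lnk-seg f s (suc l) = cong (_ ∷_) (lnk-seg f (suc s) l)

-- As in `spiderEdges`, `o` is the last label already used.
legsOf : {V : Set} → (ℕ → V) → ℕ → List ℕ → List (List V)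
legsOf f o [] = []
legsOf f o (l ∷ ls) = seg f (suc o) (suc l) ∷ legsOf f (o + suc l) ls

spiderLinks-legsOf : {V : Set} (f : ℕ → V) (o : ℕ) (ls : List ℕ) →
  spiderLinks (f 0) (legsOf f o ls) ≡ map (onEdge f) (spiderEdges o ls)
spiderLinks-legsOf f o [] = refl
spiderLinks-legsOf f o (l ∷ ls) = trans
  (cong₂ _++_ (cong ((f 0 , f (suc o)) ∷_) (lnk-seg f (suc o) l)) (spiderLinks-legsOf f (o + suc l) ls))
  (sym (LP.map-++ (onEdge f) ((0 , suc o) ∷ chain (suc o) l) (spiderEdges (o + suc l) ls)))

map-length-legsOf : {V : Set} (f : ℕ → V) (o : ℕ) (ls : List ℕ) → map length (legsOf f o ls) ≡ map suc ls
map-length-legsOf f o [] = refl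
map-length-legsOf f o (l ∷ ls) = cong₂ _∷_ (length-seg f (suc o) (suc l)) (map-length-legsOf f (o + suc l) ls)

concat-legsOf : {V : Set} (f : ℕ → V) (o : ℕ) (ls : List ℕ) → concat (legsOf f o ls) ≡ seg f (suc o) (sum (map suc ls))
concat-legsOf f o [] = refl
concat-legsOf f o (l ∷ ls) = trans (cong (seg f (suc o) (suc l) ++_) (concat-legsOf f (o + suc l) ls))
  (sym (seg-++ f (suc o) (suc l) (sum (map suc ls))))

emb⇒spider : {V : Set} {E : V → V → Set} {f : ℕ → V} (ls : List ℕ) → Emb E (spiderSize ls) (spiderEdges 0 ls) f →
  IsSpider E (map suc ls) (f 0) (legsOf f 0 ls)
emb⇒spider {E = E} {f} ls (inj , ed) = map-length-legsOf f 0 ls ,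
  subst (λ xs → Unique (f 0 ∷ xs)) (sym (concat-legsOf f 0 ls)) (seg-unique inj 0 (spiderSize ls) ≤-refl) ,
  All.tabulate λ leg∈ i → edge (∈-concat⁺′ i (∈-map⁺ (lnk (f 0)) leg∈))
  where
  edge : ∀ {u v} → (u , v) ∈ spiderLinks (f 0) (legsOf f 0 ls) → E u v
  edge {u} {v} i with ∈-map⁻ (onEdge f) (subst ((u , v) ∈_) (spiderLinks-legsOf f 0 ls) i)
  ... | _ , j , refl = ed j

legsOf-nth : {V : Set} (d : V) (pre : List V) (o : ℕ) → length pre ≡ suc o → (ls : List ℕ) (legs : List (List V)) →
  map length legs ≡ map suc ls → legsOf (nth d (pre ++ concat legs)) o ls ≡ legs
legsOf-nth d pre o e [] [] _ = refl
legsOf-nth {V} d pre o e (l ∷ ls) (leg ∷ legs) eq = cong₂ _∷_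
  (trans (cong₂ (seg (nth d (pre ++ leg ++ concat legs))) (sym e) (sym l-len)) (seg-nth d pre leg (concat legs)))
  (trans (cong (λ xs → legsOf (nth d xs) (o + suc l) ls) (sym (LP.++-assoc pre leg (concat legs))))
    (legsOf-nth d (pre ++ leg) (o + suc l) (trans (LP.length-++ pre) (cong₂ _+_ e l-len)) ls legs (LP.∷-injectiveʳ eq)))
  where
  l-len : length leg ≡ suc l
  l-len = LP.∷-injectiveˡ eq

spider⇒emb : {V : Set} {E : V → V → Set} (ls : List ℕ) {x : V} {legs : List (List V)} → IsSpider E (map suc ls) x legs →
  ∃ λ f → Emb E (spiderSize ls) (spiderEdges 0 ls) f × spiderLinks x legs ≡ map (onEdge f) (spiderEdges 0 ls)
spider⇒emb {E = E} ls {x} {legs} (lens , u , walks) = f ,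
  ((λ p q → nth-injective x u (≤-trans p size) (≤-trans q size)) , λ {i} {j} ij → edge (subst ((f i , f j) ∈_) (sym links) (∈-map⁺ (onEdge f) ij))) , links
  where
  f = nth x (x ∷ concat legs)
  size : spiderSize ls ≤ length (x ∷ concat legs)
  size = ≤-reflexive (cong suc (trans (cong sum (sym lens)) (sym (length-concat legs))))
  links : spiderLinks x legs ≡ map (onEdge f) (spiderEdges 0 ls)
  links = trans (cong (spiderLinks x) (sym (legsOf-nth x [ x ] 0 refl ls legs lens))) (spiderLinks-legsOf f 0 ls)
  edge : ∀ {u v} → (u , v) ∈ spiderLinks x legs → E u v
  edge i with find (∈-concatMap⁻ (lnk x) {xs = legs} i)
  ... | leg , leg∈ , j = All.lookup walks leg∈ j

-- Pendant edges of spiders and the theorem for spiders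

∈-chain⁻ : ∀ s l {i j} → (i , j) ∈ chain s l → suc i ≡ j × s ≤ i × j ≤ s + l
∈-chain⁻ s (suc l) (here refl) = refl , ≤-refl , subst (suc s ≤_) (sym (+-suc s l)) (s≤s (m≤m+n s l))
∈-chain⁻ s (suc l) {j = j} (there p) with ∈-chain⁻ (suc s) l p
... | e , q , r = e , <⇒≤ q , subst (j ≤_) (sym (+-suc s l)) r

∈-spiderEdges⁻ : ∀ o ls {i j} → (i , j) ∈ spiderEdges o ls →
  i < j × o < j × j ≤ o + sum (map suc ls) × (i ≡ 0 ⊎ o < i)
∈-spiderEdges⁻ o (l ∷ ls) {i} {j} p with ∈-++⁻ ((0 , suc o) ∷ chain (suc o) l) p
... | inj₁ (here refl) = s≤s z≤n , ≤-refl , subst (suc o ≤_) (sym (+-suc o _)) (s≤s (m≤m+n o _)) , inj₁ refl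
... | inj₁ (there q) with ∈-chain⁻ (suc o) l q
...   | refl , lo , hi = ≤-refl , s≤s (<⇒≤ lo) ,
        ≤-trans hi (subst (_≤ o + (suc l + sum (map suc ls))) (+-suc o l) (+-monoʳ-≤ o (m≤m+n (suc l) _))) , inj₂ lo
∈-spiderEdges⁻ o (l ∷ ls) {i} {j} p | inj₂ q with ∈-spiderEdges⁻ (o + suc l) ls q
... | a , b , c , d = a , ≤-<-trans (m≤m+n o (suc l)) b , ≤-trans c (≤-reflexive (+-assoc o (suc l) _)) ,
        [ inj₁ , (λ e → inj₂ (≤-<-trans (m≤m+n o (suc l)) e)) ]′ d

chain-last : ∀ s m → (s + m , suc (s + m)) ∈ chain s (suc m)
chain-last s zero rewrite +-identityʳ s = here refl
chain-last s (suc m) rewrite +-suc s m = there (chain-last (suc s) m)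

pendant-¬NIM : ∀ {n} (c : Coloring n) {β : Bool} {K : ℕ} {es : List (ℕ × ℕ)} →
  Bounded K es → Loopless es → {a b : ℕ} → PendantAt es a b → a ≢ b → (b , a) ∈ es →
  {Q : List (Fin n)} → MonoClique c β Q → K ≤ length Q → {u w : Fin n} → u ∉ Q → w ∉ Q → u ≢ w →
  (∀ {q} → q ∈ Q → col c u q ≡ β) → col c u w ≡ β → ¬ NIM (fromEdges K es) c u w
pendant-¬NIM c {K = K} {es} bd ll {a} {b} pend a≢b ba {Q} cl K≤ {u} {w} u∉ w∉ u≢w uQ uw =
  subst₂ (λ x y → ¬ NIM (fromEdges K es) c x y)
    (trans (update-≢ _ a w (a≢b ∘ sym)) (update-≡ (nth u Q) b u)) (update-≡ (nth u Q [ b ↦ u ]) a w)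
    (emb⇒¬NIM c bd (pendant-clique-emb c bd ll pend a≢b cl K≤ u w u∉ w∉ u≢w uQ uw) ba)

spider-feqex : (l : ℕ) (ls : List ℕ) → EventuallyFeqEx (spider l ls)
spider-feqex l ls = eventually-feqex bd (here refl) (ramseyBound (poolSize K) (poolSize K)) λ n le c ex h m<k →
    <⇒≱ m<k (nimGraph-free⇒≤ex bd (here refl) c (free c le) ex h)
  where
  es = spiderEdges 0 (l ∷ ls)
  K = spiderSize (l ∷ ls)
  H = fromEdges K es
  bd : Bounded K es
  bd p with ∈-spiderEdges⁻ 0 (l ∷ ls) p
  ... | a , _ , b , _ = s≤s (≤-trans (<⇒≤ a) b) , s≤s b
  ll : Loopless es
  ll p = <⇒≢ (proj₁ (∈-spiderEdges⁻ 0 (l ∷ ls) p))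
  -- The tip of the first leg; for `l` = 0 its neighbour is the centre 0.
  pend : PendantAt es (suc l) l
  pend p with ∈-++⁻ ((0 , 1) ∷ chain 1 l) p
  ... | inj₁ (here refl) = (λ ()) , suc-injective
  ... | inj₁ (there q) with ∈-chain⁻ 1 l q
  ...   | refl , _ , hi = (λ { refl → contradiction hi (<⇒≱ ≤-refl) }) , suc-injective
  pend p | inj₂ q with ∈-spiderEdges⁻ (suc l) ls q
  ... | _ , lo , _ , d = (λ { refl → ⊥-elim ([ (λ ()) , <-irrefl refl ]′ d) }) , λ { refl → contradiction lo (<-irrefl refl) }
  free : ∀ {n} (c : Coloring n) → ramseyBound (poolSize K) (poolSize K) ≤ n → ¬ Contains (nimGraph H c) H
  free {n} c le (φ , inj , ed) = nim-spider-free c (NIM H c) (NIM-sym {es = es} c) (map suc (l ∷ ls)) nonN pe le _ _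
      (emb⇒spider (l ∷ ls) em) (here refl)
    where
    em : Emb (NIM H c) K es (extend φ)
    em = copy⇒emb bd {NIM H c} φ inj λ a b p → proj₁ (nimGraph⁻ bd (here refl) c (ed a b p))
    nonN : ∀ β x legs → IsSpider (λ u v → col c u v ≡ β) (map suc (l ∷ ls)) x legs →
      ∀ {u v} → (u , v) ∈ spiderLinks x legs → ¬ NIM H c u v
    nonN β x legs sp {u} {v} i with spider⇒emb (l ∷ ls) sp
    ... | f , emb , links with ∈-map⁻ (onEdge f) (subst ((u , v) ∈_) links i)
    ...   | _ , j , refl = emb⇒¬NIM c bd emb j
    pe : ∀ {β Q u w} → MonoClique c β Q → K ≤ length Q → u ∉ Q → w ∉ Q → u ≢ w →
      (∀ {q} → q ∈ Q → col c u q ≡ β) → col c u w ≡ β → ¬ NIM H c u w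
    pe cl K≤ u∉ w∉ u≢w uQ uw = pendant-¬NIM c bd ll pend (λ e → <-irrefl (sym e) ≤-refl) (∈-++⁺ˡ (last-edge l)) cl K≤ u∉ w∉ u≢w uQ uw
      where
      last-edge : ∀ l → (l , suc l) ∈ (0 , 1) ∷ chain 1 l
      last-edge zero = here refl
      last-edge (suc l) = there (chain-last 1 l)

-- Double brooms as lists: the path P₀ ++ [ s ], the leaves L₁ at its first and L₂ at its last vertex

lnks : {V : Set} → List V → List (V × V)
lnks [] = []
lnks (x ∷ xs) = lnk x xs

-- The default covers the path with the single vertex `s`, which then carries both groups of leaves.
headOr : {V : Set} → V → List V → V
headOr s [] = s
headOr s (x ∷ _) = x

broomLinks : {V : Set} → List V → V → List V → List V → List (V × V)
broomLinks P₀ s L₁ L₂ = lnks (P₀ ++ [ s ]) ++ map (headOr s P₀ ,_) L₁ ++ map (s ,_) L₂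

-- Here and below `t` is the number of edges of the path, one less than its number of vertices. The
-- last vertex `s` is kept apart because the constructions fix that end.
record IsBroom {V : Set} (E : V → V → Set) (t s₁ s₂ : ℕ) (P₀ : List V) (s : V) (L₁ L₂ : List V) : Set where
  constructor isBroom
  field
    path-length : length P₀ ≡ t
    leaves₁-length : length L₁ ≡ s₁
    leaves₂-length : length L₂ ≡ s₂
    unique : Unique (P₀ ++ s ∷ L₁ ++ L₂)
    edges : ∀ {u v} → (u , v) ∈ broomLinks P₀ s L₁ L₂ → E u v

map-leaves : {V : Set} (f : ℕ → V) (i a m : ℕ) → map (f i ,_) (seg f a m) ≡ map (onEdge f) (leaves i a m)
map-leaves f i a zero = refl
map-leaves f i a (suc m) = cong (_ ∷_) (map-leaves f i (suc a) m)

seg-snoc : {V : Set} (f : ℕ → V) (a m : ℕ) → seg f a m ++ [ f (a + m) ] ≡ seg f a (suc m)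
seg-snoc f a m = trans (sym (seg-++ f a m 1)) (cong (seg f a) (+-comm m 1))

broomLinks-seg : {V : Set} (f : ℕ → V) (t s₁ s₂ : ℕ) →
  broomLinks (seg f 0 t) (f t) (seg f (suc t) s₁) (seg f (suc t + s₁) s₂) ≡ map (onEdge f) (doubleBroomEdges t s₁ s₂)
broomLinks-seg f t s₁ s₂ = begin
    lnks (seg f 0 t ++ [ f t ]) ++ map (headOr (f t) (seg f 0 t) ,_) (seg f (suc t) s₁) ++ map (f t ,_) (seg f (suc t + s₁) s₂)
      ≡⟨ cong₂ _++_ (trans (cong lnks (seg-snoc f 0 t)) (lnk-seg f 0 t))
           (cong₂ _++_ (trans (cong (λ x → map (x ,_) (seg f (suc t) s₁)) (head≡ t)) (map-leaves f 0 (suc t) s₁)) (map-leaves f t _ s₂)) ⟩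
    map g (chain 0 t) ++ map g (leaves 0 (suc t) s₁) ++ map g (leaves t (suc t + s₁) s₂)
      ≡⟨ cong (map g (chain 0 t) ++_) (LP.map-++ g (leaves 0 (suc t) s₁) _) ⟨
    map g (chain 0 t) ++ map g (leaves 0 (suc t) s₁ ++ leaves t (suc t + s₁) s₂)
      ≡⟨ LP.map-++ g (chain 0 t) _ ⟨
    map g (doubleBroomEdges t s₁ s₂) ∎
  where
  open ≡-Reasoning
  g = onEdge f
  head≡ : ∀ t → headOr (f t) (seg f 0 t) ≡ f 0
  head≡ zero = refl
  head≡ (suc t) = refl

broomSize : ℕ → ℕ → ℕ → ℕ
broomSize t s₁ s₂ = suc t + s₁ + s₂

emb⇒broom : {V : Set} {E : V → V → Set} {f : ℕ → V} (t s₁ s₂ : ℕ) → Emb E (broomSize t s₁ s₂) (doubleBroomEdges t s₁ s₂) f →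
  IsBroom E t s₁ s₂ (seg f 0 t) (f t) (seg f (suc t) s₁) (seg f (suc t + s₁) s₂)
emb⇒broom {E = E} {f} t s₁ s₂ (inj , ed) = isBroom (length-seg f 0 t) (length-seg f (suc t) s₁) (length-seg f _ s₂)
    (subst Unique pieces (seg-unique inj 0 (broomSize t s₁ s₂) ≤-refl)) edge
  where
  open ≡-Reasoning
  pieces : seg f 0 (broomSize t s₁ s₂) ≡ seg f 0 t ++ f t ∷ seg f (suc t) s₁ ++ seg f (suc t + s₁) s₂
  pieces = begin
    seg f 0 (suc t + s₁ + s₂) ≡⟨ cong (seg f 0) (trans (+-assoc (suc t) s₁ s₂) (sym (+-suc t (s₁ + s₂)))) ⟩
    seg f 0 (t + suc (s₁ + s₂)) ≡⟨ seg-++ f 0 t _ ⟩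
    seg f 0 t ++ f t ∷ seg f (suc t) (s₁ + s₂) ≡⟨ cong (λ l → seg f 0 t ++ f t ∷ l) (seg-++ f (suc t) s₁ s₂) ⟩
    seg f 0 t ++ f t ∷ seg f (suc t) s₁ ++ seg f (suc t + s₁) s₂ ∎
  edge : ∀ {u v} → (u , v) ∈ broomLinks (seg f 0 t) (f t) (seg f (suc t) s₁) (seg f (suc t + s₁) s₂) → E u v
  edge {u} {v} i with ∈-map⁻ (onEdge f) (subst ((u , v) ∈_) (broomLinks-seg f t s₁ s₂) i)
  ... | _ , j , refl = ed j

broom⇒emb : {V : Set} {E : V → V → Set} {t s₁ s₂ : ℕ} {P₀ : List V} {s : V} {L₁ L₂ : List V} → IsBroom E t s₁ s₂ P₀ s L₁ L₂ →
  ∃ λ f → Emb E (broomSize t s₁ s₂) (doubleBroomEdges t s₁ s₂) f × broomLinks P₀ s L₁ L₂ ≡ map (onEdge f) (doubleBroomEdges t s₁ s₂)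
broom⇒emb {V} {E} {P₀ = P₀} {s} {L₁} {L₂} (isBroom refl refl refl u ed) = f ,
  ((λ p q → nth-injective s u (≤-trans p size) (≤-trans q size)) ,
   λ {i} {j} ij → ed (subst ((f i , f j) ∈_) (sym links) (∈-map⁺ (onEdge f) ij))) , links
  where
  t = length P₀
  s₁ = length L₁
  s₂ = length L₂
  xs = P₀ ++ s ∷ L₁ ++ L₂
  f = nth s xs
  size : broomSize t s₁ s₂ ≤ length xs
  size = ≤-reflexive (sym (trans (LP.length-++ P₀) (trans (+-suc t _)
    (trans (cong (λ m → suc (t + m)) (LP.length-++ L₁)) (sym (+-assoc (suc t) s₁ s₂))))))
  xs₁ : xs ≡ (P₀ ++ [ s ]) ++ L₁ ++ L₂
  xs₁ = sym (LP.++-assoc P₀ [ s ] (L₁ ++ L₂))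
  xs₂ : xs ≡ ((P₀ ++ [ s ]) ++ L₁) ++ L₂ ++ []
  xs₂ = trans xs₁ (trans (sym (LP.++-assoc (P₀ ++ [ s ]) L₁ L₂)) (cong (((P₀ ++ [ s ]) ++ L₁) ++_) (sym (LP.++-identityʳ L₂))))
  len₁ : length (P₀ ++ [ s ]) ≡ suc t
  len₁ = trans (LP.length-++ P₀) (+-comm t 1)
  P₀≡ : seg f 0 t ≡ P₀
  P₀≡ = seg-nth s [] P₀ (s ∷ L₁ ++ L₂)
  s≡ : f t ≡ s
  s≡ = trans (cong f (sym (+-identityʳ t))) (nth-++ʳ s P₀ (s ∷ L₁ ++ L₂) 0)
  L₁≡ : seg f (suc t) s₁ ≡ L₁
  L₁≡ = trans (cong₂ (λ ys m → seg (nth s ys) m s₁) xs₁ (sym len₁)) (seg-nth s (P₀ ++ [ s ]) L₁ L₂)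
  L₂≡ : seg f (suc t + s₁) s₂ ≡ L₂
  L₂≡ = trans (cong₂ (λ ys m → seg (nth s ys) m s₂) xs₂ (sym (trans (LP.length-++ (P₀ ++ [ s ])) (cong (_+ s₁) len₁))))
              (seg-nth s ((P₀ ++ [ s ]) ++ L₁) L₂ [])
  links : broomLinks P₀ s L₁ L₂ ≡ map (onEdge f) (doubleBroomEdges t s₁ s₂)
  links = trans (sym (cong₂ (λ (p , x) (k , l) → broomLinks p x k l) (cong₂ _,_ P₀≡ s≡) (cong₂ _,_ L₁≡ L₂≡))) (broomLinks-seg f t s₁ s₂)

∈-leaves⁻ : ∀ c a m {i j} → (i , j) ∈ leaves c a m → i ≡ c × a ≤ j × j < a + m
∈-leaves⁻ c a (suc m) (here refl) = refl , ≤-refl , subst (a <_) (sym (+-suc a m)) (s≤s (m≤m+n a m))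
∈-leaves⁻ c a (suc m) {j = j} (there p) with ∈-leaves⁻ c (suc a) m p
... | e , q , r = e , <⇒≤ q , subst (j <_) (sym (+-suc a m)) r

data BroomEdge (t s₁ s₂ : ℕ) : ℕ → ℕ → Set where
  on-path : ∀ {i} → suc i ≤ t → BroomEdge t s₁ s₂ i (suc i)
  leaf₁ : ∀ {j} → suc t ≤ j → j < suc t + s₁ → BroomEdge t s₁ s₂ 0 j
  leaf₂ : ∀ {j} → suc t + s₁ ≤ j → j < suc t + s₁ + s₂ → BroomEdge t s₁ s₂ t j

broomEdge : ∀ t s₁ s₂ {i j} → (i , j) ∈ doubleBroomEdges t s₁ s₂ → BroomEdge t s₁ s₂ i j
broomEdge t s₁ s₂ p with ∈-++⁻ (chain 0 t) p
... | inj₁ q with ∈-chain⁻ 0 t q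
...   | refl , _ , hi = on-path hi
broomEdge t s₁ s₂ p | inj₂ q with ∈-++⁻ (leaves 0 (suc t) s₁) q
... | inj₁ r with ∈-leaves⁻ 0 (suc t) s₁ r
...   | refl , lo , hi = leaf₁ lo hi
broomEdge t s₁ s₂ p | inj₂ q | inj₂ r with ∈-leaves⁻ t (suc t + s₁) s₂ r
...   | refl , lo , hi = leaf₂ lo hi

broom-bounded : ∀ t s₁ s₂ → Bounded (broomSize t s₁ s₂) (doubleBroomEdges t s₁ s₂)
broom-bounded t s₁ s₂ p with broomEdge t s₁ s₂ p
... | on-path h = ≤-trans (≤-trans h (n≤1+n t)) (≤-trans (m≤m+n (suc t) s₁) (m≤m+n _ s₂)) ,
                  ≤-trans (s≤s h) (≤-trans (m≤m+n (suc t) s₁) (m≤m+n _ s₂))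
... | leaf₁ lo hi = s≤s z≤n , ≤-trans hi (m≤m+n _ s₂)
... | leaf₂ lo hi = ≤-trans (m≤m+n (suc t) s₁) (m≤m+n _ s₂) , hi

broom-loopless : ∀ t s₁ s₂ → Loopless (doubleBroomEdges t s₁ s₂)
broom-loopless t s₁ s₂ p with broomEdge t s₁ s₂ p
... | on-path h = <⇒≢ ≤-refl
... | leaf₁ (s≤s _) hi = λ ()
... | leaf₂ lo hi = <⇒≢ (≤-trans (m≤m+n (suc t) s₁) lo)

broom-pendant : ∀ t s₁ s₂ → PendantAt (doubleBroomEdges t s₁ s₂) (suc t + s₁) t
broom-pendant t s₁ s₂ p with broomEdge t s₁ s₂ p
... | on-path h = (λ { refl → contradiction (≤-trans (m≤m+n (suc t) s₁) (<⇒≤ h)) (<⇒≱ ≤-refl) }) ,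
                  λ { refl → contradiction (≤-trans (m≤m+n t s₁) (<⇒≤ h)) (λ _ → <⇒≱ h (m≤m+n t s₁)) }
... | leaf₁ lo hi = (λ ()) , λ { refl → contradiction hi (<-irrefl refl) }
... | leaf₂ lo hi = (λ e → contradiction (subst (suc t ≤_) (sym e) (m≤m+n (suc t) s₁)) (<⇒≱ ≤-refl)) , λ _ → refl

broom-pendant-edge : ∀ t s₁ s₂ → (t , suc t + s₁) ∈ doubleBroomEdges t s₁ (suc s₂)
broom-pendant-edge t s₁ s₂ = ∈-++⁺ʳ (chain 0 t) (∈-++⁺ʳ (leaves 0 (suc t) s₁) (here refl))

broom-pendant-≢ : ∀ t s₁ → suc t + s₁ ≢ t
broom-pendant-≢ t s₁ e = <⇒≱ (≤-refl {suc t}) (subst (suc t ≤_) e (m≤m+n (suc t) s₁))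

broom⇒¬NIM : ∀ {n} (c : Coloring n) {β t s₁ s₂ P₀ s L₁ L₂} → IsBroom (λ u v → col c u v ≡ β) t s₁ s₂ P₀ s L₁ L₂ →
  ∀ {u v} → (u , v) ∈ broomLinks P₀ s L₁ L₂ → ¬ NIM (doubleBroom t s₁ s₂) c u v
broom⇒¬NIM c {t = t} {s₁} {s₂} br {u} {v} i with broom⇒emb br
... | f , em , links with ∈-map⁻ (onEdge f) (subst ((u , v) ∈_) links i)
...   | _ , j , refl = emb⇒¬NIM c (broom-bounded t s₁ s₂) em j

-- Double brooms with s₁ = 0, which are spiders

lnks-snoc : {V : Set} (zs : List V) (y x : V) → lnks ((zs ++ [ y ]) ++ [ x ]) ≡ lnks (zs ++ [ y ]) ++ [ (y , x) ]
lnks-snoc [] y x = refl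
lnks-snoc (z ∷ zs) y x = go z zs
  where
  go : ∀ z zs → lnk z ((zs ++ [ y ]) ++ [ x ]) ≡ lnk z (zs ++ [ y ]) ++ [ (y , x) ]
  go z [] = refl
  go z (w ∷ zs) = cong (_ ∷_) (go w zs)

lnks-reverse : {V : Set} (x : V) (ys : List V) → lnks (reverse ys ++ [ x ]) ≡ reverse (map ×-swap (lnk x ys))
lnks-reverse x [] = refl
lnks-reverse x (y ∷ ys) = begin
    lnks (reverse (y ∷ ys) ++ [ x ]) ≡⟨ cong (λ l → lnks (l ++ [ x ])) (LP.unfold-reverse y ys) ⟩
    lnks ((reverse ys ++ [ y ]) ++ [ x ]) ≡⟨ lnks-snoc (reverse ys) y x ⟩
    lnks (reverse ys ++ [ y ]) ++ [ (y , x) ] ≡⟨ cong (_++ [ (y , x) ]) (lnks-reverse y ys) ⟩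
    reverse (map ×-swap (lnk y ys)) ++ [ (y , x) ] ≡⟨ LP.unfold-reverse (y , x) (map ×-swap (lnk y ys)) ⟨
    reverse ((y , x) ∷ map ×-swap (lnk y ys)) ∎
  where open ≡-Reasoning

∈-lnks-reverse⁺ : {V : Set} {x u v : V} (ys : List V) → (u , v) ∈ lnk x ys → (v , u) ∈ lnks (reverse ys ++ [ x ])
∈-lnks-reverse⁺ {x = x} {u} {v} ys i = subst ((v , u) ∈_) (sym (lnks-reverse x ys))
  (PermP.∈-resp-↭ (↭-sym (PermP.↭-reverse _)) (∈-map⁺ ×-swap i))

∈-lnks-reverse⁻ : {V : Set} {x u v : V} (ys : List V) → (u , v) ∈ lnks (reverse ys ++ [ x ]) → (v , u) ∈ lnk x ys
∈-lnks-reverse⁻ {x = x} {u} {v} ys i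
  with ∈-map⁻ ×-swap (PermP.∈-resp-↭ (PermP.↭-reverse (map ×-swap (lnk x ys))) (subst ((u , v) ∈_) (lnks-reverse x ys) i))
... | _ , j , refl = j

singles : {V : Set} → List V → List (List V)
singles = map [_]

concat-singles : {V : Set} (xs : List V) → concat (singles xs) ≡ xs
concat-singles [] = refl
concat-singles (x ∷ xs) = cong (x ∷_) (concat-singles xs)

spiderLinks-singles : {V : Set} (x : V) (ys : List V) → spiderLinks x (singles ys) ≡ map (x ,_) ys
spiderLinks-singles x [] = refl
spiderLinks-singles x (y ∷ ys) = cong (_ ∷_) (spiderLinks-singles x ys)

map-length-singles : {V : Set} (ys : List V) → map length (singles ys) ≡ replicate (length ys) 1
map-length-singles [] = refl
map-length-singles (y ∷ ys) = cong (1 ∷_) (map-length-singles ys)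

singles-from-lengths : {V : Set} (s : ℕ) (legs : List (List V)) → map length legs ≡ replicate s 1 →
  ∃ λ ys → legs ≡ singles ys × length ys ≡ s
singles-from-lengths zero [] _ = [] , refl , refl
singles-from-lengths (suc s) ((y ∷ []) ∷ legs) e with singles-from-lengths s legs (LP.∷-injectiveʳ e)
... | ys , refl , refl = y ∷ ys , refl , refl

unique-resp-↭ : {A : Set} {xs ys : List A} → xs ↭ ys → Unique xs → Unique ys
unique-resp-↭ p = PermS.Unique-resp-↭ (setoid _) (↭⇒↭ₛ p)

reverse-centre-↭ : {V : Set} (P : List V) (s : V) (L : List V) → reverse P ++ s ∷ L ↭ s ∷ P ++ L
reverse-centre-↭ P s L = ↭-trans (PermP.shift s (reverse P) L) (prep s (PermP.++⁺ʳ L (PermP.↭-reverse P)))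

sum-replicate-1 : ∀ s → sum (replicate s 1) ≡ s
sum-replicate-1 zero = refl
sum-replicate-1 (suc s) = cong suc (sum-replicate-1 s)

-- The centre is the end carrying the leaves; the path, read backwards, is one leg and each leaf is
-- a leg of length one.
broom⇒spider : {V : Set} {E : V → V → Set} → (∀ {u v} → E u v → E v u) → ∀ {t s₂ P₀ s L₂} → IsBroom E t 0 s₂ P₀ s [] L₂ →
  IsSpider E (t ∷ replicate s₂ 1) s (reverse P₀ ∷ singles L₂)
broom⇒spider {E = E} sy {P₀ = P₀} {s} {L₂} (isBroom refl _ refl u ed) =
  cong₂ _∷_ (LP.length-reverse P₀) (map-length-singles L₂) ,
  unique-resp-↭ (↭-trans (↭-trans (PermP.shift s P₀ L₂) (prep s (PermP.++⁺ʳ L₂ (↭-sym (PermP.↭-reverse P₀)))))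
    (subst (λ l → s ∷ reverse P₀ ++ L₂ ↭ s ∷ reverse P₀ ++ l) (sym (concat-singles L₂)) ↭-refl)) u ,
  leg ∷ AllP.map⁺ (All.tabulate λ y∈ → λ { (here refl) → ed (∈-++⁺ʳ (lnks (P₀ ++ [ s ])) (∈-map⁺ (s ,_) y∈)) })
  where
  leg : Walk E s (reverse P₀)
  leg {u} {v} i = sy (ed (∈-++⁺ˡ (subst (λ p → (v , u) ∈ lnks (p ++ [ s ])) (LP.reverse-involutive P₀) (∈-lnks-reverse⁺ (reverse P₀) i))))

spider⇒broom : {V : Set} {E : V → V → Set} → (∀ {u v} → E u v → E v u) → ∀ {t s₂ x leg ys} →
  IsSpider E (t ∷ replicate s₂ 1) x (leg ∷ singles ys) → IsBroom E t 0 s₂ (reverse leg) x [] ys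
spider⇒broom {E = E} sy {t} {s₂} {x} {leg} {ys} (lens , u , w ∷ ws) =
  isBroom (trans (LP.length-reverse leg) (LP.∷-injectiveˡ lens)) refl
    (trans (sym (sum-replicate-1 (length ys))) (trans (cong sum (trans (sym (map-length-singles ys)) (LP.∷-injectiveʳ lens))) (sum-replicate-1 s₂)))
    (unique-resp-↭ (↭-sym (reverse-centre-↭ leg x ys)) (subst (λ l → Unique (x ∷ leg ++ l)) (concat-singles ys) u)) edge
  where
  edge : ∀ {u v} → (u , v) ∈ broomLinks (reverse leg) x [] ys → E u v
  edge i with ∈-++⁻ (lnks (reverse leg ++ [ x ])) i
  ... | inj₁ j = sy (w (∈-lnks-reverse⁻ leg j))
  ... | inj₂ j with ∈-map⁻ (x ,_) j
  ...   | y , y∈ , refl = All.lookup ws (∈-map⁺ [_] y∈) (here refl)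

broom₀-feqex : (t s₂ : ℕ) → EventuallyFeqEx (doubleBroom t 0 (suc s₂))
broom₀-feqex t s₂ = eventually-feqex bd e₀ (ramseyBound P P) λ n le c ex h m<k →
    <⇒≱ m<k (nimGraph-free⇒≤ex bd e₀ c (free c le) ex h)
  where
  es = doubleBroomEdges t 0 (suc s₂)
  K = broomSize t 0 (suc s₂)
  lens = t ∷ replicate (suc s₂) 1
  P = poolSize (suc (sum lens))
  H = fromEdges K es
  bd = broom-bounded t 0 (suc s₂)
  e₀ = broom-pendant-edge t 0 s₂
  free : ∀ {n} (c : Coloring n) → ramseyBound P P ≤ n → ¬ Contains (nimGraph H c) H
  free {n} c le (φ , inj , ed) = nim-spider-free c (NIM H c) (NIM-sym {es = es} c) lens nonN pe le _ _
      (broom⇒spider {E = NIM H c} (NIM-sym {es = es} c) (emb⇒broom t 0 (suc s₂) em))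
      (∈-++⁺ʳ (lnk (extend φ t) (reverse (seg (extend φ) 0 t))) (here refl))
    where
    em : Emb (NIM H c) K es (extend φ)
    em = copy⇒emb bd {NIM H c} φ inj λ a b p → proj₁ (nimGraph⁻ bd e₀ c (ed a b p))
    nonN : ∀ β x legs → IsSpider (λ u v → col c u v ≡ β) lens x legs → ∀ {u v} → (u , v) ∈ spiderLinks x legs → ¬ NIM H c u v
    nonN β x (leg ∷ legs) sp@(lens≡ , _) {u} {v} i nim with singles-from-lengths (suc s₂) legs (LP.∷-injectiveʳ lens≡)
    ... | ys , refl , _ with ∈-++⁻ (lnk x leg) i
    ...   | inj₁ j = broom⇒¬NIM c br (∈-++⁺ˡ (∈-lnks-reverse⁺ leg j)) (NIM-sym {es = es} c nim)
      where br = spider⇒broom {E = λ u v → col c u v ≡ β} (trans (csym c _ _)) sp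
    ...   | inj₂ j = broom⇒¬NIM c br (∈-++⁺ʳ (lnks (reverse leg ++ [ x ])) (subst ((u , v) ∈_) (spiderLinks-singles x ys) j)) nim
      where br = spider⇒broom {E = λ u v → col c u v ≡ β} (trans (csym c _ _)) sp
    pe : ∀ {β Q u w} → MonoClique c β Q → suc (sum lens) ≤ length Q → u ∉ Q → w ∉ Q → u ≢ w →
      (∀ {q} → q ∈ Q → col c u q ≡ β) → col c u w ≡ β → ¬ NIM H c u w
    pe cl le = pendant-¬NIM c bd (broom-loopless t 0 (suc s₂)) (broom-pendant t 0 (suc s₂)) (broom-pendant-≢ t 0) e₀ cl
      (≤-trans (≤-reflexive (cong suc (trans (cong (_+ suc s₂) (+-identityʳ t)) (cong (t +_) (sym (sum-replicate-1 (suc s₂))))))) le)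

-- Few vertices of low NIM-degree

-- Connectivity as propagation of invariants, the form in which it is applied: to lying in one
-- block, to avoiding the replaced vertices and to having NIM-edges of one colour only.
Connected : ℕ → List (ℕ × ℕ) → Set₁
Connected K es = ∀ (P : ℕ → Set) → (∀ {i j} → (i , j) ∈ es → (P i → P j) × (P j → P i)) →
  P 0 → ∀ {i} → i < K → P i

-- Degrees count ordered pairs, so edge numbers are compared after doubling.
doubled : ∀ {n} {P : Fin n → Fin n → Set} {k} → (∀ {u v} → P u v → P v u) → HasCard P k →
  Σ (List (Fin n × Fin n)) λ O → Unique O × length O ≡ k + k ×
    (∀ {u v} → (u , v) ∈ O → P u v × u ≢ v) × (∀ {u v} → P u v → u ≢ v → (u , v) ∈ O)
doubled {n} {P} sy (L , u , refl , s , c) = L ++ map ×-swap L ,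
    unique-++ u (UP.map⁺ (λ { refl → refl }) u) dis ,
    trans (LP.length-++ L) (cong (length L +_) (LP.length-map ×-swap L)) , snd , cmp
  where
  dis : ∀ {e} → e ∈ L → e ∉ map ×-swap L
  dis i j with ∈-map⁻ ×-swap j
  ... | (x , y) , k , refl = <-asym (proj₁ (s _ _ i)) (proj₁ (s _ _ k))
  snd : ∀ {u v} → (u , v) ∈ L ++ map ×-swap L → P u v × u ≢ v
  snd i with ∈-++⁻ L i
  ... | inj₁ j = proj₂ (s _ _ j) , FP.<⇒≢ (proj₁ (s _ _ j))
  ... | inj₂ j with ∈-map⁻ ×-swap j
  ...   | (x , y) , k , refl = sy (proj₂ (s _ _ k)) , FP.<⇒≢ (proj₁ (s _ _ k)) ∘ sym
  cmp : ∀ {u v} → P u v → u ≢ v → (u , v) ∈ L ++ map ×-swap L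
  cmp {u} {v} p ne with <-cmp (toℕ u) (toℕ v)
  ... | tri< lt _ _ = ∈-++⁺ˡ (c u v lt p)
  ... | tri≈ _ e _ = contradiction (FP.toℕ-injective e) ne
  ... | tri> _ _ gt = ∈-++⁺ʳ L (∈-map⁺ ×-swap (c v u gt (sy p)))

chunks : {A : Set} → ℕ → ℕ → List A → List (List A)
chunks p zero xs = []
chunks p (suc r) xs = take p xs ∷ chunks p r (drop p xs)

concat-chunks : {A : Set} (p r : ℕ) (xs : List A) → length xs ≡ r * p → concat (chunks p r xs) ≡ xs
concat-chunks p zero [] e = refl
concat-chunks p (suc r) xs e = trans (cong (take p xs ++_) (concat-chunks p r (drop p xs)
    (trans (LP.length-drop p xs) (trans (cong (_∸ p) e) (m+n∸m≡n p (r * p)))))) (LP.take++drop≡id p xs)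

length-chunks : {A : Set} (p r : ℕ) (xs : List A) → length xs ≡ r * p → ∀ {B} → B ∈ chunks p r xs → length B ≡ p
length-chunks p (suc r) xs e (here refl) = length-take≤ p (subst (p ≤_) (sym e) (m≤m+n p (r * p)))
length-chunks p (suc r) xs e (there i) = length-chunks p r (drop p xs)
  (trans (LP.length-drop p xs) (trans (cong (_∸ p) e) (m+n∸m≡n p (r * p)))) i

pairsFrom : {A B : Set} → (A → List B) → List A → List (A × B)
pairsFrom g = concatMap (λ x → map (x ,_) (g x))

∈-pairsFrom⁺ : {A B : Set} (g : A → List B) {xs : List A} {x : A} {y : B} → x ∈ xs → y ∈ g x → (x , y) ∈ pairsFrom g xs
∈-pairsFrom⁺ g x∈ y∈ = ∈-concat⁺′ (∈-map⁺ _ y∈) (∈-map⁺ _ x∈)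

∈-pairsFrom⁻ : {A B : Set} (g : A → List B) (xs : List A) {x : A} {y : B} → (x , y) ∈ pairsFrom g xs → x ∈ xs × y ∈ g x
∈-pairsFrom⁻ g xs i with find (∈-concatMap⁻ (λ x → map (x ,_) (g x)) {xs = xs} i)
... | z , z∈ , j with ∈-map⁻ (z ,_) j
...   | y , y∈ , refl = z∈ , y∈

pairsFrom-unique : {A B : Set} (g : A → List B) {xs : List A} → Unique xs → (∀ x → Unique (g x)) → Unique (pairsFrom g xs)
pairsFrom-unique g {[]} u v = []
pairsFrom-unique g {x ∷ xs} (px ∷ u) v = unique-++ (UP.map⁺ (λ { refl → refl }) (v x)) (pairsFrom-unique g u v) dis
  where
  dis : ∀ {e} → e ∈ map (x ,_) (g x) → e ∉ pairsFrom g xs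
  dis i j with ∈-map⁻ (x ,_) i
  ... | y , _ , refl = All.lookup px (proj₁ (∈-pairsFrom⁻ g xs j)) refl

length-pairsFrom≤ : {A B : Set} (g : A → List B) (m : ℕ) (xs : List A) → (∀ {x} → x ∈ xs → length (g x) ≤ m) →
  length (pairsFrom g xs) ≤ length xs * m
length-pairsFrom≤ g m xs h = length-concatMap≤ _ m xs λ {x} i → subst (_≤ m) (sym (LP.length-map (x ,_) (g x))) (h i)

length-pairsFrom≥ : {A B : Set} (g : A → List B) (m : ℕ) (xs : List A) → (∀ {x} → x ∈ xs → m ≤ length (g x)) →
  length xs * m ≤ length (pairsFrom g xs)
length-pairsFrom≥ g m [] h = z≤n
length-pairsFrom≥ g m (x ∷ xs) h = subst (m + length xs * m ≤_) (sym (LP.length-++ (map (x ,_) (g x))))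
  (+-mono-≤ (subst (m ≤_) (sym (LP.length-map (x ,_) (g x))) (h (here refl))) (length-pairsFrom≥ g m xs (h ∘ there)))

module _ {n p : ℕ} {es : List (ℕ × ℕ)} (bd : Bounded (suc p) es) {i₀ j₀ : ℕ} (e₀ : (i₀ , j₀) ∈ es) (conn : Connected (suc p) es)
  (c : Coloring n) where

  private
    V = Fin n
    H = fromEdges (suc p) es

  NimEdge : V → V → Set
  NimEdge u v = NIM H c u v × u ≢ v

  nimEdge? : ∀ u v → Dec (NimEdge u v)
  nimEdge? u v = NIM? H c u v ×-dec ¬? (u FP.≟ v)

  nimEdge-sym : ∀ {u v} → NimEdge u v → NimEdge v u
  nimEdge-sym (a , b) = NIM-sym {es = es} c a , b ∘ sym

  nbrs : V → List V
  nbrs v = filter (nimEdge? v) (allFin n)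

  nbrs-unique : ∀ v → Unique (nbrs v)
  nbrs-unique v = UP.filter⁺ (nimEdge? v) (UP.allFin⁺ n)

  ∈-nbrs⁺ : ∀ {u v} → NimEdge u v → v ∈ nbrs u
  ∈-nbrs⁺ {u} e = ∈-filter⁺ (nimEdge? u) (∈-allFin _) e

  ∈-nbrs⁻ : ∀ {u v} → v ∈ nbrs u → NimEdge u v
  ∈-nbrs⁻ {u} i = proj₂ (∈-filter⁻ (nimEdge? u) {xs = allFin n} i)

  -- Replacing r blocks of p low-degree vertices by cliques K_p, and dropping the NIM edges of colour b,
  -- keeps the graph H-free. The r p replaced vertices gain at least r p / 2 edges, which pays for the dropped ones.
  module _ {b : Bool} {BL : List V} (inBL : ∀ {u v} → NimEdge u v → col c u v ≡ b → u ∈ BL)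
    {X : List V} (uX : Unique X) {r : ℕ} (X-len : length X ≡ r * p) where

    private
      blocks = chunks p r X

      X≡ : concat blocks ≡ X
      X≡ = concat-chunks p r X X-len

      SameBlock : V → V → Set
      SameBlock u v = Any (λ B → u ∈ B × v ∈ B) blocks

      Adj : V → V → Set
      Adj u v = u ≢ v × (SameBlock u v ⊎ (u ∉ X × v ∉ X × NIM H c u v × col c u v ≡ not b))

      adj? : ∀ u v → Dec (Adj u v)
      adj? u v = ¬? (u FP.≟ v) ×-dec (Data.List.Relation.Unary.Any.any? (λ B → ∈-DecFin u B ×-dec ∈-DecFin v B) blocks
        ⊎-dec (¬? (∈-DecFin u X) ×-dec (¬? (∈-DecFin v X) ×-dec (NIM? H c u v ×-dec (col c u v ≟B not b)))))

      adj-sym : ∀ {u v} → Adj u v → Adj v u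
      adj-sym (ne , inj₁ a) = ne ∘ sym , inj₁ (Data.List.Relation.Unary.Any.map (λ (x , y) → y , x) a)
      adj-sym (ne , inj₂ (x , y , q , w)) = ne ∘ sym , inj₂ (y , x , NIM-sym {es = es} c q , trans (csym c _ _) w)

      abstract
        adjB : V → V → Bool
        adjB u v = does (adj? u v)
        adjB⁻ : ∀ {u v} → adjB u v ≡ true → Adj u v
        adjB⁻ {u} {v} = does-true (adj? u v)
        adjB⁺ : ∀ {u v} → Adj u v → adjB u v ≡ true
        adjB⁺ {u} {v} = dec-true (adj? u v)

      G : Graph n
      G = record { adj = adjB }

      G-simple : IsSimple G
      G-simple = record { symm = sy ; loopless = lp }
        where
        lp : ∀ u → adjB u u ≡ false
        lp u with adjB u u in eq
        ... | false = refl
        ... | true = contradiction refl (proj₁ (adjB⁻ eq))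
        sy : ∀ u v → adjB u v ≡ adjB v u
        sy u v with adjB u v in e₁ | adjB v u in e₂
        ... | true | true = refl
        ... | false | false = refl
        ... | true | false = trans (sym (adjB⁺ (adj-sym (adjB⁻ e₁)))) e₂
        ... | false | true = trans (sym e₁) (adjB⁺ (adj-sym (adjB⁻ e₂)))

      block⊆X : ∀ {B v} → B ∈ blocks → v ∈ B → v ∈ X
      block⊆X {v = v} B∈ v∈ = subst (v ∈_) X≡ (∈-concat⁺′ v∈ B∈)

      blocks-disjoint : ∀ {Bs : List (List V)} {B B' v w} → Unique (concat Bs) → B ∈ Bs → B' ∈ Bs → v ∈ B → v ∈ B' → w ∈ B → w ∈ B'
      blocks-disjoint u (here refl) (here refl) v∈ v∈' w∈ = w∈
      blocks-disjoint {B ∷ Bs} u (here refl) (there j) v∈ v∈' w∈ = contradiction (∈-concat⁺′ v∈' j) (unique-++-disjoint B u v∈)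
      blocks-disjoint {B ∷ Bs} u (there i) (here refl) v∈ v∈' w∈ = contradiction (∈-concat⁺′ v∈ i) (unique-++-disjoint B u v∈')
      blocks-disjoint {B ∷ Bs} u (there i) (there j) = blocks-disjoint (unique-++ʳ B u) i j

      stays : ∀ {B u v} → B ∈ blocks → Adj u v → u ∈ B → v ∈ B
      stays B∈ (_ , inj₂ (u∉ , _)) u∈ = contradiction (block⊆X B∈ u∈) u∉
      stays B∈ (_ , inj₁ a) u∈ with find a
      ... | B' , B'∈ , u∈' , v∈' = blocks-disjoint (subst Unique (sym X≡) uX) B'∈ B∈ u∈' u∈ v∈'

      outside : ∀ {u v} → Adj u v → u ∉ X → v ∉ X
      outside (_ , inj₂ (_ , v∉ , _)) u∉ = v∉
      outside (_ , inj₁ a) u∉ with find a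
      ... | B , B∈ , u∈ , _ = contradiction (block⊆X B∈ u∈) u∉

      -- By connectivity, a copy that meets `X` stays inside one block, which has one vertex too
      -- few. A copy that avoids `X` consists of NIM-edges of the single colour `not b`, hence is a
      -- monochromatic copy through NIM-edges.
      G-free : ¬ Contains G H
      G-free (φ , inj , ed) = split (∈-DecFin (f 0) X)
        where
        f = extend φ
        em : Emb (λ u v → adjB u v ≡ true) (suc p) es f
        em = copy⇒emb bd {λ u v → adjB u v ≡ true} φ inj ed
        edge : ∀ {i j} → (i , j) ∈ es → Adj (f i) (f j)
        edge ij = adjB⁻ (proj₂ em ij)
        split : Dec (f 0 ∈ X) → ⊥
        split (yes f0∈) with find (∈-concat⁻ blocks (subst (f 0 ∈_) (sym X≡) f0∈))
        ... | B , B∈ , f0∈B = <⇒≱ {p} ≤-refl (begin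
            suc p ≡⟨ length-seg f 0 (suc p) ⟨
            length (seg f 0 (suc p)) ≤⟨ unique-⊆⇒length≤ (seg-unique (proj₁ em) 0 (suc p) ≤-refl) sub ⟩
            length B ≡⟨ length-chunks p r X X-len B∈ ⟩
            p ∎)
          where
          open ≤-Reasoning
          all : ∀ {i} → i < suc p → f i ∈ B
          all = conn (λ i → f i ∈ B) (λ ij → stays B∈ (edge ij) , stays B∈ (adj-sym (edge ij))) f0∈B
          sub : ∀ {v} → v ∈ seg f 0 (suc p) → v ∈ B
          sub i with ∈-seg⁻ f 0 (suc p) i
          ... | k , _ , lt , refl = all lt
        split (no f0∉) = emb⇒¬NIM c bd (proj₁ em , proj₂ ∘ red) e₀ (proj₁ (red e₀))
          where
          all : ∀ {i} → i < suc p → f i ∉ X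
          all = conn (λ i → f i ∉ X) (λ ij → outside (edge ij) , outside (adj-sym (edge ij))) f0∉
          red : ∀ {i j} → (i , j) ∈ es → NIM H c (f i) (f j) × col c (f i) (f j) ≡ not b
          red ij with edge ij
          ... | _ , inj₂ (_ , _ , nim , co) = nim , co
          ... | _ , inj₁ a with find a
          ...   | B , B∈ , i∈ , _ = contradiction (block⊆X B∈ i∈) (all (proj₁ (bd ij)))

    -- In ordered pairs, at most |BL|² + 2d|X| are lost and at least (p - 1)|X| are gained: a
    -- dropped edge of colour `b` has both ends in `BL`. As |BL|² ≤ |X|, the loss is at most (2d +
    -- 1)|X|.
    few-low : ∀ {m k} → IsEx n H m → HasCard (NIM H c) k → ∀ {d} → (∀ {x} → x ∈ X → length (nbrs x) ≤ d) →
      suc (d + d) ≤ p ∸ 1 → length BL * length BL ≤ length X → k ≤ m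
    few-low {m} {k} (_ , ub) hc {d} low d≤ BL≤ with hasCard-exists (λ u v → adjB u v ≟B true)
    ... | k' , hc' with doubled (NIM-sym {es = es} c) hc | doubled (λ {u} {v} e → trans (sym (IsSimple.symm G-simple u v)) e) hc'
    ... | O , uO , O-len , O-snd , O-cmp | O' , uO' , O'-len , O'-snd , O'-cmp =
      ≤-trans (double-cancel-≤ total) (ub k' (G , G-simple , G-free , hc'))
      where
      M = length X
      good? : (e : V × V) → Dec (proj₁ e ∉ X × proj₂ e ∉ X × col c (proj₁ e) (proj₂ e) ≡ not b)
      good? (u , v) = ¬? (∈-DecFin u X) ×-dec (¬? (∈-DecFin v X) ×-dec (col c u v ≟B not b))
      R = filter good? O
      bad = pairsFrom (λ _ → BL) BL ++ pairsFrom nbrs X ++ map ×-swap (pairsFrom nbrs X)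
      cover : ∀ {e} → e ∈ O → (proj₁ e ∉ X × proj₂ e ∉ X × col c (proj₁ e) (proj₂ e) ≡ not b) ⊎ e ∈ bad
      cover {u , v} i with O-snd i | ∈-DecFin u X | ∈-DecFin v X | bool-cases (col c u v) b
      ... | e | yes u∈ | _ | _ = inj₂ (∈-++⁺ʳ (pairsFrom (λ _ → BL) BL) (∈-++⁺ˡ (∈-pairsFrom⁺ nbrs u∈ (∈-nbrs⁺ e))))
      ... | e | no _ | yes v∈ | _ = inj₂ (∈-++⁺ʳ (pairsFrom (λ _ → BL) BL) (∈-++⁺ʳ (pairsFrom nbrs X)
              (∈-map⁺ ×-swap (∈-pairsFrom⁺ nbrs v∈ (∈-nbrs⁺ (nimEdge-sym e))))))
      ... | e | no _ | no _ | inj₁ bl = inj₂ (∈-++⁺ˡ (∈-pairsFrom⁺ (λ _ → BL) (inBL e bl) (inBL (nimEdge-sym e) (trans (csym c _ _) bl))))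
      ... | e | no u∉ | no v∉ | inj₂ rd = inj₁ (u∉ , v∉ , rd)
      nbrs' : V → List V
      nbrs' x = filter (λ v → adjB x v ≟B true) (allFin n)
      C = pairsFrom nbrs' X
      R++C : length R + length C ≤ k' + k'
      R++C = subst₂ _≤_ (LP.length-++ R) O'-len (unique-⊆⇒length≤
        (unique-++ (UP.filter⁺ good? uO) (pairsFrom-unique nbrs' uX λ x → UP.filter⁺ (λ v → adjB x v ≟B true) (UP.allFin⁺ n)) dis) sub)
        where
        dis : ∀ {e} → e ∈ R → e ∉ C
        dis i j = proj₁ (proj₂ (∈-filter⁻ good? {xs = O} i)) (proj₁ (∈-pairsFrom⁻ nbrs' X j))
        sub : ∀ {e} → e ∈ R ++ C → e ∈ O'
        sub {u , v} i with ∈-++⁻ R i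
        ... | inj₁ j with ∈-filter⁻ good? {xs = O} j
        ...   | j' , u∉ , v∉ , rd = O'-cmp (adjB⁺ (proj₂ (O-snd j') , inj₂ (u∉ , v∉ , proj₁ (O-snd j') , rd))) (proj₂ (O-snd j'))
        sub {u , v} i | inj₂ j with adjB⁻ (proj₂ (∈-filter⁻ (λ w → adjB u w ≟B true) {xs = allFin n} (proj₂ (∈-pairsFrom⁻ nbrs' X j))))
        ...   | a = O'-cmp (adjB⁺ a) (proj₁ a)
      C-len : M * (p ∸ 1) ≤ length C
      C-len = length-pairsFrom≥ nbrs' (p ∸ 1) X deg
        where
        deg : ∀ {x} → x ∈ X → p ∸ 1 ≤ length (nbrs' x)
        deg {x} x∈ with find (∈-concat⁻ blocks (subst (x ∈_) (sym X≡) x∈))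
        ... | B , B∈ , x∈B = ≤-trans (∸-monoˡ-≤ 1 (subst (_≤ length (B ∖ [ x ]) + 1) (length-chunks p r X X-len B∈) (length-∖ [ x ] uB)))
               (≤-trans (≤-reflexive (m+n∸n≡m (length (B ∖ [ x ])) 1)) (unique-⊆⇒length≤ (∖-unique [ x ] uB) sub))
          where
          block-unique : ∀ {Bs : List (List V)} {B} → Unique (concat Bs) → B ∈ Bs → Unique B
          block-unique {B ∷ _} u (here refl) = unique-++ˡ B u
          block-unique {B ∷ _} u (there i) = block-unique (unique-++ʳ B u) i
          uB : Unique B
          uB = block-unique (subst Unique (sym X≡) uX) B∈
          sub : ∀ {y} → y ∈ B ∖ [ x ] → y ∈ nbrs' x
          sub i with ∈-∖⁻ {xs = B} {F = [ x ]} i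
          ... | y∈ , y∉ = ∈-filter⁺ (λ v → adjB x v ≟B true) (∈-allFin _) (adjB⁺ ((λ { refl → y∉ (here refl) }) , inj₁ (lose B∈ (x∈B , y∈))))
      total : k + k ≤ k' + k'
      total = begin
        k + k ≡⟨ O-len ⟨
        length O ≤⟨ length-filter-cover good? uO cover ⟩
        length R + length bad ≤⟨ +-monoʳ-≤ (length R) bad-len ⟩
        length R + M * suc (d + d) ≤⟨ +-monoʳ-≤ (length R) (≤-trans (*-monoʳ-≤ M d≤) C-len) ⟩
        length R + length C ≤⟨ R++C ⟩
        k' + k' ∎
        where
        open ≤-Reasoning
        nb : length (pairsFrom nbrs X) ≤ M * d
        nb = length-pairsFrom≤ nbrs d X low
        bad-len : length bad ≤ M * suc (d + d)
        bad-len = begin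
          length bad ≡⟨ trans (LP.length-++ (pairsFrom (λ _ → BL) BL)) (cong (length (pairsFrom (λ _ → BL) BL) +_) (LP.length-++ (pairsFrom nbrs X))) ⟩
          length (pairsFrom (λ _ → BL) BL) + (length (pairsFrom nbrs X) + length (map ×-swap (pairsFrom nbrs X)))
            ≤⟨ +-mono-≤ (≤-trans (length-pairsFrom≤ (λ _ → BL) (length BL) BL (λ _ → ≤-refl)) BL≤)
                 (+-mono-≤ nb (≤-trans (≤-reflexive (LP.length-map ×-swap (pairsFrom nbrs X))) nb)) ⟩
          M + (M * d + M * d) ≡⟨ cong (M +_) (*-distribˡ-+ M d d) ⟨
          M + M * (d + d) ≡⟨ *-suc M (d + d) ⟨
          M * suc (d + d) ∎

-- Fresh vertices, chains and the assembly of double brooms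

choose : ∀ {n} {pool : List (Fin n)} (F : List (Fin n)) (m : ℕ) → Unique pool → m + length F ≤ length pool →
  ∃ λ ys → length ys ≡ m × Unique ys × (∀ {y} → y ∈ ys → y ∈ pool × y ∉ F)
choose {pool = pool} F m u le = take m (pool ∖ F) ,
  length-take≤ m (+-cancelʳ-≤ (length F) m _ (≤-trans le (length-∖ F u))) ,
  UP.take⁺ m (∖-unique F u) , λ i → ∈-∖⁻ {xs = pool} {F = F} (∈-take m i)

choose-fresh : ∀ {n} (F : List (Fin n)) (m : ℕ) → m + length F ≤ n →
  ∃ λ ys → length ys ≡ m × Unique ys × (∀ {y} → y ∈ ys → y ∉ F)
choose-fresh {n} F m le with choose F m (UP.allFin⁺ n) (subst (m + length F ≤_) (sym (LP.length-tabulate id)) le)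
... | ys , l , u , h = ys , l , u , proj₂ ∘ h

Chain : {V : Set} → (V → V → Set) → List V → Set
Chain E xs = ∀ {u v} → (u , v) ∈ lnks xs → E u v

chain-∷ : {V : Set} {E : V → V → Set} {x y : V} {ys : List V} → E x y → Chain E (y ∷ ys) → Chain E (x ∷ y ∷ ys)
chain-∷ e c (here refl) = e
chain-∷ e c (there i) = c i

-- Relating all of `xs` to `y` avoids naming its last vertex; in the applications `y` is joined to
-- the whole list anyway.
chain-++ : {V : Set} {E : V → V → Set} (xs : List V) {y : V} {ys : List V} → Chain E xs → (∀ {x} → x ∈ xs → E x y) →
  Chain E (y ∷ ys) → Chain E (xs ++ y ∷ ys)
chain-++ [] c a d i = d i
chain-++ (x ∷ []) c a d (here refl) = a (here refl)
chain-++ (x ∷ []) c a d (there i) = d i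
chain-++ (x ∷ w ∷ xs) c a d (here refl) = c (here refl)
chain-++ {E = E} (x ∷ w ∷ xs) c a d (there i) = chain-++ {E = E} (w ∷ xs) (c ∘ there) (a ∘ there) d i

chain-take : {V : Set} {E : V → V → Set} (m : ℕ) {xs : List V} → Chain E xs → Chain E (take m xs)
chain-take zero c ()
chain-take (suc m) {[]} c ()
chain-take (suc zero) {x ∷ xs} c ()
chain-take (suc (suc m)) {x ∷ []} c ()
chain-take (suc (suc m)) {x ∷ y ∷ xs} c (here refl) = c (here refl)
chain-take {E = E} (suc (suc m)) {x ∷ y ∷ xs} c (there i) = chain-take {E = E} (suc m) (c ∘ there) i

chain-mono : {V : Set} {E E' : V → V → Set} {xs : List V} → (∀ {u v} → u ∈ xs → E u v → E' u v) → Chain E xs → Chain E' xs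
chain-mono {xs = x ∷ xs} f c i = f (proj₁ (lnk-∈ i)) (c i)

mkBroom : {V : Set} {E : V → V → Set} {t s₁ s₂ : ℕ} {P₀ : List V} {s : V} {L₁ L₂ : List V} →
  length P₀ ≡ t → length L₁ ≡ s₁ → length L₂ ≡ s₂ → Unique (P₀ ++ [ s ]) → Chain E (P₀ ++ [ s ]) → Unique L₁ → Unique L₂ →
  (∀ {x} → x ∈ L₁ → E (headOr s P₀) x) → (∀ {x} → x ∈ L₂ → E s x) →
  (∀ {x} → x ∈ L₁ → x ∉ P₀ ++ [ s ]) → (∀ {x} → x ∈ L₂ → x ∉ P₀ ++ [ s ]) → (∀ {x} → x ∈ L₁ → x ∉ L₂) →
  IsBroom E t s₁ s₂ P₀ s L₁ L₂
mkBroom {E = E} {P₀ = P₀} {s} {L₁} {L₂} lP l₁ l₂ uP ch u₁ u₂ e₁ e₂ d₁ d₂ d₁₂ = isBroom lP l₁ l₂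
    (subst Unique (LP.++-assoc P₀ [ s ] (L₁ ++ L₂)) (unique-++ uP (unique-++ u₁ u₂ d₁₂) λ i k → [ (λ m → d₁ m i) , (λ m → d₂ m i) ]′ (∈-++⁻ L₁ k)))
    edge
  where
  edge : ∀ {u v} → (u , v) ∈ broomLinks P₀ s L₁ L₂ → E u v
  edge i with ∈-++⁻ (lnks (P₀ ++ [ s ])) i
  ... | inj₁ j = ch j
  ... | inj₂ j with ∈-++⁻ (map (headOr s P₀ ,_) L₁) j
  ...   | inj₁ k with ∈-map⁻ (headOr s P₀ ,_) k
  ...     | _ , m , refl = e₁ m
  edge i | inj₂ j | inj₂ k with ∈-map⁻ (s ,_) k
  ...     | _ , m , refl = e₂ m

-- Red double brooms from NIM-paths and common neighbours

parity : ∀ τ → ∃ λ a → τ ≡ a + a ⊎ τ ≡ suc (a + a)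
parity zero = 0 , inj₁ refl
parity (suc τ) with parity τ
... | a , inj₁ refl = a , inj₂ refl
... | a , inj₂ refl = suc a , inj₁ (cong suc (sym (+-suc a a)))

-- A generous bound on the number of vertices to be avoided when one more path is requested: hubs,
-- path vertices and leaves, each counted twice.
supplyBound : ℕ → ℕ → ℕ → ℕ
supplyBound t s₁ κ = κ + κ + (t + t) + (s₁ + s₁)

-- To extend paths by a vertex, the shorter ones must survive the deletion of `F` and of a further
-- set of size B · 2^|Y|, the cost of splitting along Y = F ++ Y₀. At index `i` the size of `F` is
-- at most `levelBound B C i`, and `C` bounds the size of `Y₀`.
levelBound : ℕ → ℕ → ℕ → ℕ
levelBound B C zero = B
levelBound B C (suc i) = B * 2 ^ (levelBound B C i + C) + levelBound B C i

-- s and s′ are joined in red to every vertex outside Y₀, whose NIM-edges are red and number at least s₁ + κ, where t ≤ 2κ.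
-- Interleaving s, s′ and further common neighbours (hubs) with NIM-paths gives a red double broom through a NIM-edge.
-- Its path is built from the end with s₁ leaves towards s; if that end has small degree, its leaves have to be chosen
-- before the rest of the path, since only its hub neighbours on the path are under control.

module Assembly {n : ℕ} (t s₁ s₂ κ : ℕ) (t≤2κ : t ≤ κ + κ) (1≤s₁ : 1 ≤ s₁) (1≤s₂ : 1 ≤ s₂)
  (Red : Fin n → Fin n → Set) (red-sym : ∀ {u v} → Red u v → Red v u)
  (N : Fin n → Fin n → Set) (N-sym : ∀ {u v} → N u v → N v u) (N-irrefl : ∀ {v} → ¬ N v v)
  (nbrs : Fin n → List (Fin n)) (nbrs-unique : ∀ v → Unique (nbrs v)) (∈-nbrs⁻ : ∀ {u v} → v ∈ nbrs u → N u v)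
  (nonN : ∀ {P₀ x L₁ L₂} → IsBroom Red t s₁ s₂ P₀ x L₁ L₂ → ∀ {u v} → (u , v) ∈ broomLinks P₀ x L₁ L₂ → ¬ N u v)
  (s s′ z : Fin n) (s≢s′ : s ≢ s′) (s≢z : s ≢ z) (s′≢z : s′ ≢ z) (sz-red : Red s z) (sz-N : N s z)
  (Y₀ : List (Fin n)) (s∈Y₀ : s ∈ Y₀) (s′∈Y₀ : s′ ∈ Y₀) (z∈Y₀ : z ∈ Y₀)
  (red-s : ∀ {v} → v ∉ Y₀ → Red v s) (red-s′ : ∀ {v} → v ∉ Y₀ → Red v s′)
  (N-red : ∀ {u v} → u ∉ Y₀ → N u v → Red u v)
  (deg : ∀ {v} → v ∉ Y₀ → s₁ + κ ≤ length (nbrs v))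
  (C₀ : ℕ) (Y₀-len : length Y₀ ≤ C₀) (n-large₁ : s₂ + (t + s₁ + C₀) ≤ n)
  where

  private V = Fin n

  -- The leaves at `s` may be any fresh vertices outside `Y₀`. When the rest of the broom is not
  -- known to contain a NIM-edge, `z` is made one of these leaves and `s z` is that edge.
  close : ∀ {P₀ L₁} → length P₀ ≡ t → Unique (P₀ ++ [ s ]) → Chain Red (P₀ ++ [ s ]) → length L₁ ≡ s₁ → Unique L₁ →
    (∀ {x} → x ∈ L₁ → Red (headOr s P₀) x) → (∀ {x} → x ∈ L₁ → x ∉ P₀ ++ [ s ]) →
    (∀ {L₂} → ∃ λ u → ∃ λ v → (u , v) ∈ broomLinks P₀ s L₁ L₂ × N u v) ⊎ (z ∉ P₀ × z ∉ L₁) → ⊥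
  close {P₀} {L₁} lP uP ch lL uL redL dis which = by which
    where
    F = (P₀ ++ L₁) ++ Y₀
    F-len : length F ≤ t + s₁ + C₀
    F-len = begin
        length F ≡⟨ LP.length-++ (P₀ ++ L₁) ⟩
        length (P₀ ++ L₁) + length Y₀ ≡⟨ cong (_+ length Y₀) (trans (LP.length-++ P₀) (cong₂ _+_ lP lL)) ⟩
        t + s₁ + length Y₀ ≤⟨ +-monoʳ-≤ (t + s₁) Y₀-len ⟩
        t + s₁ + C₀ ∎
      where open ≤-Reasoning
    build : ∀ {L₂} → length L₂ ≡ s₂ → Unique L₂ → (∀ {x} → x ∈ L₂ → Red s x) → (∀ {x} → x ∈ L₂ → x ∉ P₀ × x ∉ L₁ × x ≢ s) →
      IsBroom Red t s₁ s₂ P₀ s L₁ L₂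
    build l u rd av = mkBroom lP lL l uP ch uL u redL rd dis
      (λ i k → [ proj₁ (av i) , (λ { (here e) → proj₂ (proj₂ (av i)) e }) ]′ (∈-++⁻ P₀ k)) (λ i k → proj₁ (proj₂ (av k)) i)
    avoid : ∀ {x} → x ∉ F → x ∉ P₀ × x ∉ L₁ × x ≢ s
    avoid x∉ = (λ i → x∉ (∈-++⁺ˡ (∈-++⁺ˡ i))) , (λ i → x∉ (∈-++⁺ˡ (∈-++⁺ʳ P₀ i))) , λ { refl → x∉ (∈-++⁺ʳ (P₀ ++ L₁) s∈Y₀) }
    by : _ → ⊥
    by (inj₁ nl) with choose-fresh F s₂ (≤-trans (+-monoʳ-≤ s₂ F-len) n-large₁)
    ... | L₂ , l , u , fr with nl {L₂}
    ...   | _ , _ , i , ne = nonN (build l u (λ j → red-sym (red-s (fr j ∘ ∈-++⁺ʳ (P₀ ++ L₁)))) (avoid ∘ fr)) i ne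
    by (inj₂ (z∉P , z∉L)) with choose-fresh F (s₂ ∸ 1) (≤-trans (+-mono-≤ (m∸n≤m s₂ 1) F-len) n-large₁)
    ... | L₂ , l , u , fr = nonN (build {z ∷ L₂} (trans (cong suc l) (m+[n∸m]≡n 1≤s₂))
            (unique-∷ (λ i → fr i (∈-++⁺ʳ (P₀ ++ L₁) z∈Y₀)) u)
            (λ { (here refl) → sz-red ; (there j) → red-sym (red-s (fr j ∘ ∈-++⁺ʳ (P₀ ++ L₁))) })
            (λ { (here refl) → z∉P , z∉L , s≢z ∘ sym ; (there j) → avoid (fr j) }))
          (∈-++⁺ʳ (lnks (P₀ ++ [ s ])) (∈-++⁺ʳ (map (headOr s P₀ ,_) L₁) (here refl))) sz-N

  first-leaf : {A : Set} {L : List A} → length L ≡ s₁ → ∃ λ x → x ∈ L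
  first-leaf {L = L} e = nonempty-lookup {m = 0} L (subst (1 ≤_) (sym e) 1≤s₁)

  low-leaves : ∀ {v} → v ∉ Y₀ → (U : List V) → length U ≤ κ →
    ∃ λ L₁ → length L₁ ≡ s₁ × Unique L₁ × (∀ {x} → x ∈ L₁ → x ∈ nbrs v × x ∉ U)
  low-leaves v∉ U le = choose U s₁ (nbrs-unique _) (≤-trans (+-monoʳ-≤ s₁ le) (deg v∉))

  low-end : ∀ {v R L₁} → v ∉ Y₀ → length (v ∷ R) ≡ t → Unique (v ∷ R ++ [ s ]) → Chain Red (v ∷ R ++ [ s ]) →
    length L₁ ≡ s₁ → Unique L₁ → (∀ {x} → x ∈ L₁ → x ∈ nbrs v) → (∀ {x} → x ∈ L₁ → x ∉ v ∷ R ++ [ s ]) → ⊥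
  low-end {v} {R} {L₁} v∉ l u ch lL uL nb dis with first-leaf lL
  ... | x , x∈ = close {v ∷ R} l u ch lL uL (λ i → N-red v∉ (∈-nbrs⁻ (nb i))) dis
    (inj₁ (v , x , ∈-++⁺ʳ (lnks (v ∷ R ++ [ s ])) (∈-++⁺ˡ (∈-map⁺ (v ,_) x∈)) , ∈-nbrs⁻ (nb x∈)))

  -- A nonempty path, listed from the end at which hubs are attached
  Path : Set
  Path = V × List V

  verts : Path → List V
  verts (v , rest) = v ∷ rest

  record Good (j : ℕ) (π : Path) : Set where
    constructor good
    field
      len : length (proj₂ π) ≡ j
      linked : Chain N (verts π)
      uniq : Unique (verts π)
      low : ∀ {x} → x ∈ verts π → x ∉ Y₀

  open Good

  Avoids : List V → List V → Set
  Avoids F xs = ∀ {x} → x ∈ xs → x ∉ F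

  -- Existence is asserted only up to double negation: the splitting in `uniformize` treats
  -- arbitrary predicates, and every use aims at `⊥`.
  Supply : ℕ → (Path → Set) → Set
  Supply B P = ∀ F → length F ≤ B → (∀ π → P π → Avoids F (verts π) → ⊥) → ⊥

  nimred : ∀ {j π} → Good j π → Chain Red (verts π)
  nimred {π = π} g = chain-mono {E = N} {Red} {verts π} (λ i → N-red (low g i)) (linked g)

  module _ {j : ℕ} {π : Path} (g : Good j π) where

    tail-chain : Chain Red (verts π ++ [ s ])
    tail-chain = chain-++ {E = Red} (verts π) (nimred g) (λ i → red-s (low g i)) λ ()

    tail-unique : Unique (verts π ++ [ s ])
    tail-unique = unique-++ (uniq g) ([] ∷ []) λ { i (here refl) → low g i s∈Y₀ }

    tail′-chain : Chain Red (s′ ∷ verts π ++ [ s ])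
    tail′-chain = chain-∷ {E = Red} (red-sym (red-s′ (low g (here refl)))) tail-chain

    tail′-unique : Unique (s′ ∷ verts π ++ [ s ])
    tail′-unique = unique-∷ new tail-unique
      where
      new : s′ ∉ verts π ++ [ s ]
      new i with ∈-++⁻ (verts π) i
      ... | inj₁ k = low g k s′∈Y₀
      ... | inj₂ (here e) = s≢s′ (sym e)

    ∈-tail′ : ∀ {x} → x ∈ s′ ∷ verts π ++ [ s ] → x ≡ s′ ⊎ (x ∈ verts π ⊎ x ≡ s)
    ∈-tail′ (here e) = inj₁ e
    ∈-tail′ (there i) with ∈-++⁻ (verts π) i
    ... | inj₁ k = inj₂ (inj₁ k)
    ... | inj₂ (here e) = inj₂ (inj₂ e)

  Bf : ℕ
  Bf = supplyBound t s₁ κ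

  end-on-last-segment : ∀ {j t₀ v rest} → t ≡ suc t₀ → t₀ ≤ j → suc j ≤ κ → Good j (v , rest) → ⊥
  end-on-last-segment {j} {t₀} {v} {rest} refl t₀≤j j<κ g
    with low-leaves (low g (here refl)) (s ∷ take t₀ rest) (subst (_≤ κ) (cong suc (sym seg-len)) (≤-trans (s≤s t₀≤j) j<κ))
    where
    seg-len : length (take t₀ rest) ≡ t₀
    seg-len = length-take≤ t₀ (subst (t₀ ≤_) (sym (len g)) t₀≤j)
  ... | L₁ , lL , uL , h = low-end (low g (here refl)) (cong suc seg-len)
      (unique-++ (UP.take⁺ (suc t₀) (uniq g)) ([] ∷ []) λ { i (here refl) → low g (∈-take (suc t₀) i) s∈Y₀ })
      (chain-++ {E = Red} (take (suc t₀) (v ∷ rest)) (chain-take {E = Red} (suc t₀) (nimred g)) (λ i → red-s (low g (∈-take (suc t₀) i))) λ ())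
      lL uL (proj₁ ∘ h) dis
    where
    seg-len : length (take t₀ rest) ≡ t₀
    seg-len = length-take≤ t₀ (subst (t₀ ≤_) (sym (len g)) t₀≤j)
    dis : ∀ {x} → x ∈ L₁ → x ∉ v ∷ take t₀ rest ++ [ s ]
    dis i (here refl) = N-irrefl (∈-nbrs⁻ (proj₁ (h i)))
    dis i (there k) with ∈-++⁻ (take t₀ rest) k
    ... | inj₁ m = proj₂ (h i) (there m)
    ... | inj₂ (here refl) = proj₂ (h i) (here refl)

  N-Red : ∀ {w x} → x ∉ Y₀ → N w x → Red w x
  N-Red x∉ e = red-sym (N-red x∉ (N-sym e))

  star : t ≡ 0 → ⊥
  star refl with choose-fresh Y₀ s₁ (≤-trans (≤-trans (+-monoʳ-≤ s₁ Y₀-len) (m≤n+m (s₁ + C₀) s₂)) n-large₁)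
  ... | L₁ , l , u , h = close {[]} refl ([] ∷ []) (λ ()) l u (λ i → red-sym (red-s (h i))) (λ { i (here refl) → h i s∈Y₀ })
          (inj₂ ((λ ()) , λ i → h i z∈Y₀))

  end-at-s′ : ∀ {j π} → t ≡ suc (suc j) → Good j π → ⊥
  end-at-s′ {j} {π} refl g with choose-fresh (verts π ++ Y₀) s₁ (≤-trans bound n-large₁)
    where
    bound : s₁ + length (verts π ++ Y₀) ≤ s₂ + (t + s₁ + C₀)
    bound = begin
        s₁ + length (verts π ++ Y₀) ≡⟨ cong (s₁ +_) (trans (LP.length-++ (verts π)) (cong (λ m → suc m + length Y₀) (len g))) ⟩
        s₁ + (suc j + length Y₀) ≤⟨ +-monoʳ-≤ s₁ (+-mono-≤ (n≤1+n (suc j)) Y₀-len) ⟩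
        s₁ + (t + C₀) ≡⟨ trans (sym (+-assoc s₁ t C₀)) (cong (_+ C₀) (+-comm s₁ t)) ⟩
        t + s₁ + C₀ ≤⟨ m≤n+m _ s₂ ⟩
        s₂ + (t + s₁ + C₀) ∎
      where open ≤-Reasoning
  ... | L₁ , l , u , h = close {s′ ∷ verts π} (cong (suc ∘ suc) (len g)) (tail′-unique g) (tail′-chain g) l u
      (λ i → red-sym (red-s′ (λ k → h i (∈-++⁺ʳ (verts π) k)))) dis (inj₂ (z∉ , λ i → h i (∈-++⁺ʳ (verts π) z∈Y₀)))
    where
    dis : ∀ {x} → x ∈ L₁ → x ∉ s′ ∷ verts π ++ [ s ]
    dis i k with ∈-tail′ g k
    ... | inj₁ refl = h i (∈-++⁺ʳ (verts π) s′∈Y₀)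
    ... | inj₂ (inj₁ m) = h i (∈-++⁺ˡ m)
    ... | inj₂ (inj₂ refl) = h i (∈-++⁺ʳ (verts π) s∈Y₀)
    z∉ : z ∉ s′ ∷ verts π
    z∉ (here e) = s′≢z (sym e)
    z∉ (there i) = low g i z∈Y₀

  module _ {j : ℕ} {P : Path → Set} (P⇒good : ∀ {π} → P π → Good j π) (sup : Supply Bf P) where

    private J = suc j

    -- The path consists of ρ + 1 vertices of one NIM-path, `s′`, a whole second NIM-path and `s`.
    -- The leaves avoid `s`, `s′` and the first segment thanks to the degree bound; the second path
    -- is drawn afterwards and avoids the leaves.
    end-before-s′ : ∀ {ρ} → t ≡ suc J + suc ρ → ρ ≤ j → suc (suc ρ) ≤ κ → ⊥
    end-before-s′ {ρ} t≡ ρ≤j ρ<κ = sup [] z≤n λ { (v , rest) p _ → withHead (P⇒good p) }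
      where
      withHead : ∀ {v rest} → Good j (v , rest) → ⊥
      withHead {v} {rest} g = withLeaves (low-leaves (low g (here refl)) (s ∷ s′ ∷ R)
          (subst (_≤ κ) (cong (suc ∘ suc) (sym R-len)) ρ<κ))
        where
        R = take ρ rest
        R-len : length R ≡ ρ
        R-len = length-take≤ ρ (subst (ρ ≤_) (sym (len g)) ρ≤j)
        withLeaves : (∃ λ L₁ → length L₁ ≡ s₁ × Unique L₁ × (∀ {x} → x ∈ L₁ → x ∈ nbrs v × x ∉ s ∷ s′ ∷ R)) → ⊥
        withLeaves (L₁ , lL , uL , h) = sup (L₁ ++ v ∷ R) F-len λ π p av → finish′ π (P⇒good p) av
          where
          F-len : length (L₁ ++ v ∷ R) ≤ Bf
          F-len = begin
              length (L₁ ++ v ∷ R) ≡⟨ trans (LP.length-++ L₁) (cong₂ (λ a b → a + suc b) lL R-len) ⟩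
              s₁ + suc ρ ≤⟨ +-mono-≤ (m≤m+n s₁ s₁) (≤-trans (≤-trans (m≤n+m (suc ρ) (suc J)) (≤-reflexive (sym t≡))) (≤-trans (m≤m+n t t) (m≤n+m (t + t) (κ + κ)))) ⟩
              (s₁ + s₁) + (κ + κ + (t + t)) ≡⟨ +-comm (s₁ + s₁) _ ⟩
              Bf ∎
            where open ≤-Reasoning
          finish′ : ∀ π → Good j π → Avoids (L₁ ++ v ∷ R) (verts π) → ⊥
          finish′ π g′ av = low-end {v} {R ++ s′ ∷ verts π} (low g (here refl))
              (trans (cong suc (trans (LP.length-++ R) (cong₂ (λ a b → a + suc (suc b)) R-len (len g′)))) (trans (arith ρ j) (sym t≡)))
              (subst (λ l → Unique (v ∷ l)) (sym (LP.++-assoc R (s′ ∷ verts π) [ s ]))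
                (unique-++ (UP.take⁺ (suc ρ) (uniq g)) (tail′-unique g′) dis₁))
              (subst (λ l → Chain Red (v ∷ l)) (sym (LP.++-assoc R (s′ ∷ verts π) [ s ]))
                (chain-++ {E = Red} (v ∷ R) (chain-take {E = Red} (suc ρ) (nimred g)) (λ i → red-s′ (low g (∈-take (suc ρ) i))) (tail′-chain g′)))
              lL uL (proj₁ ∘ h) dis₂
            where
            arith : ∀ ρ j → suc (ρ + suc (suc j)) ≡ suc (suc j) + suc ρ
            arith ρ j = +-comm (suc ρ) (suc (suc j))
            dis₁ : ∀ {x} → x ∈ v ∷ R → x ∉ s′ ∷ verts π ++ [ s ]
            dis₁ i k with ∈-tail′ g′ k
            ... | inj₁ refl = low g (∈-take (suc ρ) i) s′∈Y₀
            ... | inj₂ (inj₁ m) = av m (∈-++⁺ʳ L₁ i)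
            ... | inj₂ (inj₂ refl) = low g (∈-take (suc ρ) i) s∈Y₀
            dis₂ : ∀ {x} → x ∈ L₁ → x ∉ v ∷ (R ++ s′ ∷ verts π) ++ [ s ]
            dis₂ {x} i k with ∈-++⁻ (v ∷ R) (subst (λ l → x ∈ v ∷ l) (LP.++-assoc R (s′ ∷ verts π) [ s ]) k)
            ... | inj₁ (here refl) = N-irrefl (∈-nbrs⁻ (proj₁ (h i)))
            ... | inj₁ (there m) = proj₂ (h i) (there (there m))
            ... | inj₂ m with ∈-tail′ g′ m
            ...   | inj₁ refl = proj₂ (h i) (there (here refl))
            ...   | inj₂ (inj₁ o) = av o (∈-++⁺ˡ i)
            ...   | inj₂ (inj₂ refl) = proj₂ (h i) (here refl)

    module _ {ws : List V} (hub : ∀ {π w} → P π → w ∈ ws → N w (proj₁ π)) (s∉ws : s ∉ ws) (s′∉ws : s′ ∉ ws)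
      (ws≤κ : length ws ≤ κ) where

      -- h ∷ R ++ [ s ] alternates between path heads and the hubs in us, and then runs through two paths, s′ and s.
      record Built (us F : List V) : Set where
        constructor built
        field
          h : V
          R : List V
          ch : Chain Red (h ∷ R ++ [ s ])
          un : Unique (h ∷ R ++ [ s ])
          ln : length (h ∷ R) ≡ suc (J + J) + (length us + length us)
          hd : ∀ {w} → w ∈ ws → N w h
          h∉ : h ∉ Y₀
          from : ∀ {x} → x ∈ h ∷ R → x ≡ s′ ⊎ (x ∈ us ⊎ (x ∉ F × x ∉ Y₀))

      -- Each hub is prepended together with the head of a new path, the rest of which is discarded.
      -- The hubs belong to `F`, so the paths requested avoid them.
      build : ∀ us F → (∀ {u} → u ∈ us → u ∈ ws × u ∈ F) → Unique us → length F + (suc (J + J) + (length us + length us)) ≤ Bf →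
        (Built us F → ⊥) → ⊥
      build [] F sub uu le k = sup F (≤-trans (m≤m+n _ _) le) λ { (v , rest) p av → sup (v ∷ rest ++ F) (bound p) λ π p′ av′ →
          k (make (P⇒good p) (λ i → hub p i) av (P⇒good p′) av′) }
        where
        bound : ∀ {v rest} → P (v , rest) → length (v ∷ rest ++ F) ≤ Bf
        bound {v} {rest} p = ≤-trans (≤-reflexive (trans (LP.length-++ (v ∷ rest)) (trans (cong (λ m → suc m + length F) (len (P⇒good p))) (+-comm J (length F)))))
          (≤-trans (+-monoʳ-≤ (length F) (≤-trans (≤-trans (m≤m+n J J) (n≤1+n _)) (m≤m+n _ 0))) le)
        make : ∀ {v rest π} → Good j (v , rest) → (∀ {w} → w ∈ ws → N w v) → Avoids F (v ∷ rest) → Good j π →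
          Avoids (v ∷ rest ++ F) (verts π) → Built [] F
        make {v} {rest} {π} g hb av g′ av′ = built v (rest ++ s′ ∷ verts π)
            (subst (λ l → Chain Red (v ∷ l)) (sym (LP.++-assoc rest (s′ ∷ verts π) [ s ]))
              (chain-++ {E = Red} (v ∷ rest) (nimred g) (λ i → red-s′ (low g i)) (tail′-chain g′)))
            (subst (λ l → Unique (v ∷ l)) (sym (LP.++-assoc rest (s′ ∷ verts π) [ s ]))
              (unique-++ (uniq g) (tail′-unique g′) dis))
            (trans (cong suc (trans (LP.length-++ rest) (cong₂ (λ a b → a + suc (suc b)) (len g) (len g′)))) (arith j))
            hb (low g (here refl)) fr
          where
          arith : ∀ j → suc (j + suc (suc j)) ≡ suc (suc j + suc j) + 0
          arith j = trans (cong suc (+-suc j (suc j))) (sym (+-identityʳ _))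
          dis : ∀ {x} → x ∈ v ∷ rest → x ∉ s′ ∷ verts π ++ [ s ]
          dis i m with ∈-tail′ g′ m
          ... | inj₁ refl = low g i s′∈Y₀
          ... | inj₂ (inj₁ o) = av′ o (∈-++⁺ˡ i)
          ... | inj₂ (inj₂ refl) = low g i s∈Y₀
          fr : ∀ {x} → x ∈ v ∷ rest ++ s′ ∷ verts π → x ≡ s′ ⊎ (x ∈ [] ⊎ (x ∉ F × x ∉ Y₀))
          fr i with ∈-++⁻ (v ∷ rest) i
          ... | inj₁ m = inj₂ (inj₂ (av m , low g m))
          ... | inj₂ (here e) = inj₁ e
          ... | inj₂ (there m) = inj₂ (inj₂ ((λ f → av′ m (∈-++⁺ʳ (v ∷ rest) f)) , low g′ m))
      build (w ∷ us) F sub (pw ∷ uu) le k = build us F (sub ∘ there) uu le₁ λ { b@(built h R ch un ln hd h∉ fr) →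
          sup (h ∷ R ++ F) (bound {h} {R} ln) λ { (v , rest) p av → k (make b v (P⇒good p) (hub p) (av (here refl))) } }
        where
        a = length us
        le₁ : length F + (suc (J + J) + (a + a)) ≤ Bf
        le₁ = ≤-trans (+-monoʳ-≤ (length F) (+-monoʳ-≤ (suc (J + J)) (+-mono-≤ (n≤1+n a) (n≤1+n a)))) le
        bound : ∀ {h R} → length (h ∷ R) ≡ suc (J + J) + (a + a) → length (h ∷ R ++ F) ≤ Bf
        bound {h} {R} ln = ≤-trans (≤-reflexive (trans (LP.length-++ (h ∷ R)) (trans (cong (_+ length F) ln) (+-comm _ (length F))))) le₁
        make : (b : Built us F) → let open Built b in ∀ v {rest} → Good j (v , rest) → (∀ {w} → w ∈ ws → N w v) → v ∉ h ∷ R ++ F → Built (w ∷ us) F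
        make (built h R ch un ln hd h∉ fr) v g hb v∉ = built v (w ∷ h ∷ R)
            (chain-∷ {E = Red} (N-red v∉Y (N-sym (hb w∈))) (chain-∷ {E = Red} (N-Red h∉ (hd w∈)) ch))
            (unique-∷ v-new (unique-∷ w-new un)) (trans (cong (suc ∘ suc) ln) (arith J a)) hb v∉Y from′
          where
          w∈ = proj₁ (sub (here refl))
          w∈F = proj₂ (sub (here refl))
          v∉Y : v ∉ Y₀
          v∉Y = low g (here refl)
          arith : ∀ J a → suc (suc (suc (J + J) + (a + a))) ≡ suc (J + J) + (suc a + suc a)
          arith J a = sym (trans (cong (suc (J + J) +_) (cong suc (+-suc a a))) (trans (+-suc (suc (J + J)) (suc (a + a))) (cong suc (+-suc (suc (J + J)) (a + a)))))
          w-new : w ∉ h ∷ R ++ [ s ]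
          w-new i with ∈-++⁻ (h ∷ R) i
          ... | inj₂ (here refl) = s∉ws w∈
          ... | inj₁ m with fr m
          ...   | inj₁ refl = s′∉ws w∈
          ...   | inj₂ (inj₁ o) = All.lookup pw o refl
          ...   | inj₂ (inj₂ (nf , _)) = nf w∈F
          v-new : v ∉ w ∷ h ∷ R ++ [ s ]
          v-new (here refl) = v∉ (∈-++⁺ʳ (h ∷ R) w∈F)
          v-new (there i) with ∈-++⁻ (h ∷ R) i
          ... | inj₁ m = v∉ (∈-++⁺ˡ m)
          ... | inj₂ (here refl) = v∉Y s∈Y₀
          from′ : ∀ {x} → x ∈ v ∷ w ∷ h ∷ R → x ≡ s′ ⊎ (x ∈ w ∷ us ⊎ (x ∉ F × x ∉ Y₀))
          from′ (here refl) = inj₂ (inj₂ ((λ f → v∉ (∈-++⁺ʳ (h ∷ R) f)) , v∉Y))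
          from′ (there (here refl)) = inj₂ (inj₁ (here refl))
          from′ (there (there m)) with fr m
          ... | inj₁ e = inj₁ e
          ... | inj₂ (inj₁ o) = inj₂ (inj₁ (there o))
          ... | inj₂ (inj₂ o) = inj₂ (inj₂ o)

      heads : ∀ m F → m + length F ≤ Bf →
        (∀ L → length L ≡ m → Unique L → (∀ {x} → x ∈ L → x ∉ F × x ∉ Y₀ × (∀ {w} → w ∈ ws → N w x)) → ⊥) → ⊥
      heads zero F le k = k [] refl [] λ ()
      heads (suc m) F le k = heads m F (≤-trans (n≤1+n _) le) λ L l u h →
        sup (L ++ F) (≤-trans (≤-reflexive (trans (LP.length-++ L) (cong (_+ length F) l))) (≤-trans (n≤1+n _) le)) λ { (v , rest) p av →
          k (v ∷ L) (cong suc l) (unique-∷ (λ i → av (here refl) (∈-++⁺ˡ i)) u)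
            λ { (here refl) → (λ f → av (here refl) (∈-++⁺ʳ L f)) , low (P⇒good p) (here refl) , hub p ; (there i) → h i } }

      -- The leaves at the final hub are heads of further paths; they are NIM-neighbours of the hub,
      -- so the broom contains a NIM-edge.
      end-at-hub : ∀ {w us} → Unique (w ∷ us) → (∀ {u} → u ∈ w ∷ us → u ∈ ws) → t ≡ suc (suc (J + J) + (length us + length us)) → ⊥
      end-at-hub {w} {us} (pw ∷ uu) sub t≡ = build us ws (λ i → sub (there i) , sub (there i)) uu bound λ { (built h R ch un ln hd h∉ fr) →
          heads s₁ (ws ++ h ∷ R) (bound₂ ln) λ L l u hl → fin h R ch un ln hd h∉ fr L l u hl }
        where
        t′≤t : suc (J + J) + (length us + length us) ≤ t
        t′≤t = subst (suc (J + J) + (length us + length us) ≤_) (sym t≡) (n≤1+n _)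
        bound : length ws + (suc (J + J) + (length us + length us)) ≤ Bf
        bound = ≤-trans (+-mono-≤ (≤-trans ws≤κ (m≤m+n κ κ)) (≤-trans t′≤t (m≤m+n t t))) (m≤m+n _ (s₁ + s₁))
        bound₂ : ∀ {h R} → length (h ∷ R) ≡ suc (J + J) + (length us + length us) → s₁ + length (ws ++ h ∷ R) ≤ Bf
        bound₂ {h} {R} ln = ≤-trans (≤-reflexive (trans (cong (s₁ +_) (trans (LP.length-++ ws) (cong (length ws +_) ln))) (+-comm s₁ _)))
          (+-mono-≤ (+-mono-≤ (≤-trans ws≤κ (m≤m+n κ κ)) (≤-trans t′≤t (m≤m+n t t))) (m≤m+n s₁ s₁))
        w∈ = sub (here refl)
        fin : ∀ h R → Chain Red (h ∷ R ++ [ s ]) → Unique (h ∷ R ++ [ s ]) → length (h ∷ R) ≡ suc (J + J) + (length us + length us) →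
          (∀ {w} → w ∈ ws → N w h) → h ∉ Y₀ → (∀ {x} → x ∈ h ∷ R → x ≡ s′ ⊎ (x ∈ us ⊎ (x ∉ ws × x ∉ Y₀))) →
          ∀ L → length L ≡ s₁ → Unique L → (∀ {x} → x ∈ L → x ∉ ws ++ h ∷ R × x ∉ Y₀ × (∀ {w} → w ∈ ws → N w x)) → ⊥
        fin h R ch un ln hd h∉ fr L l u hl with first-leaf l
        ... | x , x∈ = close {w ∷ h ∷ R} (trans (cong suc ln) (sym t≡)) (unique-∷ w-new un)
            (chain-∷ {E = Red} (N-Red h∉ (hd w∈)) ch) l u
            (λ i → N-Red (proj₁ (proj₂ (hl i))) (proj₂ (proj₂ (hl i)) w∈)) dis
            (inj₁ (w , x , ∈-++⁺ʳ (lnks (w ∷ h ∷ R ++ [ s ])) (∈-++⁺ˡ (∈-map⁺ (w ,_) x∈)) , proj₂ (proj₂ (hl x∈)) w∈))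
          where
          w-new : w ∉ h ∷ R ++ [ s ]
          w-new i with ∈-++⁻ (h ∷ R) i
          ... | inj₂ (here refl) = s∉ws w∈
          ... | inj₁ m with fr m
          ...   | inj₁ refl = s′∉ws w∈
          ...   | inj₂ (inj₁ o) = All.lookup pw o refl
          ...   | inj₂ (inj₂ (nf , _)) = nf w∈
          dis : ∀ {x} → x ∈ L → x ∉ w ∷ h ∷ R ++ [ s ]
          dis i (here refl) = proj₁ (hl i) (∈-++⁺ˡ w∈)
          dis i (there k) with ∈-++⁻ (h ∷ R) k
          ... | inj₁ m = proj₁ (hl i) (∈-++⁺ʳ ws m)
          ... | inj₂ (here refl) = proj₁ (proj₂ (hl i)) s∈Y₀

      -- The leaves at the final head avoid `s`, `s′` and the hubs in use through the degree bound,
      -- and every path drawn after them avoids them.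
      end-before-hub : ∀ {w us} → Unique (w ∷ us) → (∀ {u} → u ∈ w ∷ us → u ∈ ws) → t ≡ suc (suc (suc (J + J) + (length us + length us))) →
        suc (suc (suc (length us))) ≤ κ → ⊥
      end-before-hub {w} {us} (pw ∷ uu) sub t≡ us≤ = sup ws (≤-trans ws≤κ (≤-trans (≤-trans (m≤m+n κ κ) (m≤m+n _ (t + t))) (m≤m+n _ _)))
          λ { (v , rest) p av → withHead (low (P⇒good p) (here refl)) (hub p) (av (here refl)) }
        where
        w∈ = sub (here refl)
        t′ = suc (J + J) + (length us + length us)
        withHead : ∀ {v} → v ∉ Y₀ → (∀ {w} → w ∈ ws → N w v) → v ∉ ws → ⊥
        withHead {v} v∉ hb v∉ws with low-leaves v∉ (s ∷ s′ ∷ w ∷ us) us≤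
        ... | L₁ , lL , uL , hl = build us (ws ++ v ∷ L₁) (λ i → sub (there i) , ∈-++⁺ˡ (sub (there i))) uu bound λ { (built h R ch un ln hd h∉ fr) →
              fin h R ch un ln hd h∉ fr }
          where
          bound : length (ws ++ v ∷ L₁) + t′ ≤ Bf
          bound = begin
              length (ws ++ v ∷ L₁) + t′ ≡⟨ cong (_+ t′) (trans (LP.length-++ ws) (cong (λ m → length ws + suc m) lL)) ⟩
              length ws + suc s₁ + t′ ≡⟨ trans (+-assoc (length ws) (suc s₁) t′) (cong (length ws +_) (trans (sym (+-suc s₁ t′)) (+-comm s₁ (suc t′)))) ⟩
              length ws + (suc t′ + s₁) ≡⟨ +-assoc (length ws) (suc t′) s₁ ⟨
              length ws + suc t′ + s₁ ≤⟨ +-mono-≤ (+-mono-≤ (≤-trans ws≤κ (m≤m+n κ κ)) (≤-trans (subst (suc t′ ≤_) (sym t≡) (n≤1+n _)) (m≤m+n t t))) (m≤m+n s₁ s₁) ⟩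
              Bf ∎
            where open ≤-Reasoning
          fin : ∀ h R → Chain Red (h ∷ R ++ [ s ]) → Unique (h ∷ R ++ [ s ]) → length (h ∷ R) ≡ t′ →
            (∀ {w} → w ∈ ws → N w h) → h ∉ Y₀ → (∀ {x} → x ∈ h ∷ R → x ≡ s′ ⊎ (x ∈ us ⊎ (x ∉ ws ++ v ∷ L₁ × x ∉ Y₀))) → ⊥
          fin h R ch un ln hd h∉ fr = low-end {v} {w ∷ h ∷ R} v∉ (trans (cong (suc ∘ suc) ln) (sym t≡))
              (unique-∷ v-new (unique-∷ w-new un))
              (chain-∷ {E = Red} (N-red v∉ (N-sym (hb w∈))) (chain-∷ {E = Red} (N-Red h∉ (hd w∈)) ch))
              lL uL (proj₁ ∘ hl) dis
            where
            w-new : w ∉ h ∷ R ++ [ s ]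
            w-new i with ∈-++⁻ (h ∷ R) i
            ... | inj₂ (here refl) = s∉ws w∈
            ... | inj₁ m with fr m
            ...   | inj₁ refl = s′∉ws w∈
            ...   | inj₂ (inj₁ o) = All.lookup pw o refl
            ...   | inj₂ (inj₂ (nf , _)) = nf (∈-++⁺ˡ w∈)
            v-new : v ∉ w ∷ h ∷ R ++ [ s ]
            v-new (here refl) = v∉ws w∈
            v-new (there i) with ∈-++⁻ (h ∷ R) i
            ... | inj₂ (here refl) = v∉ s∈Y₀
            ... | inj₁ m with fr m
            ...   | inj₁ refl = v∉ s′∈Y₀
            ...   | inj₂ (inj₁ o) = v∉ws (sub (there o))
            ...   | inj₂ (inj₂ (nf , _)) = nf (∈-++⁺ʳ ws (here refl))
            dis : ∀ {x} → x ∈ L₁ → x ∉ v ∷ w ∷ h ∷ R ++ [ s ]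
            dis i (here refl) = N-irrefl (∈-nbrs⁻ (proj₁ (hl i)))
            dis i (there (here refl)) = proj₂ (hl i) (there (there (here refl)))
            dis i (there (there k)) with ∈-++⁻ (h ∷ R) k
            ... | inj₂ (here refl) = proj₂ (hl i) (here refl)
            ... | inj₁ m with fr m
            ...   | inj₁ refl = proj₂ (hl i) (there (here refl))
            ...   | inj₂ (inj₁ o) = proj₂ (hl i) (there (there (there o)))
            ...   | inj₂ (inj₂ (nf , _)) = nf (∈-++⁺ʳ ws (there i))

  prefix : {A : Set} (a : ℕ) (ws : List A) → suc a ≤ length ws → ∃ λ w → ∃ λ us → ∃ λ rest → ws ≡ (w ∷ us) ++ rest × length us ≡ a
  prefix a (w ∷ ws) (s≤s le) = w , take a ws , drop a ws , cong (w ∷_) (sym (LP.take++drop≡id a ws)) , length-take≤ a le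

  -- With J = j + 1 the cases are t = 0, t ≤ J, t = J + 1, t ≤ 2J + 1 and, beyond that, the two
  -- parities of t. In the last two, t ≤ 2κ and J + |ws| = κ guarantee enough hubs.
  finish : ∀ {j P} → (∀ {π} → P π → Good j π) → Supply Bf P → ∀ {ws} → (∀ {π w} → P π → w ∈ ws → N w (proj₁ π)) →
    s ∉ ws → s′ ∉ ws → Unique ws → suc j + length ws ≡ κ → ⊥
  finish {j} {P} P⇒good sup {ws} hub s∉ s′∉ uw J+ws with t Data.Nat.≟ 0
  ... | yes t0 = star t0
  ... | no t≢0 with t Data.Nat.≤? suc j
  ... | yes t≤J = sup [] z≤n λ { (v , rest) p _ → end-on-last-segment {t₀ = t ∸ 1} (sym (m+[n∸m]≡n (n≢0⇒n>0 t≢0))) (∸-monoˡ-≤ 1 t≤J)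
          (subst (suc j ≤_) J+ws (m≤m+n (suc j) _)) (P⇒good p) }
  ... | no t≰J = split (t ∸ suc (suc j)) (sym (m+[n∸m]≡n (≰⇒> t≰J)))
    where
    l = length ws
    ws≤κ : l ≤ κ
    ws≤κ = subst (l ≤_) J+ws (m≤n+m l (suc j))
    t≤ : ∀ {x} → t ≡ (suc j + suc j) + x → x ≤ l + l
    t≤ {x} e = +-cancelˡ-≤ (suc j + suc j) x (l + l) (begin
        (suc j + suc j) + x ≡⟨ e ⟨
        t ≤⟨ t≤2κ ⟩
        κ + κ ≡⟨ cong₂ _+_ J+ws J+ws ⟨
        (suc j + l) + (suc j + l) ≡⟨ solve 2 (λ J l → (J :+ l) :+ (J :+ l) := (J :+ J) :+ (l :+ l)) refl (suc j) l ⟩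
        (suc j + suc j) + (l + l) ∎)
      where
      open ≤-Reasoning
      open import Data.Nat.Solver using (module +-*-Solver)
      open +-*-Solver
    split : ∀ ρ → t ≡ suc (suc j) + ρ → ⊥
    split zero e = sup [] z≤n λ π p _ → end-at-s′ {π = π} (trans e (+-identityʳ _)) (P⇒good p)
    split (suc ρ) e with ≤-<-connex ρ j
    -- Otherwise κ ≤ ρ + 1 and κ ≤ J, whence 2κ ≤ ρ + 1 + J < t.
    ... | inj₁ ρ≤j = end-before-s′ P⇒good sup e ρ≤j (≰⇒> λ κ≤ → <⇒≱ {κ + κ}
            (≤-trans (s≤s (+-mono-≤ (≤-trans κ≤ (s≤s ρ≤j)) κ≤)) (≤-reflexive (sym e))) t≤2κ)
    ... | inj₂ j<ρ with parity (ρ ∸ suc j)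
    ...   | a , inj₁ τ≡ with prefix a ws (double-cancel-≤ (t≤ (trans e eq)))
      where
      eq : suc (suc j) + suc ρ ≡ (suc j + suc j) + (suc a + suc a)
      eq = trans (cong (λ r → suc (suc j) + suc r) (trans (sym (m+[n∸m]≡n j<ρ)) (cong (suc j +_) τ≡)))
        (solve 2 (λ J a → con 1 :+ J :+ (con 1 :+ (J :+ (a :+ a))) := (J :+ J) :+ ((con 1 :+ a) :+ (con 1 :+ a))) refl (suc j) a)
        where
        open import Data.Nat.Solver using (module +-*-Solver)
        open +-*-Solver
    ...     | w , us , rest , refl , refl = end-at-hub P⇒good sup {ws} hub s∉ s′∉ ws≤κ {w} {us} (unique-++ˡ (w ∷ us) uw) ∈-++⁺ˡ
              (trans e (trans (cong (λ r → suc (suc j) + suc r) (trans (sym (m+[n∸m]≡n j<ρ)) (cong (suc j +_) τ≡)))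
                (solve 2 (λ J a → con 1 :+ J :+ (con 1 :+ (J :+ (a :+ a))) := con 1 :+ ((con 1 :+ (J :+ J)) :+ (a :+ a))) refl (suc j) (length us))))
      where
      open import Data.Nat.Solver using (module +-*-Solver)
      open +-*-Solver
    split (suc ρ) e | inj₂ j<ρ | a , inj₂ τ≡ = withPrefix (prefix a ws (<⇒≤ sa<l))
      where
      open import Data.Nat.Solver using (module +-*-Solver)
      open +-*-Solver
      ρ≡ : suc (suc j) + suc ρ ≡ suc (suc j) + suc (suc j + suc (a + a))
      ρ≡ = cong (λ r → suc (suc j) + suc r) (trans (sym (m+[n∸m]≡n j<ρ)) (cong (suc j +_) τ≡))
      eq : suc (suc j) + suc ρ ≡ (suc j + suc j) + suc (suc a + suc a)
      eq = trans ρ≡ (solve 2 (λ J a → con 1 :+ J :+ (con 1 :+ (J :+ (con 1 :+ (a :+ a)))) := (J :+ J) :+ (con 1 :+ ((con 1 :+ a) :+ (con 1 :+ a)))) refl (suc j) a)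
      sa<l : suc a < l
      sa<l = ≰⇒> λ l≤ → <⇒≱ (t≤ (trans e eq)) (+-mono-≤ l≤ l≤)
      withPrefix : (∃ λ w → ∃ λ us → ∃ λ rest → ws ≡ (w ∷ us) ++ rest × length us ≡ a) → ⊥
      withPrefix (w , us , rest , ws≡ , refl) = end-before-hub P⇒good sup {ws} hub s∉ s′∉ ws≤κ {w} {us}
        (unique-++ˡ (w ∷ us) (subst Unique ws≡ uw)) (λ {u} i → subst (u ∈_) (sym ws≡) (∈-++⁺ˡ i))
        (trans e (trans ρ≡ (solve 2 (λ J a → con 1 :+ J :+ (con 1 :+ (J :+ (con 1 :+ (a :+ a)))) := con 2 :+ ((con 1 :+ (J :+ J)) :+ (a :+ a))) refl (suc j) (length us))))
        (≤-trans (s≤s sa<l) (≤-trans (m≤n+m (suc l) j) (≤-reflexive (trans (+-suc j l) J+ws))))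

  supply-mono : ∀ {B B' P} → B ≤ B' → Supply B' P → Supply B P
  supply-mono le sup F h = sup F (≤-trans h le)

  -- Either P ∧ R or P ∧ ¬ R keeps half of the supply; doing this for every y ∈ Y makes the heads agree on all of Y.
  uniformize : ∀ Y {P B} → Supply (B * 2 ^ length Y) P →
    (∀ P′ → (∀ {π} → P′ π → P π) →
      (∀ {y} → y ∈ Y → (∀ {π} → P′ π → N y (proj₁ π)) ⊎ (∀ {π} → P′ π → ¬ N y (proj₁ π))) → Supply B P′ → ⊥) → ⊥
  uniformize [] {P} {B} sup k = k P id (λ ()) (supply-mono {P = P} (≤-reflexive (sym (*-identityʳ B))) sup)
  uniformize (y ∷ Y) {P} {B} sup k = uniformize Y {λ π → P π × N y (proj₁ π)} {B}
      (λ F lF none → uniformize Y {λ π → P π × ¬ N y (proj₁ π)} {B}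
        (λ F′ lF′ none′ → sup (F ++ F′) (bound F F′ lF lF′) λ π p av →
          none′ π (p , λ nr → none π (p , nr) (λ i f → av i (∈-++⁺ˡ f))) (λ i f → av i (∈-++⁺ʳ F f)))
        (λ P′ sub un → k P′ (proj₁ ∘ sub) λ { (here refl) → inj₂ (proj₂ ∘ sub) ; (there i) → un i }))
      (λ P′ sub un → k P′ (proj₁ ∘ sub) λ { (here refl) → inj₁ (proj₂ ∘ sub) ; (there i) → un i })
    where
    bound : ∀ (F F′ : List V) → length F ≤ B * 2 ^ length Y → length F′ ≤ B * 2 ^ length Y → length (F ++ F′) ≤ B * 2 ^ suc (length Y)
    bound F F′ h h′ = ≤-trans (≤-reflexive (LP.length-++ F)) (≤-trans (+-mono-≤ h h′)
      (≤-reflexive (trans (sym (*-distribˡ-+ B (2 ^ length Y) (2 ^ length Y))) (cong (λ x → B * (2 ^ length Y + x)) (sym (+-identityʳ _))))))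

  Bd : ℕ → ℕ
  Bd = levelBound Bf C₀

  -- Induction on the length of the paths. If `F` blocked all longer paths, the NIM-neighbours of
  -- the head of each shorter path avoiding `F` would lie on that path or in F ++ Y₀. After
  -- `uniformize`, many heads share `suc i` of them apart from `s` and `s′`, which is exactly the
  -- number of hubs that `finish` asks for.
  level : suc (Bd κ + C₀) ≤ n → ∀ j i → suc j + i ≡ κ → Supply (Bd i) (Good j)
  level big zero i e F lF none with choose-fresh (F ++ Y₀) 1 (≤-trans (s≤s bound) big)
    where
    bound : length (F ++ Y₀) ≤ Bd κ + C₀
    bound = ≤-trans (≤-reflexive (LP.length-++ F)) (+-mono-≤ (≤-trans lF (subst (λ k → Bd i ≤ Bd k) e (m≤n+m (Bd i) _))) Y₀-len)
  ... | v ∷ [] , _ , _ , h = none (v , []) (good refl (λ ()) ([] ∷ []) λ { (here refl) i → h (here refl) (∈-++⁺ʳ F i) })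
        λ { (here refl) i → h (here refl) (∈-++⁺ˡ i) }
  level big (suc j) i e F lF none = uniformize Y {P₁} {Bf} sup₁ λ P′ sub un sup′ →
      sup′ [] z≤n λ { (v , rest) p _ → hubs P′ sub un sup′ (sub p) p }
    where
    Y = F ++ Y₀
    P₁ : Path → Set
    P₁ π = Good j π × Avoids F (verts π)
    sup₁ : Supply (Bf * 2 ^ length Y) P₁
    sup₁ F′ lF′ no₁ = level big j (suc i) (trans (cong suc (+-suc j i)) e) (F′ ++ F)
        (≤-trans (≤-reflexive (LP.length-++ F′)) (+-mono-≤ (≤-trans lF′ (*-monoʳ-≤ Bf (^-monoʳ-≤ 2 Y-len))) lF))
        λ π g av → no₁ π (g , λ k f → av k (∈-++⁺ʳ F′ f)) (λ k f → av k (∈-++⁺ˡ f))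
      where
      Y-len : length Y ≤ Bd i + C₀
      Y-len = ≤-trans (≤-reflexive (LP.length-++ F)) (+-mono-≤ lF Y₀-len)
    hubs : ∀ P′ → (∀ {π} → P′ π → P₁ π) → (∀ {y} → y ∈ Y → (∀ {π} → P′ π → N y (proj₁ π)) ⊎ (∀ {π} → P′ π → ¬ N y (proj₁ π))) →
      Supply Bf P′ → ∀ {v rest} → P₁ (v , rest) → P′ (v , rest) → ⊥
    hubs P′ sub un sup′ {v} {rest} (g , av) p = finish (proj₁ ∘ sub) sup′ {ws} hub
        (λ k → proj₁ (proj₂ (ws-∈ k)) refl) (λ k → proj₂ (proj₂ (ws-∈ k)) refl) (UP.take⁺ (suc i) (UP.filter⁺ hub? (nbrs-unique v)))
        (trans (cong (suc j +_) (length-take≤ (suc i) {filter hub? (nbrs v)} enough)) (trans (cong suc (+-suc j i)) e))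
      where
      hub? : ∀ x → Dec (x ∈ Y × x ≢ s × x ≢ s′)
      hub? x = ∈-DecFin x Y ×-dec (¬? (x FP.≟ s) ×-dec ¬? (x FP.≟ s′))
      ws = take (suc i) (filter hub? (nbrs v))
      ws-∈ : ∀ {w} → w ∈ ws → w ∈ Y × w ≢ s × w ≢ s′
      ws-∈ k = proj₂ (∈-filter⁻ hub? {xs = nbrs v} (∈-take (suc i) k))
      hub : ∀ {π w} → P′ π → w ∈ ws → N w (proj₁ π)
      hub {π} p′ k with un (proj₁ (ws-∈ k))
      ... | inj₁ yes′ = yes′ p′
      ... | inj₂ no′ = contradiction (N-sym (∈-nbrs⁻ (proj₁ (∈-filter⁻ hub? (∈-take (suc i) k))))) (no′ p)
      cover : ∀ {x} → x ∈ nbrs v → (x ∈ Y × x ≢ s × x ≢ s′) ⊎ x ∈ s ∷ s′ ∷ rest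
      cover {x} x∈ with x FP.≟ s | x FP.≟ s′ | ∈-DecFin x Y | ∈-DecFin x rest
      ... | yes refl | _ | _ | _ = inj₂ (here refl)
      ... | no _ | yes refl | _ | _ = inj₂ (there (here refl))
      ... | no a | no b | yes y | _ = inj₁ (y , a , b)
      ... | no a | no b | no y | yes r = inj₂ (there (there r))
      -- Otherwise `x` would extend the path to a longer one avoiding `F`.
      ... | no a | no b | no y | no r = ⊥-elim (none (x , v ∷ rest) longer λ { (here refl) f → y (∈-++⁺ˡ f) ; (there k) f → av k f })
        where
        longer : Good (suc j) (x , v ∷ rest)
        longer = good (cong suc (len g)) (chain-∷ {E = N} (N-sym (∈-nbrs⁻ x∈)) (linked g))
          (unique-∷ (λ { (here refl) → N-irrefl (∈-nbrs⁻ x∈) ; (there k) → r k }) (uniq g))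
          λ { (here refl) f → y (∈-++⁺ʳ F f) ; (there k) → low g k }
      -- Of at least κ + 1 neighbours, at most j + 2 are discarded: `s`, `s′` and the `j` other
      -- vertices of the path.
      enough : suc i ≤ length (filter hub? (nbrs v))
      enough = +-cancelʳ-≤ (suc (suc j)) (suc i) _ (begin
          suc i + suc (suc j) ≡⟨ cong suc (trans (+-comm i (suc (suc j))) e) ⟩
          suc κ ≤⟨ +-monoˡ-≤ κ 1≤s₁ ⟩
          s₁ + κ ≤⟨ deg (low g (here refl)) ⟩
          length (nbrs v) ≤⟨ length-filter-cover hub? (nbrs-unique v) cover ⟩
          length (filter hub? (nbrs v)) + suc (suc (length rest)) ≡⟨ cong (λ m → length (filter hub? (nbrs v)) + suc (suc m)) (len g) ⟩
          length (filter hub? (nbrs v)) + suc (suc j) ∎)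
        where open ≤-Reasoning

  -- Once the paths have κ vertices, two of them suffice and no hubs are required.
  impossible : suc (Bd κ + C₀) ≤ n → ⊥
  impossible big = by κ refl
    where
    by : ∀ k → k ≡ κ → ⊥
    by zero e = star (n≤0⇒n≡0 (subst (λ k → t ≤ k + k) (sym e) t≤2κ))
    by (suc j) e = finish {j} id (level big j 0 (trans (+-identityʳ (suc j)) e)) {[]} (λ _ ()) (λ ()) (λ ()) [] (trans (+-identityʳ (suc j)) e)

-- Double brooms with 1 ≤ s₁ < s₂

∈-chain⁺ : ∀ s l {i} → s ≤ i → i < s + l → (i , suc i) ∈ chain s l
∈-chain⁺ s zero {i} le lt = contradiction le (<⇒≱ (subst (i <_) (+-identityʳ s) lt))
∈-chain⁺ s (suc l) {i} le lt with m≤n⇒m<n∨m≡n le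
... | inj₂ refl = here refl
... | inj₁ s<i = there (∈-chain⁺ (suc s) l s<i (subst (i <_) (+-suc s l) lt))

∈-leaves⁺ : ∀ c a m {j} → a ≤ j → j < a + m → (c , j) ∈ leaves c a m
∈-leaves⁺ c a zero {j} le lt = contradiction le (<⇒≱ (subst (j <_) (+-identityʳ a) lt))
∈-leaves⁺ c a (suc m) {j} le lt with m≤n⇒m<n∨m≡n le
... | inj₂ refl = here refl
... | inj₁ a<j = there (∈-leaves⁺ c (suc a) m a<j (subst (j <_) (+-suc a m) lt))

broom-connected : ∀ t s₁ s₂ → Connected (broomSize t s₁ s₂) (doubleBroomEdges t s₁ s₂)
broom-connected t s₁ s₂ P step P0 {i} i<K = by (i Data.Nat.≤? t) (i Data.Nat.<? suc t + s₁)
  where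
  path : ∀ i → i ≤ t → P i
  path zero _ = P0
  path (suc i) lt = proj₁ (step (∈-++⁺ˡ (∈-chain⁺ 0 t z≤n lt))) (path i (<⇒≤ lt))
  by : Dec (i ≤ t) → Dec (i < suc t + s₁) → P i
  by (yes i≤t) _ = path i i≤t
  by (no i≰t) (yes lt) = proj₁ (step (∈-++⁺ʳ (chain 0 t) (∈-++⁺ˡ (∈-leaves⁺ 0 (suc t) s₁ (≰⇒> i≰t) lt)))) P0
  by (no _) (no ge) = proj₁ (step (∈-++⁺ʳ (chain 0 t) (∈-++⁺ʳ (leaves 0 (suc t) s₁) (∈-leaves⁺ t (suc t + s₁) s₂ (≮⇒≥ ge) i<K))))
    (path t ≤-refl)

odd : ℕ → Bool
odd zero = false
odd (suc n) = not (odd n)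

-- The bipartition demanded by `pendant-bipartite-emb`: parity along the path, and for each leaf the
-- opposite of its neighbour.
broomColour : ℕ → ℕ → ℕ → Bool
broomColour t s₁ i with i Data.Nat.≤? t | i Data.Nat.<? suc t + s₁
... | yes _ | _ = odd i
... | no _ | yes _ = true
... | no _ | no _ = not (odd t)

broomColour-path : ∀ t s₁ {i} → i ≤ t → broomColour t s₁ i ≡ odd i
broomColour-path t s₁ {i} le with i Data.Nat.≤? t
... | yes _ = refl
... | no nle = contradiction le nle

broomColour-leaf₁ : ∀ t s₁ {i} → t < i → i < suc t + s₁ → broomColour t s₁ i ≡ true
broomColour-leaf₁ t s₁ {i} gt lt with i Data.Nat.≤? t | i Data.Nat.<? suc t + s₁
... | yes le | _ = contradiction gt (≤⇒≯ le)
... | no _ | yes _ = refl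
... | no _ | no nlt = contradiction lt nlt

broomColour-leaf₂ : ∀ t s₁ {i} → suc t + s₁ ≤ i → broomColour t s₁ i ≡ not (odd t)
broomColour-leaf₂ t s₁ {i} ge with i Data.Nat.≤? t | i Data.Nat.<? suc t + s₁
... | yes le | _ = contradiction (≤-trans (m≤m+n (suc t) s₁) ge) (≤⇒≯ le)
... | no _ | yes lt = contradiction ge (<⇒≱ lt)
... | no _ | no _ = refl

broomColour-proper : ∀ t s₁ s₂ {i j} → (i , j) ∈ doubleBroomEdges t s₁ s₂ → broomColour t s₁ i ≢ broomColour t s₁ j
broomColour-proper t s₁ s₂ p e with broomEdge t s₁ s₂ p
... | on-path {i} h = not-≢ (odd i) (sym (trans (sym (broomColour-path t s₁ (<⇒≤ h))) (trans e (broomColour-path t s₁ h))))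
... | leaf₁ lo hi = contradiction (trans (sym (broomColour-path t s₁ z≤n)) (trans e (broomColour-leaf₁ t s₁ lo hi))) λ ()
... | leaf₂ lo hi = not-≢ (odd t) (sym (trans (sym (broomColour-path t s₁ ≤-refl)) (trans e (broomColour-leaf₂ t s₁ lo))))

⌈n/2⌉-bounds : ∀ n → n ≤ ⌈ n /2⌉ + ⌈ n /2⌉ × ⌈ n /2⌉ + ⌈ n /2⌉ ≤ suc n
⌈n/2⌉-bounds n = ≤-trans (≤-reflexive (sym (⌊n/2⌋+⌈n/2⌉≡n n))) (+-monoˡ-≤ ⌈ n /2⌉ (⌊n/2⌋≤⌈n/2⌉ n)) , upper n
  where
  upper : ∀ n → ⌈ n /2⌉ + ⌈ n /2⌉ ≤ suc n
  upper zero = z≤n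
  upper (suc zero) = ≤-refl
  upper (suc (suc n)) = s≤s (subst (_≤ suc (suc n)) (sym (+-suc ⌈ n /2⌉ ⌈ n /2⌉)) (s≤s (upper n)))

⌊n/2⌋-double : ∀ n → ⌊ n /2⌋ + ⌊ n /2⌋ ≤ n
⌊n/2⌋-double n = ≤-trans (+-monoʳ-≤ ⌊ n /2⌋ (⌊n/2⌋≤⌈n/2⌉ n)) (≤-reflexive (⌊n/2⌋+⌈n/2⌉≡n n))

module LargeBroom (t a b : ℕ) (a<b : a < b) where

  s₁ = suc a
  s₂ = suc b
  K = broomSize t s₁ s₂
  q = t + a + b
  es = doubleBroomEdges t s₁ s₂
  H = doubleBroom t s₁ s₂
  κ = ⌈ t /2⌉

  -- `LB` leaves room for a path with its leaves among the blue neighbours of one vertex. `LS` is K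
  -- vertices besides `s` and `z`. `LQ` is K clique vertices after removing these and the blue
  -- neighbours, fewer than `LB` each, of K + 1 vertices. `r` blocks contain at least `LS`²
  -- vertices. `C₀` adds up the bounds for the parts of `Y₀`, and `N₀` the demands on n.
  LB LS LQ r C₀ N₀ : ℕ
  LB = K + (2 + K)
  LS = K + 2
  LQ = K + (2 + K + suc K * LB)
  r = LS * LS
  C₀ = LS + ((K + 2) + ((K + 2) + (r * (t + s₁ + s₂) + 3)))
  N₀ = ramseyBound LQ LQ + ((s₂ + (t + s₁ + C₀)) + suc (levelBound (supplyBound t s₁ κ) C₀ κ + C₀))

  bd = broom-bounded t s₁ s₂
  ll = broom-loopless t s₁ s₂
  conn = broom-connected t s₁ s₂

  e₀ : (0 , suc t) ∈ es
  e₀ = ∈-++⁺ʳ (chain 0 t) (here refl)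

  s₁≤K : s₁ ≤ K
  s₁≤K = ≤-trans (m≤n+m s₁ (suc t)) (m≤m+n _ s₂)

  s₂≤K : s₂ ≤ K
  s₂≤K = m≤n+m s₂ (suc t + s₁)

  module _ {n : ℕ} (big : N₀ ≤ n) (c : Coloring n) where

    private V = Fin n

    Nim : V → V → Set
    Nim = NimEdge bd e₀ conn c

    Nim-sym : ∀ {u v} → Nim u v → Nim v u
    Nim-sym = nimEdge-sym bd e₀ conn c

    nb : V → List V
    nb = nbrs bd e₀ conn c

    module _ {β : Bool} {Q : List V} (Q-len : length Q ≡ LQ) (cl : MonoClique c β Q) where

      private
        uQ = proj₁ cl

        blue? : ∀ v x → Dec (col c v x ≡ β)
        blue? v x = col c v x ≟B β

        blueQ : V → List V
        blueQ v = filter (blue? v) Q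

        blueQ-unique : ∀ v → Unique (blueQ v)
        blueQ-unique v = UP.filter⁺ (blue? v) uQ

        ∈-blueQ⁻ : ∀ {v x} → x ∈ blueQ v → x ∈ Q × col c v x ≡ β
        ∈-blueQ⁻ {v} = ∈-filter⁻ (blue? v)

        Attached : V → Set
        Attached v = LB ≤ length (blueQ v)

        attached? : ∀ v → Dec (Attached v)
        attached? v = LB Data.Nat.≤? length (blueQ v)

      attached⇒¬blue-Nim : ∀ {u w} → Attached u → Nim u w → col c u w ≢ β
      attached⇒¬blue-Nim {u} {w} at (nim , u≢w) uw
        with choose (u ∷ w ∷ []) K (blueQ-unique u) (≤-trans (+-monoʳ-≤ K (m≤m+n 2 K)) at)
      ... | qs , l , uqs , h = pendant-¬NIM c bd ll (broom-pendant t s₁ s₂) (broom-pendant-≢ t s₁) (broom-pendant-edge t s₁ b)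
          (uqs , λ i k → proj₂ cl (inQ i) (inQ k)) (≤-reflexive (sym l))
          (λ i → proj₂ (h i) (here refl)) (λ i → proj₂ (h i) (there (here refl))) u≢w (λ i → proj₂ (∈-blueQ⁻ (proj₁ (h i)))) uw nim
        where
        inQ : ∀ {x} → x ∈ qs → x ∈ Q
        inQ i = proj₁ (∈-blueQ⁻ (proj₁ (h i)))

      Un : List V
      Un = filter (λ v → ¬? (attached? v)) (allFin n)

      ∈-Un⁺ : ∀ {v} → ¬ Attached v → v ∈ Un
      ∈-Un⁺ = ∈-filter⁺ (λ v → ¬? (attached? v)) (∈-allFin _)

      -- Unattached vertices are red to almost all of `Q`. With K of them besides `s` and `z`, and K
      -- vertices of `Q` red to these and to `s`, the bipartite embedding yields a red copy with
      -- pendant edge `s z`.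
      few-unattached : ∀ {s z} → ¬ Attached s → Nim s z → col c s z ≡ not β → length Un < LS
      few-unattached {s} {z} s-un (nim , s≢z) sz = ≰⇒> λ le → withS (choose (s ∷ z ∷ []) K (UP.filter⁺ (λ v → ¬? (attached? v)) (UP.allFin⁺ n)) le)
        where
        withS : (∃ λ S → length S ≡ K × Unique S × (∀ {x} → x ∈ S → x ∈ Un × x ∉ s ∷ z ∷ [])) → ⊥
        withS (S , lS , uS , hS) = withQs (choose bad K uQ (≤-trans (+-monoʳ-≤ K bad-len) (≤-reflexive (sym Q-len))))
          where
          bad = (s ∷ z ∷ S) ++ concatMap blueQ (s ∷ S)
          unattached : ∀ {x} → x ∈ s ∷ S → ¬ Attached x
          unattached (here refl) = s-un
          unattached (there i) = proj₂ (∈-filter⁻ (λ v → ¬? (attached? v)) {xs = allFin n} (proj₁ (hS i)))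
          bad-len : length bad ≤ 2 + K + suc K * LB
          bad-len = ≤-trans (≤-reflexive (LP.length-++ (s ∷ z ∷ S))) (+-mono-≤ (≤-reflexive (cong (2 +_) lS))
            (subst (λ m → length (concatMap blueQ (s ∷ S)) ≤ suc m * LB) lS
              (length-concatMap≤ blueQ LB (s ∷ S) λ i → <⇒≤ (≰⇒> (unattached i)))))
          withQs : (∃ λ T → length T ≡ K × Unique T × (∀ {x} → x ∈ T → x ∈ Q × x ∉ bad)) → ⊥
          withQs (T , lT , uT , hT)
            with pendant-bipartite-emb c {not β} bd ll (broom-pendant t s₁ s₂) (broom-pendant-≢ t s₁)
              (broomColour t s₁) (broomColour-proper t s₁ s₂) uS uT (≤-reflexive (sym lS)) (≤-reflexive (sym lT))
              (λ i k → proj₂ (hT k) (there (there (∈-++⁺ˡ i)))) s z s≢z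
              (λ i → proj₂ (hS i) (here refl)) (λ i → proj₂ (hT i) (here refl))
              (λ i → proj₂ (hS i) (there (here refl))) (λ i → proj₂ (hT i) (there (here refl)))
              (λ i k → red (there i) k) (red (here refl)) sz
            where
            red : ∀ {x y} → x ∈ s ∷ S → y ∈ T → col c x y ≡ not β
            red {x} {y} i k with bool-cases (col c x y) β
            ... | inj₂ e = e
            ... | inj₁ e = contradiction (∈-++⁺ʳ (s ∷ z ∷ S) (∈-concat⁺′ (∈-filter⁺ (blue? x) (proj₁ (hT k)) e) (∈-map⁺ blueQ i))) (proj₂ (hT k))
          ... | f , em , fz , fs = emb⇒¬NIM c bd em (broom-pendant-edge t s₁ b) (subst₂ (NIM H c) (sym fs) (sym fz) nim)

      BA : V → List V
      BA σ = filter (λ v → attached? v ×-dec blue? σ v) (allFin n)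

      -- Otherwise `σ τ` is a leaf edge of a blue copy: the other leaves at `σ` come from `BA σ`,
      -- and the path leaves `σ` through an attached vertex `u` and continues, like the remaining
      -- leaves, among the blue neighbours of `u` in the clique.
      few-blue-attached : ∀ {σ τ} → Nim σ τ → col c σ τ ≡ β → length (BA σ) < K + 2
      few-blue-attached {σ} {τ} (nim , σ≢τ) στ = ≰⇒> (by t refl)
        where
        uBA : Unique (BA σ)
        uBA = UP.filter⁺ (λ v → attached? v ×-dec blue? σ v) (UP.allFin⁺ n)
        ∈-BA⁻ : ∀ {v} → v ∈ BA σ → Attached v × col c σ v ≡ β
        ∈-BA⁻ i = proj₂ (∈-filter⁻ (λ v → attached? v ×-dec blue? σ v) {xs = allFin n} i)
        conclude : ∀ {P₀ L₁ L₂} → length P₀ ≡ t → length L₁ ≡ s₁ → length L₂ ≡ b → Unique (P₀ ++ [ σ ]) →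
          Chain (λ x y → col c x y ≡ β) (P₀ ++ [ σ ]) → Unique L₁ → Unique L₂ →
          (∀ {x} → x ∈ L₁ → col c (headOr σ P₀) x ≡ β) → (∀ {x} → x ∈ L₂ → col c σ x ≡ β) →
          (∀ {x} → x ∈ L₁ → x ∉ P₀ ++ [ σ ]) → (∀ {x} → x ∈ L₂ → x ∉ P₀ ++ [ σ ]) → (∀ {x} → x ∈ L₁ → x ∉ L₂) →
          τ ∉ P₀ → τ ∉ L₁ → τ ∉ L₂ → ⊥
        conclude {P₀} {L₁} {L₂} lP l₁ l₂ uP ch u₁ u₂ h₁ h₂ d₁ d₂ d₁₂ τP τ₁ τ₂ =
          broom⇒¬NIM c {P₀ = P₀} {L₁ = L₁} {L₂ = τ ∷ L₂}
            (mkBroom lP l₁ (cong suc l₂) uP ch u₁ (unique-∷ τ₂ u₂) h₁ (λ { (here refl) → στ ; (there i) → h₂ i }) d₁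
              (λ { (here refl) i → [ τP , (λ { (here e) → σ≢τ (sym e) }) ]′ (∈-++⁻ P₀ i) ; (there i) → d₂ i })
              λ { i (here refl) → τ₁ i ; i (there k) → d₁₂ i k })
            (∈-++⁺ʳ (lnks (P₀ ++ [ σ ])) (∈-++⁺ʳ (map (headOr σ P₀ ,_) L₁) (here refl))) nim
        by : ∀ t′ → t′ ≡ t → K + 2 ≤ length (BA σ) → ⊥
        -- For a one-vertex path both groups of leaves hang at `σ`, and `BA σ` supplies them all.
        by zero t≡ le with choose (σ ∷ τ ∷ []) s₁ uBA (≤-trans (+-monoˡ-≤ 2 s₁≤K) le)
        ... | L₁ , l₁ , u₁ , h₁ with choose (σ ∷ τ ∷ L₁) b uBA (≤-trans bound le)
          where
          bound : b + length (σ ∷ τ ∷ L₁) ≤ K + 2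
          bound = ≤-trans (≤-reflexive (trans (cong (λ m → b + (2 + m)) l₁) (trans (sym (+-assoc b 2 s₁)) (trans (+-comm (b + 2) s₁) (sym (+-assoc s₁ b 2))))))
            (+-monoˡ-≤ 2 (+-mono-≤ (m≤n+m s₁ (suc t)) (n≤1+n b)))
        ...   | L₂ , l₂ , u₂ , h₂ = conclude {[]} t≡ l₁ l₂ ([] ∷ []) (λ ()) u₁ u₂
            (λ i → proj₂ (∈-BA⁻ (proj₁ (h₁ i)))) (λ i → proj₂ (∈-BA⁻ (proj₁ (h₂ i))))
            (λ { i (here refl) → proj₂ (h₁ i) (here refl) }) (λ { i (here refl) → proj₂ (h₂ i) (here refl) })
            (λ i k → proj₂ (h₂ k) (there (there i))) (λ ()) (λ i → proj₂ (h₁ i) (there (here refl))) (λ i → proj₂ (h₂ i) (there (here refl)))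
        by (suc t₀) t≡ le with choose (σ ∷ τ ∷ []) 1 uBA (≤-trans (+-monoˡ-≤ 2 (s≤s z≤n)) le)
        ... | u ∷ [] , _ , _ , hu with choose (u ∷ σ ∷ τ ∷ []) b uBA (≤-trans (≤-trans (≤-reflexive (+-suc b 2)) (+-monoˡ-≤ 2 s₂≤K)) le)
        ... | L₂ , l₂ , u₂ , h₂ with choose (u ∷ σ ∷ τ ∷ L₂) t₀ (blueQ-unique u) (≤-trans bound at)
          where
          at = proj₁ (∈-BA⁻ (proj₁ (hu (here refl))))
          bound : t₀ + length (u ∷ σ ∷ τ ∷ L₂) ≤ LB
          bound = +-mono-≤ (≤-trans (≤-trans (n≤1+n t₀) (≤-reflexive t≡)) (≤-trans (n≤1+n t) (≤-trans (m≤m+n (suc t) s₁) (m≤m+n _ s₂))))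
            (s≤s (s≤s (subst (λ m → suc m ≤ K) (sym l₂) s₂≤K)))
        ... | ps , lp , up , hp with choose (ps ++ u ∷ σ ∷ τ ∷ L₂) s₁ (blueQ-unique u) (≤-trans bound at)
          where
          at = proj₁ (∈-BA⁻ (proj₁ (hu (here refl))))
          bound : s₁ + length (ps ++ u ∷ σ ∷ τ ∷ L₂) ≤ LB
          bound = begin
              s₁ + length (ps ++ u ∷ σ ∷ τ ∷ L₂) ≡⟨ cong (s₁ +_) (trans (LP.length-++ ps) (cong₂ (λ x y → x + (3 + y)) lp l₂)) ⟩
              s₁ + (t₀ + (3 + b)) ≡⟨ trans (sym (+-assoc s₁ t₀ _)) (cong (_+ (3 + b)) (+-comm s₁ t₀)) ⟩
              t₀ + s₁ + (3 + b) ≤⟨ +-mono-≤ (≤-trans (+-monoˡ-≤ s₁ (≤-trans (≤-trans (n≤1+n t₀) (≤-reflexive t≡)) (n≤1+n t))) (m≤m+n _ s₂)) (s≤s (s≤s s₂≤K)) ⟩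
              LB ∎
            where open ≤-Reasoning
        ... | L₁ , l₁ , u₁ , h₁ = conclude {ps ++ [ u ]}
            (trans (LP.length-++ ps) (trans (cong (_+ 1) lp) (trans (+-comm t₀ 1) t≡))) l₁ l₂
            (subst Unique (sym assoc) (unique-++ up (unique-∷ (λ { (here e) → u≢σ e }) ([] ∷ []))
              λ { i (here refl) → proj₂ (hp i) (here refl) ; i (there (here refl)) → proj₂ (hp i) (there (here refl)) }))
            (λ {x} {y} i → chain′ (subst (λ l → (x , y) ∈ lnks l) assoc i)) u₁ u₂
            (λ i → head-blue (head∈ ps) i) (λ i → proj₂ (∈-BA⁻ (proj₁ (h₂ i))))
            (λ {x} i k → proj₂ (h₁ i) (sub₁ (subst (x ∈_) assoc k)))
            (λ {x} i k → d₂ i (subst (x ∈_) assoc k)) (λ i k → proj₂ (h₁ i) (∈-++⁺ʳ ps (there (there (there k)))))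
            (λ i → [ (λ m → proj₂ (hp m) (there (there (here refl)))) , (λ { (here refl) → proj₂ (hu (here refl)) (there (here refl)) }) ]′ (∈-++⁻ ps i))
            (λ i → proj₂ (h₁ i) (∈-++⁺ʳ ps (there (there (here refl))))) (λ i → proj₂ (h₂ i) (there (there (here refl))))
          where
          E : V → V → Set
          E x y = col c x y ≡ β
          assoc : (ps ++ [ u ]) ++ [ σ ] ≡ ps ++ u ∷ σ ∷ []
          assoc = LP.++-assoc ps [ u ] [ σ ]
          u≢σ : u ≢ σ
          u≢σ refl = proj₂ (hu (here refl)) (here refl)
          u-blue : ∀ {x} → x ∈ ps ⊎ x ∈ L₁ → x ∈ Q × col c u x ≡ β
          u-blue (inj₁ i) = ∈-blueQ⁻ (proj₁ (hp i))
          u-blue (inj₂ i) = ∈-blueQ⁻ (proj₁ (h₁ i))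
          clique-chain : ∀ xs → Unique xs → (∀ {x} → x ∈ xs → x ∈ Q) → Chain E xs
          clique-chain (x ∷ xs) ux sub i = proj₂ cl (sub (proj₁ (lnk-∈ i))) (sub (there (proj₂ (lnk-∈ i)))) (lnk-≢ ux i)
          chain′ : Chain E (ps ++ u ∷ σ ∷ [])
          chain′ = chain-++ {E = E} ps (clique-chain ps up (λ i → proj₁ (u-blue (inj₁ i)))) (λ i → trans (csym c _ _) (proj₂ (u-blue (inj₁ i))))
            λ { (here refl) → trans (csym c _ _) (proj₂ (∈-BA⁻ (proj₁ (hu (here refl))))) }
          head∈ : ∀ ps → headOr σ (ps ++ [ u ]) ∈ ps ++ [ u ]
          head∈ [] = here refl
          head∈ (x ∷ ps) = here refl
          head-blue : ∀ {y x} → y ∈ ps ++ [ u ] → x ∈ L₁ → col c y x ≡ β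
          head-blue i k with ∈-++⁻ ps i
          ... | inj₂ (here refl) = proj₂ (u-blue (inj₂ k))
          ... | inj₁ m = proj₂ cl (proj₁ (u-blue (inj₁ m))) (proj₁ (u-blue (inj₂ k))) λ { refl → proj₂ (h₁ k) (∈-++⁺ˡ m) }
          sub₁ : ∀ {x} → x ∈ ps ++ u ∷ σ ∷ [] → x ∈ ps ++ u ∷ σ ∷ τ ∷ L₂
          sub₁ i with ∈-++⁻ ps i
          ... | inj₁ m = ∈-++⁺ˡ m
          ... | inj₂ (here e) = ∈-++⁺ʳ ps (here e)
          ... | inj₂ (there (here e)) = ∈-++⁺ʳ ps (there (here e))
          d₂ : ∀ {x} → x ∈ L₂ → x ∉ ps ++ u ∷ σ ∷ []
          d₂ i k with ∈-++⁻ ps k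
          ... | inj₁ m = proj₂ (hp m) (there (there (there i)))
          ... | inj₂ (here refl) = proj₂ (h₂ i) (here refl)
          ... | inj₂ (there (here refl)) = proj₂ (h₂ i) (there (here refl))

      -- As |H| = q + 3, this says that the NIM-degree is below (|H| - 2) / 2.
      Low : V → Set
      Low x = suc (length (nb x) + length (nb x)) ≤ suc q

      low? : ∀ x → Dec (Low x)
      low? x = suc (length (nb x) + length (nb x)) Data.Nat.≤? suc q

      X₀ : List V
      X₀ = filter low? (allFin n)

      p≡ : t + s₁ + s₂ ≡ suc (suc q)
      p≡ = trans (cong (_+ s₂) (+-suc t a)) (cong suc (+-suc (t + a) b))

      few-low-degree : length Un < LS → ∀ {m k} → IsEx n H m → HasCard (NIM H c) k → m < k → length X₀ < r * (t + s₁ + s₂)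
      few-low-degree lUn ex hc m<k = ≰⇒> λ le → <⇒≱ m<k (few-low bd e₀ conn c inUn
          (UP.take⁺ M (UP.filter⁺ low? (UP.allFin⁺ n))) {r} (length-take≤ M le) ex hc {⌊ q /2⌋} low
          (≤-trans (s≤s (⌊n/2⌋-double q)) (≤-reflexive (sym (cong (_∸ 1) p≡))))
          (≤-trans (*-mono-≤ (<⇒≤ lUn) (<⇒≤ lUn)) (≤-trans (≤-trans (≤-reflexive (sym (*-identityʳ r)))
            (*-monoʳ-≤ r (subst (1 ≤_) (sym p≡) (s≤s z≤n)))) (≤-reflexive (sym (length-take≤ M le))))))
        where
        M = r * (t + s₁ + s₂)
        inUn : ∀ {u v} → Nim u v → col c u v ≡ β → u ∈ Un
        inUn nim e = ∈-Un⁺ λ at → attached⇒¬blue-Nim at nim e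
        low : ∀ {x} → x ∈ take M X₀ → length (nb x) ≤ ⌊ q /2⌋
        low {x} i with proj₂ (∈-filter⁻ low? {xs = allFin n} (∈-take M i))
        ... | s≤s le = ≤-trans (≤-reflexive (n≡⌊n+n/2⌋ (length (nb x)))) (⌊n/2⌋-mono le)

      -- Twice the degree is at least q + 1 = t + a + b + 1, and `a<b` makes this at least t + 2s₁.
      -- Integrality rounds t / 2 up to κ.
      high-degree : ∀ {x} → ¬ Low x → s₁ + κ ≤ length (nb x)
      high-degree {x} nlow = ≮⇒≥ λ lt → <⇒≱ (too-small lt) (≤-pred (≰⇒> nlow))
        where
        D = length (nb x)
        too-small : D < s₁ + κ → D + D < suc q
        too-small lt = ≤-pred (begin
            suc (suc (D + D)) ≡⟨ cong suc (+-suc D D) ⟨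
            suc D + suc D ≤⟨ +-mono-≤ lt lt ⟩
            (s₁ + κ) + (s₁ + κ) ≡⟨ solve 2 (λ s k → (s :+ k) :+ (s :+ k) := (k :+ k) :+ (s :+ s)) refl s₁ κ ⟩
            (κ + κ) + (s₁ + s₁) ≤⟨ +-monoˡ-≤ (s₁ + s₁) (proj₂ (⌈n/2⌉-bounds t)) ⟩
            suc t + (s₁ + s₁) ≡⟨ solve 2 (λ t a → con 1 :+ t :+ (con 1 :+ a :+ (con 1 :+ a)) := con 2 :+ ((t :+ a) :+ (con 1 :+ a))) refl t a ⟩
            suc (suc (t + a + suc a)) ≤⟨ s≤s (s≤s (+-monoʳ-≤ (t + a) a<b)) ⟩
            suc (suc q) ∎)
          where
          open ≤-Reasoning
          open import Data.Nat.Solver using (module +-*-Solver)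
          open +-*-Solver

      no-two-colours : ∀ {m k} → IsEx n H m → HasCard (NIM H c) k → m < k →
        ∀ {s s′ z} → Nim s s′ → Nim s z → col c s s′ ≡ β → col c s z ≡ not β → ⊥
      no-two-colours ex hc m<k {s} {s′} {z} ss′ sz ss′-blue sz-red =
        Assembly.impossible {n} t s₁ s₂ κ (proj₁ (⌈n/2⌉-bounds t)) (s≤s z≤n) (s≤s z≤n)
          (λ u v → col c u v ≡ not β) (trans (csym c _ _)) Nim Nim-sym (λ e → proj₂ e refl)
          nb (nbrs-unique bd e₀ conn c) (∈-nbrs⁻ bd e₀ conn c) (λ br i nim → broom⇒¬NIM c br i (proj₁ nim))
          s s′ z (proj₂ ss′) (proj₂ sz) s′≢z sz-red sz
          Y₀ (∈-Y₀ (here refl)) (∈-Y₀ (there (here refl))) (∈-Y₀ (there (there (here refl))))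
          (λ v∉ → red-to ss′ ss′-blue v∉ (λ i → v∉ (∈-++⁺ʳ Un (∈-++⁺ˡ i))))
          (λ v∉ → red-to (Nim-sym ss′) (trans (csym c _ _) ss′-blue) v∉ (λ i → v∉ (∈-++⁺ʳ Un (∈-++⁺ʳ (BA s) (∈-++⁺ˡ i)))))
          (λ u∉ nim → not-blue (attached⇒¬blue-Nim (attached u∉) nim))
          (λ v∉ → high-degree λ low → v∉ (∈-++⁺ʳ Un (∈-++⁺ʳ (BA s) (∈-++⁺ʳ (BA s′) (∈-++⁺ˡ (∈-filter⁺ low? (∈-allFin _) low))))))
          C₀ Y₀-len (≤-trans (≤-trans (m≤m+n (s₂ + (t + s₁ + C₀)) _) (m≤n+m _ (ramseyBound LQ LQ))) big)
          (≤-trans (≤-trans (m≤n+m _ (s₂ + (t + s₁ + C₀))) (m≤n+m _ (ramseyBound LQ LQ))) big)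
        where
        s-un : ¬ Attached s
        s-un at = attached⇒¬blue-Nim at ss′ ss′-blue
        lUn : length Un < LS
        lUn = few-unattached s-un sz sz-red
        s′≢z : s′ ≢ z
        s′≢z refl = not-≢ β (trans (sym sz-red) ss′-blue)
        -- Outside `Un` all NIM-edges are red; outside `BA s` and `BA s′` as well, a vertex is red
        -- to `s` and `s′`; outside `X₀` its degree is large.
        Y₀ = Un ++ BA s ++ BA s′ ++ X₀ ++ s ∷ s′ ∷ z ∷ []
        ∈-Y₀ : ∀ {x} → x ∈ s ∷ s′ ∷ z ∷ [] → x ∈ Y₀
        ∈-Y₀ i = ∈-++⁺ʳ Un (∈-++⁺ʳ (BA s) (∈-++⁺ʳ (BA s′) (∈-++⁺ʳ X₀ i)))
        not-blue : ∀ {u v} → col c u v ≢ β → col c u v ≡ not β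
        not-blue {u} {v} ne = [ (λ e → contradiction e ne) , id ]′ (bool-cases (col c u v) β)
        attached : ∀ {v} → v ∉ Y₀ → Attached v
        attached {v} v∉ with attached? v
        ... | yes at = at
        ... | no nat = contradiction (∈-++⁺ˡ (∈-Un⁺ nat)) v∉
        red-to : ∀ {σ τ} → Nim σ τ → col c σ τ ≡ β → ∀ {v} → v ∉ Y₀ → v ∉ BA σ → col c v σ ≡ not β
        red-to {σ} _ _ {v} v∉ v∉BA = trans (csym c _ _) (not-blue λ e →
          v∉BA (∈-filter⁺ (λ w → attached? w ×-dec blue? σ w) (∈-allFin _) (attached v∉ , e)))
        Y₀-len : length Y₀ ≤ C₀
        Y₀-len = begin
            length Y₀ ≡⟨ trans (LP.length-++ Un) (cong (length Un +_) (trans (LP.length-++ (BA s)) (cong (length (BA s) +_)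
                          (trans (LP.length-++ (BA s′)) (cong (length (BA s′) +_) (LP.length-++ X₀)))))) ⟩
            length Un + (length (BA s) + (length (BA s′) + (length X₀ + 3)))
              ≤⟨ +-mono-≤ (<⇒≤ lUn) (+-mono-≤ (<⇒≤ (few-blue-attached ss′ ss′-blue))
                  (+-mono-≤ (<⇒≤ (few-blue-attached (Nim-sym ss′) (trans (csym c _ _) ss′-blue)))
                    (+-monoˡ-≤ 3 (<⇒≤ (few-low-degree lUn ex hc m<k))))) ⟩
            C₀ ∎
          where open ≤-Reasoning

    upper : ∀ {m k} → IsEx n H m → HasCard (NIM H c) k → ¬ m < k
    upper ex hc m<k with ramsey c LQ (≤-trans (m≤m+n (ramseyBound LQ LQ) _) big)
    ... | β , Q , Q-len , cl = <⇒≱ m<k (nimGraph-free⇒≤ex bd e₀ c free ex hc)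
      where
      monochromatic : ∀ {s u v} → Nim s u → Nim s v → col c s u ≡ col c s v
      monochromatic {s} {u} {v} su sv with bool-cases (col c s u) β | bool-cases (col c s v) β
      ... | inj₁ e | inj₁ e' = trans e (sym e')
      ... | inj₂ e | inj₂ e' = trans e (sym e')
      ... | inj₁ e | inj₂ e' = ⊥-elim (no-two-colours Q-len cl ex hc m<k su sv e e')
      ... | inj₂ e | inj₁ e' = ⊥-elim (no-two-colours Q-len cl ex hc m<k sv su e' e)
      free : ¬ Contains (nimGraph H c) H
      free (φ , inj , ed) = emb⇒¬NIM c bd {γ} (proj₁ em , colour) e₀ (proj₁ (proj₂ em e₀))
        where
        f = extend φ
        em : Emb Nim K es f
        em = copy⇒emb bd {Nim} φ inj λ x y p → nimGraph⁻ bd e₀ c (ed x y p)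
        γ = col c (f 0) (f (suc t))
        -- Each vertex sees a single colour on its NIM-edges, and connectivity carries this colour
        -- along the whole copy, which is therefore monochromatic.
        All-γ : ℕ → Set
        All-γ i = ∀ {v} → Nim (f i) v → col c (f i) v ≡ γ
        all-γ : ∀ {i} → i < K → All-γ i
        all-γ = broom-connected t s₁ s₂ All-γ
          (λ ij → (λ h nv → trans (monochromatic nv (Nim-sym (proj₂ em ij))) (trans (csym c _ _) (h (proj₂ em ij)))) ,
                  (λ h nv → trans (monochromatic nv (proj₂ em ij)) (trans (csym c _ _) (h (Nim-sym (proj₂ em ij))))))
          (λ nv → monochromatic nv (proj₂ em e₀))
        colour : ∀ {i j} → (i , j) ∈ es → col c (f i) (f j) ≡ γ
        colour ij = all-γ (proj₁ (bd ij)) (proj₂ em ij)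

  feqex : EventuallyFeqEx (doubleBroom t s₁ s₂)
  feqex = eventually-feqex bd e₀ N₀ λ n big c ex hc → upper big c ex hc

theorem1p2 : ((l : ℕ) (ls : List ℕ) → EventuallyFeqEx (spider l ls))
    × ((t' s₁ s₂ : ℕ) → s₁ < s₂ → EventuallyFeqEx (doubleBroom t' s₁ s₂))
theorem1p2 = spider-feqex , λ { t zero (suc b) _ → broom₀-feqex t b ; t (suc a) (suc b) (s≤s a<b) → LargeBroom.feqex t a b a<b }
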